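{- Let $w\in S_\infty$, let $k<l$, and let $\eta=\eta_1+2\eta_2\in B_{k,l}(w)$ with $|\eta_1|+2|\eta_2|=k+l$ and $k=|\eta_2|+2$ (so $|\eta_1|=l-k+4$). Write the elements of $\eta_1$ in increasing order as $\gamma_1<\gamma_2<\dots<\gamma_{l-k+4}$, and let $a<b$ and $c<d$ be the indices with $\beta_{\min}=\eta_2\cup\{\gamma_a,\gamma_b\}$ and $\beta_{\max}=\eta_2\cup\{\gamma_c,\gamma_d\}$. Set $\varepsilon=1$ if $b>c$ and $\varepsilon=0$ if $b<c$. Then $m^{k,l}_\eta(w)=d-a+1-\varepsilon(b-c)$.
   Context: Permutations in $S_\infty$ compose as functions, $s_i$ is the transposition of $i,i+1$, $\ell(w)$ the length. For $m\geq1$, $w^m$ is the increasing ordering of $w(1),\dots,w(m)$; $A_m(w)$ is the set of strictly increasing sequences $\alpha$ of $m$ positive integers with $\alpha_j\leq w^m_j$ for all $j$ (identified with sets); $\alpha\leq\gamma$ means entrywise $\leq$. $s_i\alpha$ is the increasing sequence with entry set $\{s_i(\alpha_j)\}$; $A_{m,i}(w)=\{\alpha\in A_m(w):s_i\alpha\notin A_m(w)\}$. A multi-set with multiplicities at most 2 is $\eta=\eta_1+2\eta_2$; $x^\alpha=\prod_jx_{\alpha_j}$, $x^\eta=\prod_{j\in\eta_1}x_j\prod_{j\in\eta_2}x_j^2$; $\alpha+\beta$ is multi-set union. $T_m=t_1\cdots t_m$; $\pi_if=(x_if-x_{i+1}s_if)/(x_i-x_{i+1})$. For $\ell(s_iw)>\ell(w)$,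 $N_{w,i}=\prod_{m}\prod_{\alpha\in A_{m,i}(w)}(1-x^{s_i\alpha}T_m)$; $P_{\mathrm{Id}}=1$, $P_{s_iw}=\pi_i(P_wN_{w,i})$ when $\ell(s_iw)>\ell(w)$ (well defined); $m^{k,l}_\eta(w)$ is minus the coefficient of $x^\eta T_kT_l$ in $P_w$. $B_{k,l}(w)$ is the set of $\eta$ with $\eta=\alpha+\beta=\tilde\alpha+\tilde\beta$ for some $\alpha,\tilde\alpha\in A_l(w)$, $\beta,\tilde\beta\in A_k(w)$ with $\alpha\neq\tilde\alpha,\alpha\neq\tilde\beta,\beta\neq\tilde\alpha,\beta\neq\tilde\beta$. $A^\eta_m(w)=\{\alpha\in A_m(w):\eta_2\subseteq\alpha\subseteq\eta_1\cup\eta_2\}$, which (when non-empty) has a unique element $\geq$ all its others; $\alpha_{\max}$ is this element for $A_l^\eta(w)$, $\beta_{\max}$ that for $A_k^\eta(w)$, and $\beta_{\min}$ is the set with $\alpha_{\max}+\beta_{\min}=\eta$. (For $\eta\in B_{k,l}(w)$ with these cardinalities, $\beta_{\min}$ and $\beta_{\max}$ each consist of $\eta_2$ and two elements of $\eta_1$.) -}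

module Defs where

open import Data.Bool using (Bool; true; false; _∧_; _∨_; not; if_then_else_)
open import Data.Nat using (ℕ; zero; suc; _+_; _*_; _∸_; _≤_; _<_; _≡ᵇ_; _≤ᵇ_; _<ᵇ_; _⊔_)
open import Data.Integer as ℤ using (ℤ; +_; -_)
open import Data.List using (List; []; _∷_; _++_; map; foldr; concatMap; replicate; upTo; length; lookup)
open import Data.Bool.ListAction using (any)
open import Data.List.Membership.Propositional using (_∈_)
open import Data.List.Relation.Unary.Linked using (Linked)
open import Data.List.Relation.Binary.Pointwise using (Pointwise)
open import Data.Product using (_×_; _,_; Σ; ∃)
open import Data.Sum using (_⊎_)
open import Data.Empty using (⊥)
open import Relation.Binary.PropositionalEquality using (_≡_)
open import Relation.Nullary using (¬_)

-- Basic list helpers (positive integers are represented by ℕ, values ≥ 1)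

range : ℕ → List ℕ
range n = map suc (upTo n)

maxL : List ℕ → ℕ
maxL = foldr _⊔_ 0

filterB : {A : Set} → (A → Bool) → List A → List A
filterB p [] = []
filterB p (x ∷ xs) = if p x then x ∷ filterB p xs else filterB p xs

memB : ℕ → List ℕ → Bool
memB x = any (λ y → y ≡ᵇ x)

ind : ℕ → List ℕ → ℕ
ind x xs = if memB x xs then 1 else 0

listEqB : List ℕ → List ℕ → Bool
listEqB [] [] = true
listEqB [] (_ ∷ _) = false
listEqB (_ ∷ _) [] = false
listEqB (x ∷ xs) (y ∷ ys) = (x ≡ᵇ y) ∧ listEqB xs ys

memLB : List ℕ → List (List ℕ) → Bool
memLB α = any (listEqB α)

insertL : ℕ → List ℕ → List ℕ
insertL x [] = x ∷ []
insertL x (y ∷ ys) = if x ≤ᵇ y then x ∷ y ∷ ys else y ∷ insertL x ys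

sortL : List ℕ → List ℕ
sortL = foldr insertL []

leqB : List ℕ → List ℕ → Bool
leqB [] [] = true
leqB [] (_ ∷ _) = false
leqB (_ ∷ _) [] = false
leqB (x ∷ xs) (y ∷ ys) = (x ≤ᵇ y) ∧ leqB xs ys

choose : ℕ → List ℕ → List (List ℕ)
choose zero _ = [] ∷ []
choose (suc m) [] = []
choose (suc m) (x ∷ xs) = map (x ∷_) (choose m xs) ++ choose (suc m) xs

-- Permutations of S_∞, given by words in the simple transpositions

sw : ℕ → ℕ → ℕ
sw i j = if j ≡ᵇ i then suc i else (if j ≡ᵇ suc i then i else j)

perm : List ℕ → ℕ → ℕ
perm [] j = j
perm (i ∷ ws) j = sw i (perm ws j)

-- a bound B such that perm ws fixes every j > B (and B exceeds every letter)
bound : List ℕ → ℕ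
bound ws = suc (maxL ws)

-- length ℓ(f) = number of inversions, for f fixing every j > B
countInv : (ℕ → ℕ) → ℕ → List ℕ → ℕ
countInv f p [] = 0
countInv f p (q ∷ qs) = (if (p <ᵇ q) ∧ (f q <ᵇ f p) then 1 else 0) + countInv f p qs

len : ℕ → (ℕ → ℕ) → ℕ
len B f = foldr (λ p acc → countInv f p (range B) + acc) 0 (range B)

wup : (ℕ → ℕ) → ℕ → List ℕ
wup w m = sortL (map w (range m))

-- A_m(w) : strictly increasing α of length m with α_j ≤ w^m_j.
-- All such α have entries ≤ w^m_m ≤ m + B, so enumerating subsets of [1..m+B] is complete.
A : ℕ → (ℕ → ℕ) → ℕ → List (List ℕ)
A B w m = filterB (λ α → leqB α (wup w m)) (choose m (range (m + B)))

sα : ℕ → List ℕ → List ℕ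
sα i α = sortL (map (sw i) α)

Ami : ℕ → (ℕ → ℕ) → ℕ → ℕ → List (List ℕ)
Ami B w m i = filterB (λ α → not (memLB (sα i α) (A B w m))) (A B w m)

-- Polynomials in x₁,x₂,… and t₁,t₂,… with integer coefficients.
-- An exponent vector lists the exponents of variables 1,2,3,… (missing = 0).

Exp : Set
Exp = List ℕ

addE : Exp → Exp → Exp
addE [] ys = ys
addE (x ∷ xs) [] = x ∷ xs
addE (x ∷ xs) (y ∷ ys) = (x + y) ∷ addE xs ys

eqE : Exp → Exp → Bool
eqE [] [] = true
eqE [] (y ∷ ys) = (y ≡ᵇ 0) ∧ eqE [] ys
eqE (x ∷ xs) [] = (x ≡ᵇ 0) ∧ eqE xs []
eqE (x ∷ xs) (y ∷ ys) = (x ≡ᵇ y) ∧ eqE xs ys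

-- monomial: (x-exponents , t-exponents)
Mono : Set
Mono = Exp × Exp

mulM : Mono → Mono → Mono
mulM (e , t) (e' , t') = addE e e' , addE t t'

eqM : Mono → Mono → Bool
eqM (e , t) (e' , t') = eqE e e' ∧ eqE t t'

-- a polynomial is a finite formal sum of terms (coefficient , monomial)
Poly : Set
Poly = List (ℤ × Mono)

coeff : Poly → Mono → ℤ
coeff [] m = + 0
coeff ((c , m') ∷ p) m = (if eqM m' m then c else + 0) ℤ.+ coeff p m

_≈P_ : Poly → Poly → Set
p ≈P q = ∀ m → coeff p m ≡ coeff q m

_+P_ : Poly → Poly → Poly
p +P q = p ++ q

negP : Poly → Poly
negP = map (λ { (c , m) → (- c , m) })

_-P_ : Poly → Poly → Poly
p -P q = p +P negP q

_*P_ : Poly → Poly → Poly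
p *P q = concatMap (λ { (c , m) → map (λ { (d , n) → (c ℤ.* d , mulM m n) }) q }) p

oneP : Poly
oneP = (+ 1 , ([] , [])) ∷ []

prodP : List Poly → Poly
prodP = foldr _*P_ oneP

-- exponent vector of the single variable with index i ≥ 1
unitE : ℕ → Exp
unitE i = replicate (i ∸ 1) 0 ++ (1 ∷ [])

xP : ℕ → Poly
xP i = (+ 1 , (unitE i , [])) ∷ []

xExp : List ℕ → Exp
xExp = foldr (λ j e → addE (unitE j) e) []

tExp : ℕ → Exp
tExp m = replicate m 1

-- swap the exponents of variables n+1 and n+2
swapAt : ℕ → Exp → Exp
swapAt zero [] = []
swapAt zero (x ∷ []) = 0 ∷ x ∷ []
swapAt zero (x ∷ y ∷ r) = y ∷ x ∷ r
swapAt (suc n) [] = []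
swapAt (suc n) (x ∷ xs) = x ∷ swapAt n xs

sP : ℕ → Poly → Poly
sP i = map (λ { (c , (e , t)) → (c , (swapAt (i ∸ 1) e , t)) })

IsPi : ℕ → Poly → Poly → Set
IsPi i f g = ((xP i -P xP (suc i)) *P g) ≈P ((xP i *P f) -P (xP (suc i) *P sP i f))

-- N_{w,i} = ∏_m ∏_{α ∈ A_{m,i}(w)} (1 − x^{s_i α} T_m)
-- (A_{m,i}(w) = ∅ for m > B when i < B, so m ranges over 1..B)
N : ℕ → (ℕ → ℕ) → ℕ → Poly
N B w i = prodP (concatMap (λ m → map (λ α → oneP -P ((+ 1 , (xExp (sα i α) , tExp m)) ∷ [])) (Ami B w m i)) (range B))

data IsP (B : ℕ) : List ℕ → Poly → Set where
  base : IsP B [] oneP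
  step : ∀ {ws P Q} (i : ℕ) → 1 ≤ i →
         len B (perm ws) < len B (λ j → sw i (perm ws j)) →
         IsP B ws P → IsPi i (P *P N B (perm ws) i) Q → IsP B (i ∷ ws) Q

cnt : List ℕ → List ℕ → ℕ → ℕ
cnt η₁ η₂ j = ind j η₁ + 2 * ind j η₂

IsSum : List ℕ → List ℕ → List ℕ → List ℕ → Set
IsSum η₁ η₂ α β = ∀ j → cnt η₁ η₂ j ≡ ind j α + ind j β

InB : ℕ → (ℕ → ℕ) → ℕ → ℕ → List ℕ → List ℕ → Set
InB B w k l η₁ η₂ =
  Σ (List ℕ) λ α → Σ (List ℕ) λ α~ → Σ (List ℕ) λ β → Σ (List ℕ) λ β~ →
    α ∈ A B w l × α~ ∈ A B w l × β ∈ A B w k × β~ ∈ A B w k ×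
    IsSum η₁ η₂ α β × IsSum η₁ η₂ α~ β~ ×
    ¬ α ≡ α~ × ¬ α ≡ β~ × ¬ β ≡ α~ × ¬ β ≡ β~

InAη : ℕ → (ℕ → ℕ) → ℕ → List ℕ → List ℕ → List ℕ → Set
InAη B w m η₁ η₂ α =
  α ∈ A B w m × (∀ x → x ∈ η₂ → x ∈ α) × (∀ x → x ∈ α → x ∈ η₁ ⊎ x ∈ η₂)

IsMaxAη : ℕ → (ℕ → ℕ) → ℕ → List ℕ → List ℕ → List ℕ → Set
IsMaxAη B w m η₁ η₂ α =
  InAη B w m η₁ η₂ α × (∀ α' → InAη B w m η₁ η₂ α' → Pointwise _≤_ α' α)

StrictInc : List ℕ → Set
StrictInc = Linked _<_

Disjoint : List ℕ → List ℕ → Set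
Disjoint xs ys = ∀ x → x ∈ xs → x ∈ ys → ⊥

target : List ℕ → List ℕ → ℕ → ℕ → Mono
target η₁ η₂ k l = addE (xExp η₁) (addE (xExp η₂) (xExp η₂)) , addE (tExp k) (tExp l)

-- P_w is the numerator of Σ_λ π_w(x^λ) t^λ over ∏_m ∏_{α ∈ A_m(w)} (1 − x^α T_m), so −m^{k,l}_η(w) is
-- the coefficient of x^η in π_w(x_1⋯x_k x_1⋯x_l) minus the number of pairs (α , β) ∈ A_l(w) × A_k(w) with α + β = η.
-- The former coefficient counts two-column tableaux: read the entries of η in order and make each element of η₁ an up step,
-- a down step or a level step of a path, level steps being allowed at height 0 only; β consists of η₂ and the down steps, the
-- first column of the right key consists of all of η except the up steps, and the two must lie in A_k(w) and A_l(w).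
-- Under w ↦ s_i w this number changes exactly as π_i prescribes: for entries (1 , 1) at (i , i + 1) only the pair (up , down)
-- is affected, and its contributions before and after are those of the entries (0 , 2) and (2 , 0).
-- For k = |η₂| + 2 membership in A_k(w) and A_l(w) bounds the two down steps by γ_c, γ_d and the two up steps by γ_a, γ_b,
-- and both counts are evaluated by recursion along η₁.
module Submission where

open import Defs
open import Data.Nat using (ℕ; zero; suc; pred; _+_; _*_; _∸_; _⊔_; _≤_; _<_; _≡ᵇ_; _≤ᵇ_; _<ᵇ_; z≤n; s≤s)
open import Data.Integer as ℤ using (ℤ; +_; -_; _-_)
open import Data.Bool using (Bool; true; false; _∧_; not; if_then_else_; T)
open import Data.List using (List; []; _∷_; _++_; map; foldr; concatMap; replicate; upTo; applyUpTo; length; lookup)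
open import Data.List.Membership.Propositional using (_∈_)
open import Data.List.Relation.Unary.Any using (here; there)
open import Data.List.Relation.Unary.All as All using (All; []; _∷_)
open import Data.List.Relation.Unary.Linked using (Linked; []; [-]; _∷_)
open import Data.List.Relation.Unary.Unique.Propositional using (Unique; []; _∷_)
open import Data.List.Relation.Binary.Pointwise using (Pointwise; []; _∷_)
open import Data.Fin as Fin using (Fin; toℕ)
open import Data.Product using (_×_; _,_; proj₁; proj₂; ∃)
open import Data.Sum using (_⊎_; inj₁; inj₂)
open import Data.Empty using (⊥; ⊥-elim)
open import Function.Base using (_∘_)
open import Function.Bundles using (_⇔_; Equivalence)
open import Relation.Nullary using (¬_; Dec; yes; no)
open import Relation.Binary.Definitions using (tri<; tri≈; tri>)
open import Relation.Binary.PropositionalEquality using (_≡_; refl; sym; trans; cong; cong₂; subst; subst₂; module ≡-Reasoning)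
open import Data.Integer.Tactic.RingSolver using (solve-∀)
import Data.Nat.Properties as ℕP
import Data.Integer.Properties as ℤP
import Data.Bool.Properties as BP
import Data.List.Properties as LP
import Data.Fin.Properties as FinP
import Data.List.Membership.Propositional.Properties as ∈P
import Data.List.Relation.Unary.All.Properties as AllP
import Data.List.Relation.Unary.AllPairs as AllPairs
import Data.List.Relation.Unary.Linked.Properties as LinkedP
import Data.List.Relation.Unary.Unique.Propositional.Properties as UP

-- Since π_i leaves t alone, P_w can be followed one t-exponent at a time; multiplication by the
-- factors 1 - x^ν T_m, however, mixes these exponents. The induction along the word therefore
-- carries four facts at once: constant term 1, no term in a single T_m, the coefficient of T_k T_l,
-- and vanishing wherever the exponents of t rise. The last fact disposes of every T_m that divides
-- T_k T_l without being T_k or T_l. No linear term arises because π_i kills the sum ε_m of the new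
-- x^{s_i α}; hence the factors change the coefficient of T_k T_l only by ε_k ε_l, exactly the
-- correction under which the product of the sums over A_k(w) and A_l(w) passes to s_i w. Level
-- steps are confined to height 0 in order to exclude the pairs (up , level) and (level , down):
-- these would put (0 , 1) at (i , i + 1) into just one of the two sets and would change by
-- themselves.

-- Boolean tests and the relations they decide

true≢false : ¬ true ≡ false
true≢false ()

≡ᵇ-sound : ∀ m n → (m ≡ᵇ n) ≡ true → m ≡ n
≡ᵇ-sound m n eq = ℕP.≡ᵇ⇒≡ m n (subst T (sym eq) _)

≡ᵇ-refl : ∀ n → (n ≡ᵇ n) ≡ true
≡ᵇ-refl zero = refl
≡ᵇ-refl (suc n) = ≡ᵇ-refl n

≡ᵇ-false : ∀ m n → ¬ m ≡ n → (m ≡ᵇ n) ≡ false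
≡ᵇ-false m n m≢n with m ≡ᵇ n in eq
... | true = ⊥-elim (m≢n (≡ᵇ-sound m n eq))
... | false = refl

≤ᵇ-sound : ∀ m n → (m ≤ᵇ n) ≡ true → m ≤ n
≤ᵇ-sound m n eq = ℕP.≤ᵇ⇒≤ m n (subst T (sym eq) _)

≤ᵇ-complete : ∀ {m n} → m ≤ n → (m ≤ᵇ n) ≡ true
≤ᵇ-complete {m} {n} m≤n with m ≤ᵇ n | ℕP.≤⇒≤ᵇ m≤n
... | true | _ = refl

≤ᵇ-false : ∀ {m n} → n < m → (m ≤ᵇ n) ≡ false
≤ᵇ-false {m} {n} n<m with m ≤ᵇ n in eq
... | true = ⊥-elim (ℕP.<⇒≱ n<m (≤ᵇ-sound m n eq))
... | false = refl

∧-elim : ∀ {a b} → a ∧ b ≡ true → a ≡ true × b ≡ true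
∧-elim {true} eq = refl , eq

bool-ext : ∀ {a b} → (a ≡ true → b ≡ true) → (b ≡ true → a ≡ true) → a ≡ b
bool-ext {true} {true} f g = refl
bool-ext {true} {false} f g = sym (f refl)
bool-ext {false} {true} f g = g refl
bool-ext {false} {false} f g = refl

-- Coefficients of products

nth : Exp → ℕ → ℕ
nth [] _ = 0
nth (x ∷ _) zero = x
nth (_ ∷ e) (suc j) = nth e j

eqE→nth : ∀ a b → eqE a b ≡ true → ∀ j → nth a j ≡ nth b j
eqE→nth [] [] eq j = refl
eqE→nth [] (y ∷ b) eq zero = sym (≡ᵇ-sound y 0 (proj₁ (∧-elim eq)))
eqE→nth [] (y ∷ b) eq (suc j) = eqE→nth [] b (proj₂ (∧-elim {y ≡ᵇ 0} eq)) j
eqE→nth (x ∷ a) [] eq zero = ≡ᵇ-sound x 0 (proj₁ (∧-elim eq))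
eqE→nth (x ∷ a) [] eq (suc j) = eqE→nth a [] (proj₂ (∧-elim {x ≡ᵇ 0} eq)) j
eqE→nth (x ∷ a) (y ∷ b) eq zero = ≡ᵇ-sound x y (proj₁ (∧-elim eq))
eqE→nth (x ∷ a) (y ∷ b) eq (suc j) = eqE→nth a b (proj₂ (∧-elim {x ≡ᵇ y} eq)) j

nth→eqE : ∀ a b → (∀ j → nth a j ≡ nth b j) → eqE a b ≡ true
nth→eqE [] [] eq = refl
nth→eqE [] (y ∷ b) eq rewrite sym (eq 0) = nth→eqE [] b (eq ∘ suc)
nth→eqE (x ∷ a) [] eq rewrite eq 0 = nth→eqE a [] (eq ∘ suc)
nth→eqE (x ∷ a) (y ∷ b) eq rewrite eq 0 | ≡ᵇ-refl y = nth→eqE a b (eq ∘ suc)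

eqE-cong : ∀ {a a' b b'} → (∀ j → nth a j ≡ nth a' j) → (∀ j → nth b j ≡ nth b' j) →
  eqE a b ≡ eqE a' b'
eqE-cong {a} {a'} {b} {b'} p q = bool-ext
  (λ h → nth→eqE a' b' λ j → trans (sym (p j)) (trans (eqE→nth a b h j) (q j)))
  (λ h → nth→eqE a b λ j → trans (p j) (trans (eqE→nth a' b' h j) (sym (q j))))

nth-addE : ∀ a b j → nth (addE a b) j ≡ nth a j + nth b j
nth-addE [] b j = refl
nth-addE (x ∷ a) [] j = sym (ℕP.+-identityʳ _)
nth-addE (x ∷ a) (y ∷ b) zero = refl
nth-addE (x ∷ a) (y ∷ b) (suc j) = nth-addE a b j

addE-[] : ∀ a → addE a [] ≡ a
addE-[] [] = refl
addE-[] (x ∷ a) = refl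

addE-comm : ∀ a b → addE a b ≡ addE b a
addE-comm [] b = sym (addE-[] b)
addE-comm (x ∷ a) [] = refl
addE-comm (x ∷ a) (y ∷ b) = cong₂ _∷_ (ℕP.+-comm x y) (addE-comm a b)

addE-assoc : ∀ a b c → addE (addE a b) c ≡ addE a (addE b c)
addE-assoc [] b c = refl
addE-assoc (x ∷ a) [] c = refl
addE-assoc (x ∷ a) (y ∷ b) [] = refl
addE-assoc (x ∷ a) (y ∷ b) (z ∷ c) = cong₂ _∷_ (ℕP.+-assoc x y z) (addE-assoc a b c)

leqE : Exp → Exp → Bool
leqE [] e = true
leqE (x ∷ ν) [] = (x ≡ᵇ 0) ∧ leqE ν []
leqE (x ∷ ν) (y ∷ e) = (x ≤ᵇ y) ∧ leqE ν e

subE : Exp → Exp → Exp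
subE e [] = e
subE [] (x ∷ ν) = []
subE (y ∷ e) (x ∷ ν) = (y ∸ x) ∷ subE e ν

nth-subE : ∀ e ν j → nth (subE e ν) j ≡ nth e j ∸ nth ν j
nth-subE e [] j = refl
nth-subE [] (x ∷ ν) j = sym (ℕP.0∸n≡0 (nth (x ∷ ν) j))
nth-subE (y ∷ e) (x ∷ ν) zero = refl
nth-subE (y ∷ e) (x ∷ ν) (suc j) = nth-subE e ν j

leqE→nth : ∀ ν e → leqE ν e ≡ true → ∀ j → nth ν j ≤ nth e j
leqE→nth [] e eq j = z≤n
leqE→nth (x ∷ ν) [] eq zero = ℕP.≤-reflexive (≡ᵇ-sound x 0 (proj₁ (∧-elim eq)))
leqE→nth (x ∷ ν) [] eq (suc j) = leqE→nth ν [] (proj₂ (∧-elim {x ≡ᵇ 0} eq)) j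
leqE→nth (x ∷ ν) (y ∷ e) eq zero = ≤ᵇ-sound x y (proj₁ (∧-elim eq))
leqE→nth (x ∷ ν) (y ∷ e) eq (suc j) = leqE→nth ν e (proj₂ (∧-elim {x ≤ᵇ y} eq)) j

nth→leqE : ∀ ν e → (∀ j → nth ν j ≤ nth e j) → leqE ν e ≡ true
nth→leqE [] e le = refl
nth→leqE (x ∷ ν) [] le rewrite ℕP.n≤0⇒n≡0 (le 0) = nth→leqE ν [] (le ∘ suc)
nth→leqE (x ∷ ν) (y ∷ e) le rewrite ≤ᵇ-complete (le 0) = nth→leqE ν e (le ∘ suc)

-- Turns multiplication by a monomial into reading off at e - ν; the test `leqE` has to accompany
-- this because `subE` truncates at 0.
eqE-addE : ∀ a ν e → eqE (addE a ν) e ≡ leqE ν e ∧ eqE a (subE e ν)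
eqE-addE a ν e = bool-ext to from
  where
  to : eqE (addE a ν) e ≡ true → leqE ν e ∧ eqE a (subE e ν) ≡ true
  to h = cong₂ _∧_
    (nth→leqE ν e λ j → subst (nth ν j ≤_) (at j) (ℕP.m≤n+m _ (nth a j)))
    (nth→eqE a (subE e ν) λ j → sym (trans (nth-subE e ν j)
      (trans (cong (_∸ nth ν j) (sym (at j))) (ℕP.m+n∸n≡m (nth a j) (nth ν j)))))
    where
    at : ∀ j → nth a j + nth ν j ≡ nth e j
    at j = trans (sym (nth-addE a ν j)) (eqE→nth (addE a ν) e h j)
  from : leqE ν e ∧ eqE a (subE e ν) ≡ true → eqE (addE a ν) e ≡ true
  from h = nth→eqE (addE a ν) e λ j → trans (nth-addE a ν j)
    (trans (cong (_+ nth ν j) (trans (eqE→nth a _ (proj₂ (∧-elim {leqE ν e} h)) j) (nth-subE e ν j)))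
      (ℕP.m∸n+n≡m (leqE→nth ν e (proj₁ (∧-elim h)) j)))

if-∧ : ∀ {A : Set} a b {x y : A} → (if a ∧ b then x else y) ≡ (if a then (if b then x else y) else y)
if-∧ true b = refl
if-∧ false b = refl

-- the coefficients of the product of a monomial with f, for f given by its coefficients
shift : Mono → (Exp → Exp → ℤ) → Exp → Exp → ℤ
shift (ν , τ) f e t = if leqE ν e ∧ leqE τ t then f (subE e ν) (subE t τ) else + 0

coeff′ : Poly → Exp → Exp → ℤ
coeff′ p e t = coeff p (e , t)

coeff-++ : ∀ p q m → coeff (p ++ q) m ≡ coeff p m ℤ.+ coeff q m
coeff-++ [] q m = sym (ℤP.+-identityˡ _)
coeff-++ ((c , n) ∷ p) q m = trans (cong (λ z → (if eqM n m then c else + 0) ℤ.+ z) (coeff-++ p q m))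
  (sym (ℤP.+-assoc (if eqM n m then c else + 0) (coeff p m) (coeff q m)))

coeff-neg : ∀ p m → coeff (negP p) m ≡ - coeff p m
coeff-neg [] m = refl
coeff-neg ((c , n) ∷ p) m = trans (cong₂ ℤ._+_ (neg-if (eqM n m)) (coeff-neg p m))
  (sym (ℤP.neg-distrib-+ (if eqM n m then c else + 0) (coeff p m)))
  where
  neg-if : ∀ b → (if b then - c else + 0) ≡ - (if b then c else + 0)
  neg-if true = refl
  neg-if false = refl

eqM-mul : ∀ n' n e t → eqM (mulM n' n) (e , t)
  ≡ (leqE (proj₁ n) e ∧ leqE (proj₂ n) t) ∧ eqM n' (subE e (proj₁ n) , subE t (proj₂ n))
eqM-mul (a , b) (ν , τ) e t rewrite eqE-addE a ν e | eqE-addE b τ t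
  with leqE ν e | eqE a (subE e ν) | leqE τ t
... | true | true | r = refl
... | true | false | true = refl
... | true | false | false = refl
... | false | s | r = refl

shift-+ : ∀ n (g : Exp → Exp → ℤ) c n' e t →
  (if eqM (mulM n' n) (e , t) then c else + 0) ℤ.+ shift n g e t
  ≡ shift n (λ e' t' → (if eqM n' (e' , t') then c else + 0) ℤ.+ g e' t') e t
shift-+ n@(ν , τ) g c n' e t rewrite eqM-mul n' n e t with leqE ν e ∧ leqE τ t
... | true = refl
... | false = refl

-- `φ` is known only through its values because the function mapped inside `_*P_` is an anonymous
-- pattern match.
coeff-map : ∀ c n (φ : ℤ × Mono → ℤ × Mono) → (∀ d n' → φ (d , n') ≡ (c ℤ.* d , mulM n n')) →
  ∀ q e t → coeff′ (map φ q) e t ≡ c ℤ.* shift n (coeff′ q) e t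
coeff-map c n@(ν , τ) φ φ≡ [] e t with leqE ν e ∧ leqE τ t
... | true = sym (ℤP.*-zeroʳ c)
... | false = sym (ℤP.*-zeroʳ c)
coeff-map c n@(ν , τ) φ φ≡ ((d , n'@(ν' , τ')) ∷ q) e t rewrite φ≡ d n' | addE-comm ν ν' | addE-comm τ τ' = begin
  (if eqM (mulM n' n) (e , t) then c ℤ.* d else + 0) ℤ.+ coeff′ (map φ q) e t
    ≡⟨ cong₂ ℤ._+_ (scale (eqM (mulM n' n) (e , t))) (coeff-map c n φ φ≡ q e t) ⟩
  c ℤ.* (if eqM (mulM n' n) (e , t) then d else + 0) ℤ.+ c ℤ.* shift n (coeff′ q) e t
    ≡⟨ ℤP.*-distribˡ-+ c (if eqM (mulM n' n) (e , t) then d else + 0) _ ⟨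
  c ℤ.* ((if eqM (mulM n' n) (e , t) then d else + 0) ℤ.+ shift n (coeff′ q) e t)
    ≡⟨ cong (c ℤ.*_) (shift-+ n (coeff′ q) d n' e t) ⟩
  c ℤ.* shift n (coeff′ ((d , n') ∷ q)) e t ∎
  where
  open ≡-Reasoning
  scale : ∀ b → (if b then c ℤ.* d else + 0) ≡ c ℤ.* (if b then d else + 0)
  scale true = refl
  scale false = sym (ℤP.*-zeroʳ c)

coeff-∷* : ∀ c n p q e t →
  coeff′ (((c , n) ∷ p) *P q) e t ≡ c ℤ.* shift n (coeff′ q) e t ℤ.+ coeff′ (p *P q) e t
coeff-∷* c n p q e t = trans (coeff-++ (map _ q) (p *P q) (e , t))
  (cong (ℤ._+ coeff′ (p *P q) e t) (coeff-map c n _ (λ _ _ → refl) q e t))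

coeff-mono* : ∀ n q e t → coeff′ (((+ 1 , n) ∷ []) *P q) e t ≡ shift n (coeff′ q) e t
coeff-mono* n q e t = trans (coeff-∷* (+ 1) n [] q e t)
  (trans (ℤP.+-identityʳ _) (ℤP.*-identityˡ _))

*P-distribʳ : ∀ p p' q → (p ++ p') *P q ≡ p *P q ++ p' *P q
*P-distribʳ p p' q = LP.concatMap-++ _ p p'

map-*P : ∀ c n (φ ψ : ℤ × Mono → ℤ × Mono) →
  (∀ d n' → φ (d , n') ≡ (c ℤ.* d , mulM n n')) → (∀ d n' → ψ (d , n') ≡ (c ℤ.* d , mulM n n')) →
  ∀ p q → map φ p *P q ≡ map ψ (p *P q)
map-*P c n φ ψ φ≡ ψ≡ [] q = refl
map-*P c n φ ψ φ≡ ψ≡ ((d , n') ∷ p) q rewrite φ≡ d n' =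
  trans (cong₂ _++_ (trans (LP.map-cong term q) (LP.map-∘ q)) (map-*P c n φ ψ φ≡ ψ≡ p q))
    (sym (LP.map-++ ψ (map _ q) (p *P q)))
  where
  term : ∀ (x : ℤ × Mono) → (c ℤ.* d ℤ.* proj₁ x , mulM (mulM n n') (proj₂ x)) ≡ ψ (d ℤ.* proj₁ x , mulM n' (proj₂ x))
  term (f , r) = trans (cong₂ _,_ (ℤP.*-assoc c d f)
    (cong₂ _,_ (addE-assoc (proj₁ n) (proj₁ n') (proj₁ r)) (addE-assoc (proj₂ n) (proj₂ n') (proj₂ r))))
    (sym (ψ≡ (d ℤ.* f) (mulM n' r)))

*P-assoc : ∀ p q r → (p *P q) *P r ≡ p *P (q *P r)
*P-assoc [] q r = refl
*P-assoc ((c , n) ∷ p) q r = trans (*P-distribʳ (map _ q) (p *P q) r)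
  (cong₂ _++_ (map-*P c n _ _ (λ _ _ → refl) (λ _ _ → refl) q r) (*P-assoc p q r))

factor : ℕ × Exp → Poly
factor (m , ν) = oneP -P ((+ 1 , (ν , tExp m)) ∷ [])

coeff-*factor : ∀ p m ν e t →
  coeff′ (p *P factor (m , ν)) e t ≡ coeff′ p e t - shift (ν , tExp m) (coeff′ p) e t
coeff-*factor [] m ν e t with leqE ν e ∧ leqE (tExp m) t
... | true = refl
... | false = refl
coeff-*factor ((c , n) ∷ p) m ν e t
  rewrite addE-[] (proj₁ n) | addE-[] (proj₂ n) | ℤP.*-identityʳ c = begin
  A₀ ℤ.+ ((if b then c ℤ.* - (+ 1) else + 0) ℤ.+ coeff′ (p *P factor (m , ν)) e t)
    ≡⟨ cong (λ z → A₀ ℤ.+ ((if b then c ℤ.* - (+ 1) else + 0) ℤ.+ z)) (coeff-*factor p m ν e t) ⟩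
  A₀ ℤ.+ ((if b then c ℤ.* - (+ 1) else + 0) ℤ.+ (p₀ - s₀))
    ≡⟨ cong (λ z → A₀ ℤ.+ (z ℤ.+ (p₀ - s₀))) (neg b) ⟩
  A₀ ℤ.+ (- B₀ ℤ.+ (p₀ - s₀))
    ≡⟨ rearrange A₀ B₀ p₀ s₀ ⟩
  (A₀ ℤ.+ p₀) - (B₀ ℤ.+ s₀)
    ≡⟨ cong (λ z → (A₀ ℤ.+ p₀) - z) (shift-+ (ν , tExp m) (coeff′ p) c n e t) ⟩
  (A₀ ℤ.+ p₀) - shift (ν , tExp m) (coeff′ ((c , n) ∷ p)) e t ∎
  where
  open ≡-Reasoning
  b = eqM (mulM n (ν , tExp m)) (e , t)
  A₀ = if eqM n (e , t) then c else + 0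
  B₀ = if b then c else + 0
  p₀ = coeff′ p e t
  s₀ = shift (ν , tExp m) (coeff′ p) e t
  neg : ∀ b → (if b then c ℤ.* - (+ 1) else + 0) ≡ - (if b then c else + 0)
  neg true = trans (ℤP.*-comm c (- (+ 1))) (ℤP.-1*i≡-i c)
  neg false = refl
  rearrange : ∀ a b p s → a ℤ.+ (- b ℤ.+ (p ℤ.- s)) ≡ (a ℤ.+ p) ℤ.- (b ℤ.+ s)
  rearrange = solve-∀

-- The operators π_i in coordinates

nth-++ : ∀ u e j → nth (u ++ e) (length u + j) ≡ nth e j
nth-++ [] e j = refl
nth-++ (x ∷ u) e j = nth-++ u e j

shift-x : ∀ u (f : Exp → Exp → ℤ) p q v t →
  shift (unitE (suc (length u)) , []) f (u ++ p ∷ q ∷ v) t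
  ≡ (if 1 ≤ᵇ p then f (u ++ (p ∸ 1) ∷ q ∷ v) t else + 0)
shift-x [] f p q v t rewrite BP.∧-identityʳ (1 ≤ᵇ p) | BP.∧-identityʳ (1 ≤ᵇ p) = refl
shift-x (x ∷ u) f p q v t = shift-x u (λ e → f (x ∷ e)) p q v t

shift-y : ∀ u (f : Exp → Exp → ℤ) p q v t →
  shift (unitE (suc (suc (length u))) , []) f (u ++ p ∷ q ∷ v) t
  ≡ (if 1 ≤ᵇ q then f (u ++ p ∷ (q ∸ 1) ∷ v) t else + 0)
shift-y [] f p q v t rewrite BP.∧-identityʳ (1 ≤ᵇ q) | BP.∧-identityʳ (1 ≤ᵇ q) = refl
shift-y (x ∷ u) f p q v t = shift-y u (λ e → f (x ∷ e)) p q v t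

∧-swap : ∀ a b c → a ∧ (b ∧ c) ≡ b ∧ (a ∧ c)
∧-swap true b c = refl
∧-swap false b c = sym (BP.∧-zeroʳ b)

≡ᵇ-comm0 : ∀ p → (0 ≡ᵇ p) ≡ (p ≡ᵇ 0)
≡ᵇ-comm0 zero = refl
≡ᵇ-comm0 (suc p) = refl

eqE-swapAt : ∀ u e p q v → eqE (swapAt (length u) e) (u ++ p ∷ q ∷ v) ≡ eqE e (u ++ q ∷ p ∷ v)
eqE-swapAt [] [] p q v = ∧-swap (p ≡ᵇ 0) (q ≡ᵇ 0) _
eqE-swapAt [] (x ∷ []) p q v rewrite ≡ᵇ-comm0 p = ∧-swap (p ≡ᵇ 0) (x ≡ᵇ q) _
eqE-swapAt [] (x ∷ y ∷ e) p q v = ∧-swap (y ≡ᵇ p) (x ≡ᵇ q) _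
eqE-swapAt (z ∷ u) [] p q v with z ≡ᵇ 0 | eqE-swapAt u [] p q v
... | false | _ = refl
... | true | h = trans (cong (λ e → eqE e (u ++ p ∷ q ∷ v)) (sym (swapAt-[] (length u)))) h
  where
  swapAt-[] : ∀ n → swapAt n [] ≡ []
  swapAt-[] zero = refl
  swapAt-[] (suc n) = refl
eqE-swapAt (z ∷ u) (x ∷ e) p q v = cong ((x ≡ᵇ z) ∧_) (eqE-swapAt u e p q v)

coeff-sP : ∀ u f p q v t →
  coeff′ (sP (suc (length u)) f) (u ++ p ∷ q ∷ v) t ≡ coeff′ f (u ++ q ∷ p ∷ v) t
coeff-sP u [] p q v t = refl
coeff-sP u ((c , (e , s)) ∷ f) p q v t =
  cong₂ ℤ._+_ (cong (λ b → if b ∧ eqE s t then c else + 0) (eqE-swapAt u e p q v)) (coeff-sP u f p q v t)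

-- ((x_i − x_{i+1}) g) and (x_i f − x_{i+1} s_i f) at x_i^p x_{i+1}^q
_↦_ : (ℕ → ℕ → ℤ) → (ℕ → ℕ → ℤ) → Set
f ↦ g = ∀ p q →
  (if 1 ≤ᵇ p then g (p ∸ 1) q else + 0) - (if 1 ≤ᵇ q then g p (q ∸ 1) else + 0)
  ≡ (if 1 ≤ᵇ p then f (p ∸ 1) q else + 0) - (if 1 ≤ᵇ q then f (q ∸ 1) p else + 0)

-- The context `u`, `v` and `t` is unaffected by π_i, so its defining equation, read at all (p , q),
-- involves only coefficients with this same context.
coeff-π : ∀ u f g → IsPi (suc (length u)) f g → ∀ v t →
  (λ p q → coeff′ f (u ++ p ∷ q ∷ v) t) ↦ (λ p q → coeff′ g (u ++ p ∷ q ∷ v) t)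
coeff-π u f g π v t p q = begin
  X (coeff′ g) - Y (coeff′ g)
    ≡⟨ cong₂ _-_ (shift-x u (coeff′ g) p q v t) (shift-y u (coeff′ g) p q v t) ⟨
  shift xi (coeff′ g) e t - shift xj (coeff′ g) e t
    ≡⟨ simp (shift xi (coeff′ g) e t) (shift xj (coeff′ g) e t) ⟨
  + 1 ℤ.* shift xi (coeff′ g) e t ℤ.+ (- (+ 1) ℤ.* shift xj (coeff′ g) e t ℤ.+ + 0)
    ≡⟨ cong (λ z → + 1 ℤ.* shift xi (coeff′ g) e t ℤ.+ z) (coeff-∷* (- (+ 1)) xj [] g e t) ⟨
  + 1 ℤ.* shift xi (coeff′ g) e t ℤ.+ coeff′ (((- (+ 1) , xj) ∷ []) *P g) e t
    ≡⟨ coeff-∷* (+ 1) xi ((- (+ 1) , xj) ∷ []) g e t ⟨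
  coeff′ ((xP i -P xP (suc i)) *P g) e t
    ≡⟨ π (e , t) ⟩
  coeff′ ((xP i *P f) -P (xP (suc i) *P sP i f)) e t
    ≡⟨ coeff-++ (xP i *P f) (negP (xP (suc i) *P sP i f)) (e , t) ⟩
  coeff′ (xP i *P f) e t ℤ.+ coeff′ (negP (xP (suc i) *P sP i f)) e t
    ≡⟨ cong₂ ℤ._+_ (coeff-mono* xi f e t) (trans (coeff-neg (xP (suc i) *P sP i f) (e , t)) (cong -_ (coeff-mono* xj (sP i f) e t))) ⟩
  shift xi (coeff′ f) e t - shift xj (coeff′ (sP i f)) e t
    ≡⟨ cong₂ _-_ (shift-x u (coeff′ f) p q v t) (trans (shift-y u (coeff′ (sP i f)) p q v t)
         (cong (λ z → if 1 ≤ᵇ q then z else + 0) (coeff-sP u f p (q ∸ 1) v t))) ⟩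
  X (coeff′ f) - (if 1 ≤ᵇ q then coeff′ f (u ++ (q ∸ 1) ∷ p ∷ v) t else + 0) ∎
  where
  open ≡-Reasoning
  i = suc (length u)
  e = u ++ p ∷ q ∷ v
  xi xj : Mono
  xi = unitE i , []
  xj = unitE (suc i) , []
  X Y : (Exp → Exp → ℤ) → ℤ
  X h = if 1 ≤ᵇ p then h (u ++ (p ∸ 1) ∷ q ∷ v) t else + 0
  Y h = if 1 ≤ᵇ q then h (u ++ p ∷ (q ∸ 1) ∷ v) t else + 0
  simp : ∀ a b → + 1 ℤ.* a ℤ.+ (- (+ 1) ℤ.* b ℤ.+ + 0) ≡ a ℤ.- b
  simp = solve-∀

-- x_i - x_{i+1} is not a zero divisor: the equation at (0 , q + 1) determines `g 0 q`, and the one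
-- at (p + 1 , q + 1) determines `g (suc p) q` from `g p (suc q)`. This replaces any division of
-- polynomials.
↦-unique : ∀ {f g g'} → f ↦ g → f ↦ g' → ∀ p q → g p q ≡ g' p q
↦-unique {f} {g} {g'} G G' zero q = ℤP.neg-injective (begin
  - g 0 q ≡⟨ ℤP.+-identityˡ _ ⟨
  + 0 - g 0 q ≡⟨ G 0 (suc q) ⟩
  + 0 - f q 0 ≡⟨ G' 0 (suc q) ⟨
  + 0 - g' 0 q ≡⟨ ℤP.+-identityˡ _ ⟩
  - g' 0 q ∎)
  where open ≡-Reasoning
↦-unique {f} {g} {g'} G G' (suc p) q = begin
  g (suc p) q ≡⟨ cancel (g p (suc q)) _ ⟩
  g p (suc q) - (g p (suc q) - g (suc p) q)
    ≡⟨ cong₂ _-_ (↦-unique {f} {g} {g'} G G' p (suc q)) (trans (G (suc p) (suc q)) (sym (G' (suc p) (suc q)))) ⟩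
  g' p (suc q) - (g' p (suc q) - g' (suc p) q) ≡⟨ cancel (g' p (suc q)) _ ⟨
  g' (suc p) q ∎
  where
  open ≡-Reasoning
  cancel : ∀ a b → b ≡ a ℤ.- (a ℤ.- b)
  cancel = solve-∀

⟦_⟧ : Bool → ℤ
⟦ b ⟧ = if b then + 1 else + 0

_⟨_⟩ : (Exp → ℤ) → ℕ → Exp → ℤ
(κ ⟨ b ⟩) v = κ (b ∷ v)

-- Sums over splittings and over paths

-- the sum of κ β · μ α over the 0/1 vectors α, β with α + β = e
S : (Exp → ℤ) → (Exp → ℤ) → Exp → ℤ
S κ μ [] = κ [] ℤ.* μ []
S κ μ (0 ∷ e) = S (κ ⟨ 0 ⟩) (μ ⟨ 0 ⟩) e
S κ μ (1 ∷ e) = S (κ ⟨ 0 ⟩) (μ ⟨ 1 ⟩) e ℤ.+ S (κ ⟨ 1 ⟩) (μ ⟨ 0 ⟩) e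
S κ μ (2 ∷ e) = S (κ ⟨ 1 ⟩) (μ ⟨ 1 ⟩) e
S κ μ (suc (suc (suc _)) ∷ e) = + 0

-- Read along the entries equal to 1, the pairs of letters (0,1), (0,0), (1,1) are a level step, an up step
-- and a down step of a path of height h whose level steps all lie at height 0.
W : (Exp → ℤ) → (Exp → ℤ) → Exp → ℕ → ℤ
W κ μ [] zero = κ [] ℤ.* μ []
W κ μ [] (suc h) = + 0
W κ μ (0 ∷ e) h = W (κ ⟨ 0 ⟩) (μ ⟨ 0 ⟩) e h
W κ μ (1 ∷ e) zero = W (κ ⟨ 0 ⟩) (μ ⟨ 1 ⟩) e 0 ℤ.+ W (κ ⟨ 0 ⟩) (μ ⟨ 0 ⟩) e 1
W κ μ (1 ∷ e) (suc h) = W (κ ⟨ 0 ⟩) (μ ⟨ 0 ⟩) e (suc (suc h)) ℤ.+ W (κ ⟨ 1 ⟩) (μ ⟨ 1 ⟩) e h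
W κ μ (2 ∷ e) h = W (κ ⟨ 1 ⟩) (μ ⟨ 1 ⟩) e h
W κ μ (suc (suc (suc _)) ∷ e) h = + 0

data Bits : Exp → Set where
  [] : Bits []
  0∷_ : ∀ {v} → Bits v → Bits (0 ∷ v)
  1∷_ : ∀ {v} → Bits v → Bits (1 ∷ v)

S-cong : ∀ {κ κ' μ μ'} → (∀ v → κ v ≡ κ' v) → (∀ v → μ v ≡ μ' v) → ∀ e → S κ μ e ≡ S κ' μ' e
S-cong p q [] = cong₂ ℤ._*_ (p []) (q [])
S-cong p q (0 ∷ e) = S-cong (p ∘ (0 ∷_)) (q ∘ (0 ∷_)) e
S-cong p q (1 ∷ e) = cong₂ ℤ._+_ (S-cong (p ∘ (0 ∷_)) (q ∘ (1 ∷_)) e) (S-cong (p ∘ (1 ∷_)) (q ∘ (0 ∷_)) e)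
S-cong p q (2 ∷ e) = S-cong (p ∘ (1 ∷_)) (q ∘ (1 ∷_)) e
S-cong p q (suc (suc (suc _)) ∷ e) = refl

S-zeroˡ : ∀ {κ μ} → (∀ v → κ v ≡ + 0) → ∀ e → S κ μ e ≡ + 0
S-zeroˡ {κ} {μ} z [] rewrite z [] = refl
S-zeroˡ z (0 ∷ e) = S-zeroˡ (z ∘ (0 ∷_)) e
S-zeroˡ z (1 ∷ e) = cong₂ ℤ._+_ (S-zeroˡ (z ∘ (0 ∷_)) e) (S-zeroˡ (z ∘ (1 ∷_)) e)
S-zeroˡ z (2 ∷ e) = S-zeroˡ (z ∘ (1 ∷_)) e
S-zeroˡ z (suc (suc (suc _)) ∷ e) = refl

S-comm : ∀ κ μ e → S κ μ e ≡ S μ κ e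
S-comm κ μ [] = ℤP.*-comm (κ []) (μ [])
S-comm κ μ (0 ∷ e) = S-comm (κ ⟨ 0 ⟩) (μ ⟨ 0 ⟩) e
S-comm κ μ (1 ∷ e) = trans (cong₂ ℤ._+_ (S-comm (κ ⟨ 0 ⟩) (μ ⟨ 1 ⟩) e) (S-comm (κ ⟨ 1 ⟩) (μ ⟨ 0 ⟩) e))
  (ℤP.+-comm (S (μ ⟨ 1 ⟩) (κ ⟨ 0 ⟩) e) _)
S-comm κ μ (2 ∷ e) = S-comm (κ ⟨ 1 ⟩) (μ ⟨ 1 ⟩) e
S-comm κ μ (suc (suc (suc _)) ∷ e) = refl

S-zeroʳ : ∀ {κ μ} → (∀ v → μ v ≡ + 0) → ∀ e → S κ μ e ≡ + 0
S-zeroʳ {κ} {μ} z e = trans (S-comm κ μ e) (S-zeroˡ z e)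

+-interchange : ∀ a b c d → (a ℤ.+ b) ℤ.+ (c ℤ.+ d) ≡ (a ℤ.+ c) ℤ.+ (b ℤ.+ d)
+-interchange = solve-∀

S-+ˡ : ∀ κ κ' μ e → S (λ v → κ v ℤ.+ κ' v) μ e ≡ S κ μ e ℤ.+ S κ' μ e
S-+ˡ κ κ' μ [] = ℤP.*-distribʳ-+ (μ []) (κ []) (κ' [])
S-+ˡ κ κ' μ (0 ∷ e) = S-+ˡ (κ ⟨ 0 ⟩) (κ' ⟨ 0 ⟩) (μ ⟨ 0 ⟩) e
S-+ˡ κ κ' μ (1 ∷ e) = trans
  (cong₂ ℤ._+_ (S-+ˡ (κ ⟨ 0 ⟩) (κ' ⟨ 0 ⟩) (μ ⟨ 1 ⟩) e) (S-+ˡ (κ ⟨ 1 ⟩) (κ' ⟨ 1 ⟩) (μ ⟨ 0 ⟩) e))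
  (+-interchange (S (κ ⟨ 0 ⟩) (μ ⟨ 1 ⟩) e) _ _ _)
S-+ˡ κ κ' μ (2 ∷ e) = S-+ˡ (κ ⟨ 1 ⟩) (κ' ⟨ 1 ⟩) (μ ⟨ 1 ⟩) e
S-+ˡ κ κ' μ (suc (suc (suc _)) ∷ e) = refl

S-+ʳ : ∀ κ μ μ' e → S κ (λ v → μ v ℤ.+ μ' v) e ≡ S κ μ e ℤ.+ S κ μ' e
S-+ʳ κ μ μ' e = trans (S-comm κ _ e) (trans (S-+ˡ μ μ' κ e) (cong₂ ℤ._+_ (S-comm μ κ e) (S-comm μ' κ e)))

S-negˡ : ∀ κ μ e → S (λ v → - κ v) μ e ≡ - S κ μ e
S-negˡ κ μ [] = sym (ℤP.neg-distribˡ-* (κ []) (μ []))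
S-negˡ κ μ (0 ∷ e) = S-negˡ (κ ⟨ 0 ⟩) (μ ⟨ 0 ⟩) e
S-negˡ κ μ (1 ∷ e) = trans (cong₂ ℤ._+_ (S-negˡ (κ ⟨ 0 ⟩) (μ ⟨ 1 ⟩) e) (S-negˡ (κ ⟨ 1 ⟩) (μ ⟨ 0 ⟩) e))
  (sym (ℤP.neg-distrib-+ (S (κ ⟨ 0 ⟩) (μ ⟨ 1 ⟩) e) _))
S-negˡ κ μ (2 ∷ e) = S-negˡ (κ ⟨ 1 ⟩) (μ ⟨ 1 ⟩) e
S-negˡ κ μ (suc (suc (suc _)) ∷ e) = refl

S-−ˡ : ∀ κ κ' μ e → S (λ v → κ v - κ' v) μ e ≡ S κ μ e - S κ' μ e
S-−ˡ κ κ' μ e = trans (S-+ˡ κ (λ v → - κ' v) μ e) (cong (λ z → S κ μ e ℤ.+ z) (S-negˡ κ' μ e))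

S-−ʳ : ∀ κ μ μ' e → S κ (λ v → μ v - μ' v) e ≡ S κ μ e - S κ μ' e
S-−ʳ κ μ μ' e = trans (S-comm κ _ e) (trans (S-−ˡ μ μ' κ e) (cong₂ _-_ (S-comm μ κ e) (S-comm μ' κ e)))

hd : Exp → ℕ
hd [] = 0
hd (x ∷ _) = x

tl : Exp → Exp
tl [] = []
tl (_ ∷ v) = v

eqE-∷ : ∀ ν b v → eqE ν (b ∷ v) ≡ (hd ν ≡ᵇ b) ∧ eqE (tl ν) v
eqE-∷ [] zero v = refl
eqE-∷ [] (suc b) v = refl
eqE-∷ (x ∷ ν) b v = refl

addE-eqE-∷ : ∀ ν μ x e → eqE (addE ν μ) (x ∷ e) ≡ (hd ν + hd μ ≡ᵇ x) ∧ eqE (addE (tl ν) (tl μ)) e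
addE-eqE-∷ [] μ x e = eqE-∷ μ x e
addE-eqE-∷ (n ∷ ν) [] x e rewrite ℕP.+-identityʳ n | addE-[] ν = refl
addE-eqE-∷ (n ∷ ν) (m ∷ μ) x e = refl

addE-eqE-[] : ∀ ν μ → eqE (addE ν μ) [] ≡ eqE ν [] ∧ eqE μ []
addE-eqE-[] [] μ = refl
addE-eqE-[] (n ∷ ν) [] = sym (BP.∧-identityʳ _)
addE-eqE-[] (zero ∷ ν) (zero ∷ μ) = addE-eqE-[] ν μ
addE-eqE-[] (zero ∷ ν) (suc m ∷ μ) = sym (BP.∧-zeroʳ _)
addE-eqE-[] (suc n ∷ ν) (m ∷ μ) = refl

⟦⟧-* : ∀ a b → ⟦ a ⟧ ℤ.* ⟦ b ⟧ ≡ ⟦ a ∧ b ⟧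
⟦⟧-* true true = refl
⟦⟧-* true false = refl
⟦⟧-* false true = refl
⟦⟧-* false false = refl

𝟙 : Exp → Exp → ℤ
𝟙 ν v = ⟦ eqE ν v ⟧

hd-bits : ∀ {ν} → Bits ν → hd ν ≡ 0 ⊎ hd ν ≡ 1
hd-bits [] = inj₁ refl
hd-bits (0∷ b) = inj₁ refl
hd-bits (1∷ b) = inj₂ refl

tl-bits : ∀ {ν} → Bits ν → Bits (tl ν)
tl-bits [] = []
tl-bits (0∷ b) = b
tl-bits (1∷ b) = b

-- `S` multiplies two generating functions but sees only the squarefree monomials of each; hence the
-- conditions `Bits`.
S-𝟙 : ∀ {ν μ} → Bits ν → Bits μ → ∀ e → S (𝟙 ν) (𝟙 μ) e ≡ 𝟙 (addE ν μ) e
S-𝟙 {ν} {μ} bν bμ [] rewrite addE-eqE-[] ν μ = ⟦⟧-* (eqE ν []) (eqE μ [])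
S-𝟙 {ν} {μ} bν bμ (x ∷ e) = trans (go x (hd-bits bν) (hd-bits bμ)) (cong ⟦_⟧ (sym (addE-eqE-∷ ν μ x e)))
  where
  IH = S-𝟙 (tl-bits bν) (tl-bits bμ) e
  eq : ∀ {b} λ' → hd λ' ≡ b → ∀ v → 𝟙 λ' (b ∷ v) ≡ 𝟙 (tl λ') v
  eq {b} λ' h v rewrite eqE-∷ λ' b v | h | ≡ᵇ-refl b = refl
  ne01 : ∀ λ' → hd λ' ≡ 0 → ∀ v → 𝟙 λ' (1 ∷ v) ≡ + 0
  ne01 λ' h v rewrite eqE-∷ λ' 1 v | h = refl
  ne10 : ∀ λ' → hd λ' ≡ 1 → ∀ v → 𝟙 λ' (0 ∷ v) ≡ + 0
  ne10 λ' h v rewrite eqE-∷ λ' 0 v | h = refl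
  go : ∀ x → hd ν ≡ 0 ⊎ hd ν ≡ 1 → hd μ ≡ 0 ⊎ hd μ ≡ 1 →
    S (𝟙 ν) (𝟙 μ) (x ∷ e) ≡ ⟦ (hd ν + hd μ ≡ᵇ x) ∧ eqE (addE (tl ν) (tl μ)) e ⟧
  go 0 (inj₁ p) (inj₁ q) rewrite p | q = trans (S-cong (eq ν p) (eq μ q) e) IH
  go 0 (inj₁ p) (inj₂ q) rewrite p | q = S-zeroʳ (ne10 μ q) e
  go 0 (inj₂ p) _ rewrite p = S-zeroˡ (ne10 ν p) e
  go 1 (inj₁ p) (inj₁ q) rewrite p | q = cong₂ ℤ._+_ (S-zeroʳ (ne01 μ q) e) (S-zeroˡ (ne01 ν p) e)
  go 1 (inj₁ p) (inj₂ q) rewrite p | q =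
    trans (cong₂ ℤ._+_ (trans (S-cong (eq ν p) (eq μ q) e) IH) (S-zeroˡ (ne01 ν p) e)) (ℤP.+-identityʳ _)
  go 1 (inj₂ p) (inj₁ q) rewrite p | q =
    trans (cong₂ ℤ._+_ (S-zeroˡ (ne10 ν p) e) (trans (S-cong (eq ν p) (eq μ q) e) IH)) (ℤP.+-identityˡ _)
  go 1 (inj₂ p) (inj₂ q) rewrite p | q = cong₂ ℤ._+_ (S-zeroˡ (ne10 ν p) e) (S-zeroʳ (ne10 μ q) e)
  go 2 (inj₁ p) (inj₁ q) rewrite p | q = S-zeroˡ (ne01 ν p) e
  go 2 (inj₁ p) (inj₂ q) rewrite p | q = S-zeroˡ (ne01 ν p) e
  go 2 (inj₂ p) (inj₁ q) rewrite p | q = S-zeroʳ (ne01 μ q) e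
  go 2 (inj₂ p) (inj₂ q) rewrite p | q = trans (S-cong (eq ν p) (eq μ q) e) IH
  go (suc (suc (suc x))) (inj₁ p) (inj₁ q) rewrite p | q = refl
  go (suc (suc (suc x))) (inj₁ p) (inj₂ q) rewrite p | q = refl
  go (suc (suc (suc x))) (inj₂ p) (inj₁ q) rewrite p | q = refl
  go (suc (suc (suc x))) (inj₂ p) (inj₂ q) rewrite p | q = refl

W-cong : ∀ {κ κ' μ μ'} → (∀ v → κ v ≡ κ' v) → (∀ v → μ v ≡ μ' v) → ∀ e h → W κ μ e h ≡ W κ' μ' e h
W-cong p q [] zero = cong₂ ℤ._*_ (p []) (q [])
W-cong p q [] (suc h) = refl
W-cong p q (0 ∷ e) h = W-cong (p ∘ (0 ∷_)) (q ∘ (0 ∷_)) e h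
W-cong p q (1 ∷ e) zero = cong₂ ℤ._+_ (W-cong (p ∘ (0 ∷_)) (q ∘ (1 ∷_)) e 0) (W-cong (p ∘ (0 ∷_)) (q ∘ (0 ∷_)) e 1)
W-cong p q (1 ∷ e) (suc h) =
  cong₂ ℤ._+_ (W-cong (p ∘ (0 ∷_)) (q ∘ (0 ∷_)) e (suc (suc h))) (W-cong (p ∘ (1 ∷_)) (q ∘ (1 ∷_)) e h)
W-cong p q (2 ∷ e) h = W-cong (p ∘ (1 ∷_)) (q ∘ (1 ∷_)) e h
W-cong p q (suc (suc (suc _)) ∷ e) h = refl

W-zeroˡ : ∀ {κ μ} → (∀ v → κ v ≡ + 0) → ∀ e h → W κ μ e h ≡ + 0
W-zeroˡ z [] zero rewrite z [] = refl
W-zeroˡ z [] (suc h) = refl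
W-zeroˡ z (0 ∷ e) h = W-zeroˡ (z ∘ (0 ∷_)) e h
W-zeroˡ z (1 ∷ e) zero = cong₂ ℤ._+_ (W-zeroˡ (z ∘ (0 ∷_)) e 0) (W-zeroˡ (z ∘ (0 ∷_)) e 1)
W-zeroˡ z (1 ∷ e) (suc h) = cong₂ ℤ._+_ (W-zeroˡ (z ∘ (0 ∷_)) e (suc (suc h))) (W-zeroˡ (z ∘ (1 ∷_)) e h)
W-zeroˡ z (2 ∷ e) h = W-zeroˡ (z ∘ (1 ∷_)) e h
W-zeroˡ z (suc (suc (suc _)) ∷ e) h = refl

W-zeroʳ : ∀ {κ μ} → (∀ v → μ v ≡ + 0) → ∀ e h → W κ μ e h ≡ + 0
W-zeroʳ {κ} z [] zero rewrite z [] = ℤP.*-zeroʳ (κ [])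
W-zeroʳ z [] (suc h) = refl
W-zeroʳ z (0 ∷ e) h = W-zeroʳ (z ∘ (0 ∷_)) e h
W-zeroʳ z (1 ∷ e) zero = cong₂ ℤ._+_ (W-zeroʳ (z ∘ (1 ∷_)) e 0) (W-zeroʳ (z ∘ (0 ∷_)) e 1)
W-zeroʳ z (1 ∷ e) (suc h) = cong₂ ℤ._+_ (W-zeroʳ (z ∘ (0 ∷_)) e (suc (suc h))) (W-zeroʳ (z ∘ (1 ∷_)) e h)
W-zeroʳ z (2 ∷ e) h = W-zeroʳ (z ∘ (1 ∷_)) e h
W-zeroʳ z (suc (suc (suc _)) ∷ e) h = refl

-- π_i on a function of the exponents (p , q) of (x_i , x_{i+1}) that is supported on p , q ≤ 2
record Demazure (f g : ℕ → ℕ → ℤ) : Set where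
  field
    f-suppˡ : ∀ p q → f (3 + p) q ≡ + 0
    f-suppʳ : ∀ p q → f p (3 + q) ≡ + 0
    g-suppˡ : ∀ p q → g (3 + p) q ≡ + 0
    g-suppʳ : ∀ p q → g p (3 + q) ≡ + 0
    at00 : g 0 0 ≡ f 0 0
    at22 : g 2 2 ≡ f 2 2
    at10 : g 1 0 ≡ f 1 0
    at01 : g 0 1 ≡ f 1 0
    at20 : g 2 0 ≡ f 2 0
    at02 : g 0 2 ≡ f 2 0
    at21 : g 2 1 ≡ f 2 1
    at12 : g 1 2 ≡ f 2 1
    at11 : g 1 1 ≡ (f 2 0 ℤ.+ f 1 1) - f 0 2

-- The values in `Demazure` come from π_i(x_i) = x_i + x_{i+1}, π_i(x_i²) = x_i² + x_i x_{i+1} +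
-- x_{i+1}² and π_i(x_{i+1}²) = - x_i x_{i+1}, while x_{i+1} and x_i x_{i+1}² are killed. Exponents
-- up to 3, one more than the support, need a check because both sides carry a factor x_i or
-- x_{i+1}.
Demazure⇒↦ : ∀ {f g} → Demazure f g → f ↦ g
Demazure⇒↦ {f} {g} D = go
  where
  open Demazure D
  four : ∀ {a b c d a' b' c' d'} → a ≡ a' → b ≡ b' → c ≡ c' → d ≡ d' → a' - b' ≡ c' - d' → a - b ≡ c - d
  four refl refl refl refl h = h
  column : ∀ q → g 0 q ≡ f q 0
  column 0 = at00
  column 1 = at01
  column 2 = at02
  column (suc (suc (suc q))) = trans (g-suppʳ 0 q) (sym (f-suppˡ q 0))
  row : ∀ p → g p 0 ≡ f p 0
  row 0 = at00
  row 1 = at10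
  row 2 = at20
  row (suc (suc (suc p))) = trans (g-suppˡ p 0) (sym (f-suppˡ p 0))
  id₁ : ∀ a b c → a ℤ.- (a ℤ.+ b ℤ.- c) ≡ c ℤ.- b
  id₁ = solve-∀
  id₂ : ∀ a b c → (a ℤ.+ b ℤ.- c) ℤ.- a ≡ b ℤ.- c
  id₂ = solve-∀
  id₃ : ∀ a b → a ℤ.- a ≡ b ℤ.- b
  id₃ = solve-∀
  go : f ↦ g
  go 0 0 = refl
  go 0 (suc q) = cong (_-_ (+ 0)) (column q)
  go (suc p) 0 = cong (_- + 0) (row p)
  go 1 1 = four at01 at10 (refl {x = f 0 1}) (refl {x = f 0 1}) (id₃ (f 1 0) (f 0 1))
  go 1 2 = four at02 at11 (refl {x = f 0 2}) (refl {x = f 1 1}) (id₁ (f 2 0) (f 1 1) (f 0 2))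
  go 1 3 = four (g-suppʳ 0 0) at12 (f-suppʳ 0 0) (refl {x = f 2 1}) refl
  go 1 (suc (suc (suc (suc q)))) = four (g-suppʳ 0 (suc q)) (g-suppʳ 1 q) (f-suppʳ 0 (suc q)) (f-suppˡ q 1) refl
  go 2 1 = four at11 at20 (refl {x = f 1 1}) (refl {x = f 0 2}) (id₂ (f 2 0) (f 1 1) (f 0 2))
  go 2 2 = four at12 at21 (refl {x = f 1 2}) (refl {x = f 1 2}) (id₃ (f 2 1) (f 1 2))
  go 2 3 = four (g-suppʳ 1 0) at22 (f-suppʳ 1 0) (refl {x = f 2 2}) refl
  go 2 (suc (suc (suc (suc q)))) = four (g-suppʳ 1 (suc q)) (g-suppʳ 2 q) (f-suppʳ 1 (suc q)) (f-suppˡ q 2) refl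
  go 3 1 = four at21 (g-suppˡ 0 0) (refl {x = f 2 1}) (f-suppʳ 0 0) refl
  go 3 2 = four at22 (g-suppˡ 0 1) (refl {x = f 2 2}) (f-suppʳ 1 0) refl
  go 3 (suc (suc (suc q))) = four (g-suppʳ 2 q) (g-suppˡ 0 (2 + q)) (f-suppʳ 2 q) (f-suppʳ (2 + q) 0) refl
  go (suc (suc (suc (suc p)))) (suc q) =
    four (g-suppˡ p (suc q)) (g-suppˡ (suc p) q) (f-suppˡ p (suc q)) (f-suppʳ q (suc p)) refl

Demazure-resp : ∀ {f f' g g'} → (∀ p q → f p q ≡ f' p q) → (∀ p q → g p q ≡ g' p q) → Demazure f g → Demazure f' g'
Demazure-resp {f} {f'} {g} {g'} p q D = record
  { f-suppˡ = λ a b → trans (sym (p (3 + a) b)) (f-suppˡ a b)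
  ; f-suppʳ = λ a b → trans (sym (p a (3 + b))) (f-suppʳ a b)
  ; g-suppˡ = λ a b → trans (sym (q (3 + a) b)) (g-suppˡ a b)
  ; g-suppʳ = λ a b → trans (sym (q a (3 + b))) (g-suppʳ a b)
  ; at00 = move at00
  ; at22 = move at22
  ; at10 = move at10
  ; at01 = move at01
  ; at20 = move at20
  ; at02 = move at02
  ; at21 = move at21
  ; at12 = move at12
  ; at11 = trans (sym (q 1 1)) (trans at11 (cong₂ _-_ (cong₂ ℤ._+_ (p 2 0) (p 1 1)) (p 0 2)))
  }
  where
  open Demazure D
  move : ∀ {a b c d} → g a b ≡ f c d → g' a b ≡ f' c d
  move {a} {b} {c} {d} h = trans (sym (q a b)) (trans h (p c d))

Demazure-+ : ∀ {f f' g g'} → Demazure f g → Demazure f' g' →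
  Demazure (λ p q → f p q ℤ.+ f' p q) (λ p q → g p q ℤ.+ g' p q)
Demazure-+ {f} {f'} D D' = record
  { f-suppˡ = λ a b → cong₂ ℤ._+_ (D.f-suppˡ a b) (D'.f-suppˡ a b)
  ; f-suppʳ = λ a b → cong₂ ℤ._+_ (D.f-suppʳ a b) (D'.f-suppʳ a b)
  ; g-suppˡ = λ a b → cong₂ ℤ._+_ (D.g-suppˡ a b) (D'.g-suppˡ a b)
  ; g-suppʳ = λ a b → cong₂ ℤ._+_ (D.g-suppʳ a b) (D'.g-suppʳ a b)
  ; at00 = cong₂ ℤ._+_ D.at00 D'.at00
  ; at22 = cong₂ ℤ._+_ D.at22 D'.at22
  ; at10 = cong₂ ℤ._+_ D.at10 D'.at10
  ; at01 = cong₂ ℤ._+_ D.at01 D'.at01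
  ; at20 = cong₂ ℤ._+_ D.at20 D'.at20
  ; at02 = cong₂ ℤ._+_ D.at02 D'.at02
  ; at21 = cong₂ ℤ._+_ D.at21 D'.at21
  ; at12 = cong₂ ℤ._+_ D.at12 D'.at12
  ; at11 = trans (cong₂ ℤ._+_ D.at11 D'.at11)
      (rearrange (f 2 0) (f 1 1) (f 0 2) (f' 2 0) (f' 1 1) (f' 0 2))
  }
  where
  module D = Demazure D
  module D' = Demazure D'
  rearrange : ∀ a b c a' b' c' →
    (a ℤ.+ b ℤ.- c) ℤ.+ (a' ℤ.+ b' ℤ.- c') ≡ ((a ℤ.+ a') ℤ.+ (b ℤ.+ b')) ℤ.- (c ℤ.+ c')
  rearrange = solve-∀

Demazure-neg : ∀ {f g} → Demazure f g → Demazure (λ p q → - f p q) (λ p q → - g p q)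
Demazure-neg {f} D = record
  { f-suppˡ = λ a b → cong -_ (f-suppˡ a b)
  ; f-suppʳ = λ a b → cong -_ (f-suppʳ a b)
  ; g-suppˡ = λ a b → cong -_ (g-suppˡ a b)
  ; g-suppʳ = λ a b → cong -_ (g-suppʳ a b)
  ; at00 = cong -_ at00
  ; at22 = cong -_ at22
  ; at10 = cong -_ at10
  ; at01 = cong -_ at01
  ; at20 = cong -_ at20
  ; at02 = cong -_ at02
  ; at21 = cong -_ at21
  ; at12 = cong -_ at12
  ; at11 = trans (cong -_ at11) (rearrange (f 2 0) (f 1 1) (f 0 2))
  }
  where
  open Demazure D
  rearrange : ∀ a b c → ℤ.- (a ℤ.+ b ℤ.- c) ≡ (ℤ.- a ℤ.+ ℤ.- b) ℤ.- ℤ.- c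
  rearrange = solve-∀

Demazure-0 : Demazure (λ _ _ → + 0) (λ _ _ → + 0)
Demazure-0 = record
  { f-suppˡ = λ _ _ → refl ; f-suppʳ = λ _ _ → refl ; g-suppˡ = λ _ _ → refl ; g-suppʳ = λ _ _ → refl
  ; at00 = refl ; at22 = refl ; at10 = refl ; at01 = refl ; at20 = refl ; at02 = refl ; at21 = refl ; at12 = refl
  ; at11 = refl }

record Lift₀ (κ κ' : Exp → ℤ) : Set where
  field
    l00 : ∀ v → κ' (0 ∷ 0 ∷ v) ≡ κ (0 ∷ 0 ∷ v)
    l11 : ∀ v → κ' (1 ∷ 1 ∷ v) ≡ κ (1 ∷ 1 ∷ v)
    l10 : ∀ v → κ' (1 ∷ 0 ∷ v) ≡ κ (1 ∷ 0 ∷ v)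
    l01 : ∀ v → κ' (0 ∷ 1 ∷ v) ≡ κ (1 ∷ 0 ∷ v)

-- how the indicator of A_m changes from w to s_i w, for i = suc n and ℓ(s_i w) > ℓ(w)
Lift : ℕ → (κ κ' : Exp → ℤ) → Set
Lift zero κ κ' = Lift₀ κ κ'
Lift (suc n) κ κ' = ∀ b → Lift n (κ ⟨ b ⟩) (κ' ⟨ b ⟩)

-- At entries (1 , 1) every possible pair of steps other than (up , down) gives two sets neither of
-- which contains i + 1 without i, and `Lift` leaves those alone. For the peak both sets have (0 ,
-- 1), which after the lift is worth what (1 , 0) was before; these are the values at (0 , 2) and (2
-- , 0).
W-Demazure : ∀ u {κ κ' μ μ'} → Lift (length u) κ κ' → Lift (length u) μ μ' → ∀ v h →
  Demazure (λ p q → W κ μ (u ++ p ∷ q ∷ v) h) (λ p q → W κ' μ' (u ++ p ∷ q ∷ v) h)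
W-Demazure [] {κ} {κ'} {μ} {μ'} K M v h = record
  { f-suppˡ = λ _ _ → refl
  ; f-suppʳ = λ p q → supp κ μ p q h
  ; g-suppˡ = λ _ _ → refl
  ; g-suppʳ = λ p q → supp κ' μ' p q h
  ; at00 = W-cong K.l00 M.l00 v h
  ; at22 = W-cong K.l11 M.l11 v h
  ; at10 = one-zero h
  ; at01 = zero-one h
  ; at20 = W-cong K.l10 M.l10 v h
  ; at02 = W-cong K.l01 M.l01 v h
  ; at21 = two-one h
  ; at12 = one-two h
  ; at11 = one-one h
  }
  where
  module K = Lift₀ K
  module M = Lift₀ M
  supp : ∀ κ μ p q h → W κ μ (p ∷ 3 + q ∷ v) h ≡ + 0
  supp κ μ 0 q h = refl
  supp κ μ 1 q zero = refl
  supp κ μ 1 q (suc h) = refl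
  supp κ μ 2 q h = refl
  supp κ μ (suc (suc (suc p))) q h = refl
  one-zero : ∀ h → W κ' μ' (1 ∷ 0 ∷ v) h ≡ W κ μ (1 ∷ 0 ∷ v) h
  one-zero zero = cong₂ ℤ._+_ (W-cong K.l00 M.l10 v 0) (W-cong K.l00 M.l00 v 1)
  one-zero (suc h) = cong₂ ℤ._+_ (W-cong K.l00 M.l00 v (suc (suc h))) (W-cong K.l10 M.l10 v h)
  zero-one : ∀ h → W κ' μ' (0 ∷ 1 ∷ v) h ≡ W κ μ (1 ∷ 0 ∷ v) h
  zero-one zero = cong₂ ℤ._+_ (W-cong K.l00 M.l01 v 0) (W-cong K.l00 M.l00 v 1)
  zero-one (suc h) = cong₂ ℤ._+_ (W-cong K.l00 M.l00 v (suc (suc h))) (W-cong K.l01 M.l01 v h)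
  two-one : ∀ h → W κ' μ' (2 ∷ 1 ∷ v) h ≡ W κ μ (2 ∷ 1 ∷ v) h
  two-one zero = cong₂ ℤ._+_ (W-cong K.l10 M.l11 v 0) (W-cong K.l10 M.l10 v 1)
  two-one (suc h) = cong₂ ℤ._+_ (W-cong K.l10 M.l10 v (suc (suc h))) (W-cong K.l11 M.l11 v h)
  one-two : ∀ h → W κ' μ' (1 ∷ 2 ∷ v) h ≡ W κ μ (2 ∷ 1 ∷ v) h
  one-two zero = cong₂ ℤ._+_ (W-cong K.l01 M.l11 v 0) (W-cong K.l01 M.l01 v 1)
  one-two (suc h) = cong₂ ℤ._+_ (W-cong K.l01 M.l01 v (suc (suc h))) (W-cong K.l11 M.l11 v h)
  -- `x` is the peak after the lift, that is, the old value at (2 , 0); `y` is the peak before it,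
  -- the old value at (0 , 2).
  swap-peak₀ : ∀ a b c x y → (a ℤ.+ b) ℤ.+ (c ℤ.+ x) ≡ (x ℤ.+ ((a ℤ.+ b) ℤ.+ (c ℤ.+ y))) ℤ.- y
  swap-peak₀ = solve-∀
  swap-peak₁ : ∀ a b c x y → (a ℤ.+ x) ℤ.+ (b ℤ.+ c) ≡ (x ℤ.+ ((a ℤ.+ y) ℤ.+ (b ℤ.+ c))) ℤ.- y
  swap-peak₁ = solve-∀
  one-one : ∀ h → W κ' μ' (1 ∷ 1 ∷ v) h
    ≡ (W κ μ (2 ∷ 0 ∷ v) h ℤ.+ W κ μ (1 ∷ 1 ∷ v) h) - W κ μ (0 ∷ 2 ∷ v) h
  one-one zero = trans
    (cong₂ ℤ._+_ (cong₂ ℤ._+_ (W-cong K.l00 M.l11 v 0) (W-cong K.l00 M.l10 v 1))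
      (cong₂ ℤ._+_ (W-cong K.l00 M.l00 v 2) (W-cong K.l01 M.l01 v 0)))
    (swap-peak₀ (W (κ ⟨ 0 ⟩ ⟨ 0 ⟩) (μ ⟨ 1 ⟩ ⟨ 1 ⟩) v 0) (W (κ ⟨ 0 ⟩ ⟨ 0 ⟩) (μ ⟨ 1 ⟩ ⟨ 0 ⟩) v 1)
      (W (κ ⟨ 0 ⟩ ⟨ 0 ⟩) (μ ⟨ 0 ⟩ ⟨ 0 ⟩) v 2) (W (κ ⟨ 1 ⟩ ⟨ 0 ⟩) (μ ⟨ 1 ⟩ ⟨ 0 ⟩) v 0)
      (W (κ ⟨ 0 ⟩ ⟨ 1 ⟩) (μ ⟨ 0 ⟩ ⟨ 1 ⟩) v 0))
  -- Heights 0, 1 and at least 2 are separate because the second letter can be a level step only if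
  -- the first one ends at height 0.
  one-one (suc zero) = trans
    (cong₂ ℤ._+_ (cong₂ ℤ._+_ (W-cong K.l00 M.l00 v 3) (W-cong K.l01 M.l01 v 1))
      (cong₂ ℤ._+_ (W-cong K.l10 M.l11 v 0) (W-cong K.l10 M.l10 v 1)))
    (swap-peak₁ (W (κ ⟨ 0 ⟩ ⟨ 0 ⟩) (μ ⟨ 0 ⟩ ⟨ 0 ⟩) v 3) (W (κ ⟨ 1 ⟩ ⟨ 0 ⟩) (μ ⟨ 1 ⟩ ⟨ 1 ⟩) v 0)
      (W (κ ⟨ 1 ⟩ ⟨ 0 ⟩) (μ ⟨ 1 ⟩ ⟨ 0 ⟩) v 1) (W (κ ⟨ 1 ⟩ ⟨ 0 ⟩) (μ ⟨ 1 ⟩ ⟨ 0 ⟩) v 1)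
      (W (κ ⟨ 0 ⟩ ⟨ 1 ⟩) (μ ⟨ 0 ⟩ ⟨ 1 ⟩) v 1))
  one-one (suc (suc h)) = trans
    (cong₂ ℤ._+_ (cong₂ ℤ._+_ (W-cong K.l00 M.l00 v (4 + h)) (W-cong K.l01 M.l01 v (2 + h)))
      (cong₂ ℤ._+_ (W-cong K.l10 M.l10 v (2 + h)) (W-cong K.l11 M.l11 v h)))
    (swap-peak₁ (W (κ ⟨ 0 ⟩ ⟨ 0 ⟩) (μ ⟨ 0 ⟩ ⟨ 0 ⟩) v (4 + h)) (W (κ ⟨ 1 ⟩ ⟨ 0 ⟩) (μ ⟨ 1 ⟩ ⟨ 0 ⟩) v (2 + h))
      (W (κ ⟨ 1 ⟩ ⟨ 1 ⟩) (μ ⟨ 1 ⟩ ⟨ 1 ⟩) v h) (W (κ ⟨ 1 ⟩ ⟨ 0 ⟩) (μ ⟨ 1 ⟩ ⟨ 0 ⟩) v (2 + h))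
      (W (κ ⟨ 0 ⟩ ⟨ 1 ⟩) (μ ⟨ 0 ⟩ ⟨ 1 ⟩) v (2 + h)))
W-Demazure (0 ∷ u) K M v h = W-Demazure u (K 0) (M 0) v h
W-Demazure (1 ∷ u) K M v zero = Demazure-+ (W-Demazure u (K 0) (M 1) v 0) (W-Demazure u (K 0) (M 0) v 1)
W-Demazure (1 ∷ u) K M v (suc h) = Demazure-+ (W-Demazure u (K 0) (M 0) v (2 + h)) (W-Demazure u (K 1) (M 1) v h)
W-Demazure (2 ∷ u) K M v h = W-Demazure u (K 1) (M 1) v h
W-Demazure (suc (suc (suc _)) ∷ u) K M v h = Demazure-0

-- Let A_m and A'_m be the sums of x^α over A_m(w) and A_m(s_i w), and ε_m = A'_m - A_m. Then A_k
-- A_l - ε_k ε_l = A'_k A'_l - A'_k ε_l - ε_k A'_l. As A'_m is symmetric in x_i and x_{i+1} and π_i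
-- kills ε_m, the image under π_i is A'_k A'_l. The proof verifies this entry by entry.
S-Demazure : ∀ u {κ κ' μ μ'} → Lift (length u) κ κ' → Lift (length u) μ μ' → ∀ v →
  Demazure
    (λ p q → S κ μ (u ++ p ∷ q ∷ v) - S (λ x → κ' x - κ x) (λ x → μ' x - μ x) (u ++ p ∷ q ∷ v))
    (λ p q → S κ' μ' (u ++ p ∷ q ∷ v))
S-Demazure [] {κ} {κ'} {μ} {μ'} K M v = record
  { f-suppˡ = λ _ _ → refl
  ; f-suppʳ = λ p q → cong₂ _-_ (supp κ μ p q) (supp ε η p q)
  ; g-suppˡ = λ _ _ → refl
  ; g-suppʳ = λ p q → supp κ' μ' p q
  ; at00 = drop (S-cong K.l00 M.l00 v) (S-zeroˡ (null K.l00) v)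
  ; at22 = drop (S-cong K.l11 M.l11 v) (S-zeroˡ (null K.l11) v)
  ; at10 = drop (cong₂ ℤ._+_ (S-cong K.l00 M.l10 v) (S-cong K.l10 M.l00 v))
      (cong₂ ℤ._+_ (S-zeroˡ (null K.l00) v) (S-zeroˡ (null K.l10) v))
  ; at01 = drop (cong₂ ℤ._+_ (S-cong K.l00 M.l01 v) (S-cong K.l01 M.l00 v))
      (cong₂ ℤ._+_ (S-zeroˡ (null K.l00) v) (S-zeroˡ (null K.l10) v))
  ; at20 = drop (S-cong K.l10 M.l10 v) (S-zeroˡ (null K.l10) v)
  ; at02 = drop (S-cong K.l01 M.l01 v) (S-zeroˡ (null K.l10) v)
  ; at21 = drop (cong₂ ℤ._+_ (S-cong K.l10 M.l11 v) (S-cong K.l11 M.l10 v))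
      (cong₂ ℤ._+_ (S-zeroˡ (null K.l10) v) (S-zeroˡ (null K.l11) v))
  ; at12 = drop (cong₂ ℤ._+_ (S-cong K.l01 M.l11 v) (S-cong K.l11 M.l01 v))
      (cong₂ ℤ._+_ (S-zeroˡ (null K.l10) v) (S-zeroˡ (null K.l11) v))
  ; at11 = one-one
  }
  where
  module K = Lift₀ K
  module M = Lift₀ M
  ε η : Exp → ℤ
  ε x = κ' x - κ x
  η x = μ' x - μ x
  supp : ∀ κ μ p q → S κ μ (p ∷ 3 + q ∷ v) ≡ + 0
  supp κ μ 0 q = refl
  supp κ μ 1 q = refl
  supp κ μ 2 q = refl
  supp κ μ (suc (suc (suc p))) q = refl
  null : ∀ {a b : Exp → ℤ} → (∀ x → a x ≡ b x) → ∀ x → a x - b x ≡ + 0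
  null h x = ℤP.i≡j⇒i-j≡0 (h x)
  drop : ∀ {a b c} → a ≡ b → c ≡ + 0 → a ≡ b - c
  drop refl refl = sym (ℤP.+-identityʳ _)
  -- Both differences are supported on (0 , 1) at (i , i + 1), so the correction survives only at (0
  -- , 2).
  expand : S (ε ⟨ 0 ⟩ ⟨ 1 ⟩) (η ⟨ 0 ⟩ ⟨ 1 ⟩) v
    ≡ (S (κ ⟨ 1 ⟩ ⟨ 0 ⟩) (μ ⟨ 1 ⟩ ⟨ 0 ⟩) v - S (κ ⟨ 1 ⟩ ⟨ 0 ⟩) (μ ⟨ 0 ⟩ ⟨ 1 ⟩) v)
      - (S (κ ⟨ 0 ⟩ ⟨ 1 ⟩) (μ ⟨ 1 ⟩ ⟨ 0 ⟩) v - S (κ ⟨ 0 ⟩ ⟨ 1 ⟩) (μ ⟨ 0 ⟩ ⟨ 1 ⟩) v)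
  expand = trans (S-cong (λ x → cong (_- κ (0 ∷ 1 ∷ x)) (K.l01 x)) (λ x → cong (_- μ (0 ∷ 1 ∷ x)) (M.l01 x)) v)
    (trans (S-−ˡ (κ ⟨ 1 ⟩ ⟨ 0 ⟩) (κ ⟨ 0 ⟩ ⟨ 1 ⟩) _ v)
      (cong₂ _-_ (S-−ʳ (κ ⟨ 1 ⟩ ⟨ 0 ⟩) (μ ⟨ 1 ⟩ ⟨ 0 ⟩) (μ ⟨ 0 ⟩ ⟨ 1 ⟩) v)
        (S-−ʳ (κ ⟨ 0 ⟩ ⟨ 1 ⟩) (μ ⟨ 1 ⟩ ⟨ 0 ⟩) (μ ⟨ 0 ⟩ ⟨ 1 ⟩) v)))
  rearrange : ∀ a b c d x y → (a ℤ.+ x) ℤ.+ (x ℤ.+ b)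
    ≡ ((x ℤ.- + 0) ℤ.+ (((a ℤ.+ c) ℤ.+ (d ℤ.+ b)) ℤ.- + 0)) ℤ.- (y ℤ.- ((x ℤ.- d) ℤ.- (c ℤ.- y)))
  rearrange = solve-∀
  one-one : S κ' μ' (1 ∷ 1 ∷ v)
    ≡ ((S κ μ (2 ∷ 0 ∷ v) - S ε η (2 ∷ 0 ∷ v)) ℤ.+ (S κ μ (1 ∷ 1 ∷ v) - S ε η (1 ∷ 1 ∷ v)))
      - (S κ μ (0 ∷ 2 ∷ v) - S ε η (0 ∷ 2 ∷ v))
  one-one = trans
    (cong₂ ℤ._+_ (cong₂ ℤ._+_ (S-cong K.l00 M.l11 v) (S-cong K.l01 M.l10 v))
      (cong₂ ℤ._+_ (S-cong K.l10 M.l01 v) (S-cong K.l11 M.l00 v)))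
    (trans (rearrange (S (κ ⟨ 0 ⟩ ⟨ 0 ⟩) (μ ⟨ 1 ⟩ ⟨ 1 ⟩) v) (S (κ ⟨ 1 ⟩ ⟨ 1 ⟩) (μ ⟨ 0 ⟩ ⟨ 0 ⟩) v)
        (S (κ ⟨ 0 ⟩ ⟨ 1 ⟩) (μ ⟨ 1 ⟩ ⟨ 0 ⟩) v) (S (κ ⟨ 1 ⟩ ⟨ 0 ⟩) (μ ⟨ 0 ⟩ ⟨ 1 ⟩) v)
        (S (κ ⟨ 1 ⟩ ⟨ 0 ⟩) (μ ⟨ 1 ⟩ ⟨ 0 ⟩) v) (S (κ ⟨ 0 ⟩ ⟨ 1 ⟩) (μ ⟨ 0 ⟩ ⟨ 1 ⟩) v))
      (sym (cong₂ _-_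
        (cong₂ ℤ._+_ (cong (_-_ (S κ μ (2 ∷ 0 ∷ v))) (S-zeroˡ (null K.l10) v))
          (cong (_-_ (S κ μ (1 ∷ 1 ∷ v)))
            (cong₂ ℤ._+_ (cong₂ ℤ._+_ (S-zeroˡ (null K.l00) v) (S-zeroʳ (null M.l10) v))
              (cong₂ ℤ._+_ (S-zeroˡ (null K.l10) v) (S-zeroˡ (null K.l11) v)))))
        (cong (_-_ (S κ μ (0 ∷ 2 ∷ v))) expand))))
S-Demazure (0 ∷ u) K M v = S-Demazure u (K 0) (M 0) v
S-Demazure (1 ∷ u) K M v = Demazure-resp (λ p q → rearrange (S _ _ (u ++ p ∷ q ∷ v)) (S _ _ (u ++ p ∷ q ∷ v)) _ _) (λ _ _ → refl)
  (Demazure-+ (S-Demazure u (K 0) (M 1) v) (S-Demazure u (K 1) (M 0) v))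
  where
  rearrange : ∀ a b c d → (a ℤ.- b) ℤ.+ (c ℤ.- d) ≡ (a ℤ.+ c) ℤ.- (b ℤ.+ d)
  rearrange = solve-∀
S-Demazure (2 ∷ u) K M v = S-Demazure u (K 1) (M 1) v
S-Demazure (suc (suc (suc _)) ∷ u) K M v = Demazure-0

-- Indicators of the order ideals A_m(w)

next : ℕ → ℕ → ℕ → (ℕ → Bool) → Bool
next 0 0 δ k = k δ
next 1 1 δ k = k δ
next 1 0 δ k = k (suc δ)
next 0 1 zero k = false
next 0 1 (suc δ) k = k δ
next _ _ _ _ = false

-- v and y are 0/1 vectors of equal weight, and each prefix of v outweighs that of y; δ is the excess so far.
-- For the sets they indicate this is α ≤ γ entrywise.
dom : ℕ → Exp → (ℕ → ℕ) → Bool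
dom δ [] y = δ ≡ᵇ 0
dom δ (x ∷ v) y = next x (y 0) δ (λ δ' → dom δ' v (y ∘ suc))

next-cong : ∀ x y δ {k k'} → (∀ δ → k δ ≡ k' δ) → next x y δ k ≡ next x y δ k'
next-cong 0 0 δ h = h δ
next-cong 1 1 δ h = h δ
next-cong 1 0 δ h = h (suc δ)
next-cong 0 1 zero h = refl
next-cong 0 1 (suc δ) h = h δ
next-cong 0 (suc (suc y)) δ h = refl
next-cong 1 (suc (suc y)) δ h = refl
next-cong (suc (suc x)) y δ h = refl

dom-cong : ∀ δ v {y y'} → (∀ j → y j ≡ y' j) → dom δ v y ≡ dom δ v y'
dom-cong δ [] h = refl
dom-cong δ (x ∷ v) {y} {y'} h rewrite h 0 = next-cong x (y' 0) δ λ δ' → dom-cong δ' v (h ∘ suc)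

dom-nonbit : ∀ δ u x v y → dom δ (u ++ suc (suc x) ∷ v) y ≡ false
dom-nonbit δ [] x v y = refl
dom-nonbit δ (z ∷ u) x v y = trans (next-cong z (y 0) δ λ δ' → dom-nonbit δ' u x v (y ∘ suc)) (next-false z (y 0) δ)
  where
  next-false : ∀ x y δ → next x y δ (λ _ → false) ≡ false
  next-false 0 0 δ = refl
  next-false 1 1 δ = refl
  next-false 1 0 δ = refl
  next-false 0 1 zero = refl
  next-false 0 1 (suc δ) = refl
  next-false 0 (suc (suc y)) δ = refl
  next-false 1 (suc (suc y)) δ = refl
  next-false (suc (suc x)) y δ = refl

𝔻 : (ℕ → ℕ) → Exp → ℤ
𝔻 y v = ⟦ dom 0 v y ⟧

-- The pair (0 , 1) is left out: it would mean that i + 1 but not i lies among w(1), ..., w(m),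
-- which ℓ(s_i w) > ℓ(w) forbids.
Ordered : ℕ → ℕ → Set
Ordered r s = (r ≡ 0 × s ≡ 0) ⊎ (r ≡ 1 × s ≡ 1) ⊎ (r ≡ 1 × s ≡ 0)

sw-suc : ∀ n j → sw (suc n) (suc j) ≡ suc (sw n j)
sw-suc n j with j ≡ᵇ n | j ≡ᵇ suc n
... | true | _ = refl
... | false | true = refl
... | false | false = refl

Lift-zero : ∀ n → Lift n (λ _ → + 0) (λ _ → + 0)
Lift-zero zero = record { l00 = λ _ → refl ; l11 = λ _ → refl ; l10 = λ _ → refl ; l01 = λ _ → refl }
Lift-zero (suc n) b = Lift-zero n

-- Swapping two letters of `y` alters the prefix condition only between positions i and i + 1. In
-- each identity the excess after the pair is the same on both sides, and the condition between the
-- two letters is already implied by those before and after the pair. For `y` equal to (1 , 0) and v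
-- to (0 , 1) this needs the swap, which is how new sets appear.
dom-Lift : ∀ n {y y'} → (∀ j → y' j ≡ y (sw n j)) → Ordered (y n) (y (suc n)) → ∀ δ →
  Lift n (λ v → ⟦ dom δ v y ⟧) (λ v → ⟦ dom δ v y' ⟧)
dom-Lift zero {y} {y'} h o δ = record
  { l00 = λ v → cong ⟦_⟧ (go l00 v (h 0) (h 1) o)
  ; l11 = λ v → cong ⟦_⟧ (go l11 v (h 0) (h 1) o)
  ; l10 = λ v → cong ⟦_⟧ (go l10 v (h 0) (h 1) o)
  ; l01 = λ v → cong ⟦_⟧ (go l01 v (h 0) (h 1) o)
  }
  where
  data Move : ℕ → ℕ → ℕ → ℕ → Set where
    l00 : Move 0 0 0 0
    l11 : Move 1 1 1 1
    l10 : Move 1 0 1 0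
    l01 : Move 0 1 1 0
  two : (ℕ → ℕ) → ℕ → ℕ → ℕ → ℕ → Exp → ℕ → Bool
  two z p q a b v δ = next p a δ λ δ → next q b δ λ δ → dom δ v z
  y₂ y₂' : ℕ → ℕ
  y₂ = y ∘ suc ∘ suc
  y₂' = y' ∘ suc ∘ suc
  rest : ∀ v δ → dom δ v y₂' ≡ dom δ v y₂
  rest v δ = dom-cong δ v λ j → h (suc (suc j))
  once : ∀ v δ → (next 0 1 δ λ δ → dom δ v y₂') ≡ (next 0 1 δ λ δ → dom δ v y₂)
  once v δ = next-cong 0 1 δ (rest v)
  go : ∀ {p q r s a b a' b'} → Move p q r s → ∀ v → a' ≡ b → b' ≡ a → Ordered a b →
    two y₂' p q a' b' v δ ≡ two y₂ r s a b v δ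
  go l00 v refl refl (inj₁ (refl , refl)) = rest v δ
  go l11 v refl refl (inj₁ (refl , refl)) = rest v (2 + δ)
  go l10 v refl refl (inj₁ (refl , refl)) = rest v (1 + δ)
  go l01 v refl refl (inj₁ (refl , refl)) = rest v (1 + δ)
  go l00 v refl refl (inj₂ (inj₁ (refl , refl))) = next-cong 0 1 δ (once v)
  go l11 v refl refl (inj₂ (inj₁ (refl , refl))) = rest v δ
  go l10 v refl refl (inj₂ (inj₁ (refl , refl))) = once v δ
  go l01 v refl refl (inj₂ (inj₁ (refl , refl))) = late δ
    where
    late : ∀ δ → two y₂' 0 1 1 1 v δ ≡ two y₂ 1 0 1 1 v δ
    late zero = refl
    late (suc δ) = rest v δ
  go l00 v refl refl (inj₂ (inj₂ (refl , refl))) = late δ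
    where
    late : ∀ δ → two y₂' 0 0 0 1 v δ ≡ two y₂ 0 0 1 0 v δ
    late zero = refl
    late (suc δ) = rest v δ
  go l11 v refl refl (inj₂ (inj₂ (refl , refl))) = rest v (suc δ)
  go l10 v refl refl (inj₂ (inj₂ (refl , refl))) = rest v δ
  go l01 v refl refl (inj₂ (inj₂ (refl , refl))) = rest v δ
dom-Lift (suc n) {y} {y'} h o δ b = go b (y 0) (y' 0) (h 0) δ
  where
  IH : ∀ δ → Lift n (λ v → ⟦ dom δ v (y ∘ suc) ⟧) (λ v → ⟦ dom δ v (y' ∘ suc) ⟧)
  IH = dom-Lift n (λ j → trans (h (suc j)) (cong y (sw-suc n j))) o
  go : ∀ b r r' → r' ≡ r → ∀ δ → Lift n (λ v → ⟦ next b r δ (λ δ → dom δ v (y ∘ suc)) ⟧)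
    (λ v → ⟦ next b r' δ (λ δ → dom δ v (y' ∘ suc)) ⟧)
  go 0 0 _ refl δ = IH δ
  go 1 1 _ refl δ = IH δ
  go 1 0 _ refl δ = IH (suc δ)
  go 0 1 _ refl zero = Lift-zero n
  go 0 1 _ refl (suc δ) = IH δ
  go 0 (suc (suc r)) _ refl δ = Lift-zero n
  go 1 (suc (suc r)) _ refl δ = Lift-zero n
  go (suc (suc b)) r _ refl δ = Lift-zero n

Lift-at : ∀ u {κ κ'} → Lift (length u) κ κ' → Lift₀ (λ v → κ (u ++ v)) (λ v → κ' (u ++ v))
Lift-at [] L = L
Lift-at (x ∷ u) L = Lift-at u (L x)

-- the new sets s_i α contain i + 1 but not i, so π_i annihilates their sum
new-Demazure : ∀ u {y y'} → Lift (length u) (𝔻 y) (𝔻 y') → ∀ v →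
  Demazure (λ p q → 𝔻 y' (u ++ p ∷ q ∷ v) - 𝔻 y (u ++ p ∷ q ∷ v)) (λ _ _ → + 0)
new-Demazure u {y} {y'} L v = record
  { f-suppˡ = λ p q → first (suc p) q
  ; f-suppʳ = λ p q → second p (suc q)
  ; g-suppˡ = λ _ _ → refl
  ; g-suppʳ = λ _ _ → refl
  ; at00 = sym (ℤP.i≡j⇒i-j≡0 (l00 v))
  ; at22 = sym (first 0 2)
  ; at10 = sym (ℤP.i≡j⇒i-j≡0 (l10 v))
  ; at01 = sym (ℤP.i≡j⇒i-j≡0 (l10 v))
  ; at20 = sym (first 0 0)
  ; at02 = sym (first 0 0)
  ; at21 = sym (first 0 1)
  ; at12 = sym (first 0 1)
  ; at11 = sym (cong₂ _-_ (cong₂ ℤ._+_ (first 0 0) (ℤP.i≡j⇒i-j≡0 (l11 v))) (second 0 0))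
  }
  where
  open Lift₀ (Lift-at u L)
  first : ∀ p q → 𝔻 y' (u ++ 2 + p ∷ q ∷ v) - 𝔻 y (u ++ 2 + p ∷ q ∷ v) ≡ + 0
  first p q = cong₂ _-_ (cong ⟦_⟧ (dom-nonbit 0 u p (q ∷ v) y')) (cong ⟦_⟧ (dom-nonbit 0 u p (q ∷ v) y))
  second : ∀ p q → 𝔻 y' (u ++ p ∷ 2 + q ∷ v) - 𝔻 y (u ++ p ∷ 2 + q ∷ v) ≡ + 0
  second p q rewrite sym (LP.++-assoc u (p ∷ []) (2 + q ∷ v)) =
    cong₂ _-_ (cong ⟦_⟧ (dom-nonbit 0 (u ++ p ∷ []) q v y')) (cong ⟦_⟧ (dom-nonbit 0 (u ++ p ∷ []) q v y))

-- Serves twice: as the indicator of {1, ..., m} and as the t-exponent of T_m.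
seg : ℕ → ℕ → ℕ
seg m j = if j <ᵇ m then 1 else 0

dom-surplus : ∀ δ v → dom (suc δ) v (seg 0) ≡ false
dom-surplus δ [] = refl
dom-surplus δ (0 ∷ v) = dom-surplus δ v
dom-surplus δ (1 ∷ v) = dom-surplus (suc δ) v
dom-surplus δ (suc (suc x) ∷ v) = refl

-- From positive height a down step must come, and it would put an element into β although the only
-- β allowed is empty.
W-seg0-up : ∀ μ e h → W (𝔻 (seg 0)) μ e (suc h) ≡ + 0
W-seg0-up μ [] h = refl
W-seg0-up μ (0 ∷ e) h = W-seg0-up (μ ⟨ 0 ⟩) e h
W-seg0-up μ (1 ∷ e) h =
  cong₂ ℤ._+_ (W-seg0-up (μ ⟨ 0 ⟩) e (suc h)) (W-zeroˡ (λ v → cong ⟦_⟧ (dom-surplus 0 v)) e h)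
W-seg0-up μ (2 ∷ e) h = W-zeroˡ (λ v → cong ⟦_⟧ (dom-surplus 0 v)) e (suc h)
W-seg0-up μ (suc (suc (suc x)) ∷ e) h = refl

-- A_m(Id) consists of {1, ..., m} alone. So there is one splitting, and for the same η one path,
-- made of level steps only. This matches P_Id = 1, which has no term in T_k T_l.
W≡S-id : ∀ k d e → W (𝔻 (seg k)) (𝔻 (seg (k + d))) e 0 ≡ S (𝔻 (seg k)) (𝔻 (seg (k + d))) e
W≡S-id k d [] = refl
W≡S-id zero zero (0 ∷ e) = W≡S-id 0 0 e
W≡S-id zero (suc d) (0 ∷ e) = trans (W-zeroʳ (λ _ → refl) e 0) (sym (S-zeroʳ (λ _ → refl) e))
W≡S-id (suc k) d (0 ∷ e) = trans (W-zeroˡ (λ _ → refl) e 0) (sym (S-zeroˡ (λ _ → refl) e))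
W≡S-id zero zero (1 ∷ e) = trans
  (cong₂ ℤ._+_ (W-zeroʳ (λ v → cong ⟦_⟧ (dom-surplus 0 v)) e 0) (W-seg0-up _ e 0))
  (sym (cong₂ ℤ._+_ (S-zeroʳ (λ v → cong ⟦_⟧ (dom-surplus 0 v)) e) (S-zeroˡ (λ v → cong ⟦_⟧ (dom-surplus 0 v)) e)))
W≡S-id zero (suc d) (1 ∷ e) = cong₂ ℤ._+_ (W≡S-id 0 d e)
  (trans (W-zeroʳ (λ _ → refl) e 1) (sym (S-zeroʳ (λ _ → refl) e)))
W≡S-id (suc k) d (1 ∷ e) = trans
  (cong₂ ℤ._+_ (W-zeroˡ (λ _ → refl) e 0) (W-zeroˡ (λ _ → refl) e 1))
  (sym (cong₂ ℤ._+_ (S-zeroˡ (λ _ → refl) e) (S-zeroʳ (λ _ → refl) e)))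
W≡S-id zero d (2 ∷ e) = trans (W-zeroˡ (λ v → cong ⟦_⟧ (dom-surplus 0 v)) e 0)
  (sym (S-zeroˡ (λ v → cong ⟦_⟧ (dom-surplus 0 v)) e))
W≡S-id (suc k) d (2 ∷ e) = W≡S-id k d e
W≡S-id k d (suc (suc (suc x)) ∷ e) = refl

-- Slices in t

epsL : List (ℕ × Exp) → ℕ → Exp → ℤ
epsL [] m e = + 0
epsL ((n , ν) ∷ L) m e = (if n ≡ᵇ m then 𝟙 ν e else + 0) ℤ.+ epsL L m e

-- Coefficients in t of a product P ∏ (1 − x^ν T_n) over (n , ν) ∈ L, where P has constant term 1, no terms in T_m,
-- and M at T_k T_l, and only weakly decreasing exponents of t occur; ε m sums the x^ν with (m , ν) ∈ L.
record Slices (k l R : ℕ) (M : Exp → ℤ) (ε : ℕ → Exp → ℤ) (f : Exp → Exp → ℤ) : Set where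
  field
    rising : ∀ e τ j → R ≤ length e → nth τ j < nth τ (suc j) → f e τ ≡ + 0
    constant : ∀ e τ → R ≤ length e → (∀ j → nth τ j ≡ 0) → f e τ ≡ 𝟙 [] e
    linear : ∀ m → 1 ≤ m → m ≤ l → ∀ e τ → R ≤ length e → (∀ j → nth τ j ≡ seg m j) → f e τ ≡ - ε m e
    quadratic : ∀ e τ → R ≤ length e → (∀ j → nth τ j ≡ seg k j + seg l j) → f e τ ≡ M e ℤ.+ S (ε k) (ε l) e

Slices-resp : ∀ {k l R M ε ε' f f'} → (∀ m e → ε m e ≡ ε' m e) → (∀ e τ → f e τ ≡ f' e τ) →
  Slices k l R M ε f → Slices k l R M ε' f'
Slices-resp {k} {l} {M = M} p q I = record
  { rising = λ e τ j r h → trans (sym (q e τ)) (rising e τ j r h)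
  ; constant = λ e τ r h → trans (sym (q e τ)) (constant e τ r h)
  ; linear = λ m m≥1 m≤l e τ r h → trans (sym (q e τ)) (trans (linear m m≥1 m≤l e τ r h) (cong -_ (p m e)))
  ; quadratic = λ e τ r h → trans (sym (q e τ)) (trans (quadratic e τ r h) (cong (λ z → M e ℤ.+ z) (S-cong (p k) (p l) e)))
  }
  where open Slices I

seg-< : ∀ m j → j < m → seg m j ≡ 1
seg-< (suc m) zero _ = refl
seg-< (suc m) (suc j) (s≤s h) = seg-< m j h

seg-≥ : ∀ m j → m ≤ j → seg m j ≡ 0
seg-≥ zero j _ = refl
seg-≥ (suc m) (suc j) (s≤s h) = seg-≥ m j h

nth-tExp : ∀ m j → nth (tExp m) j ≡ seg m j
nth-tExp zero j = refl
nth-tExp (suc m) zero = refl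
nth-tExp (suc m) (suc j) = nth-tExp m j

seg-antitone : ∀ m j → (seg m j ≡ 1 × seg m (suc j) ≡ 1) ⊎ seg m (suc j) ≡ 0
seg-antitone m j with suc j ℕP.<? m
... | yes h = inj₁ (seg-< m j (ℕP.<-trans (ℕP.n<1+n j) h) , seg-< m (suc j) h)
... | no h = inj₂ (seg-≥ m (suc j) (ℕP.≮⇒≥ h))

length-subE : ∀ e ν → length (subE e ν) ≡ length e
length-subE e [] = refl
length-subE [] (x ∷ ν) = refl
length-subE (y ∷ e) (x ∷ ν) = cong suc (length-subE e ν)

shift-0 : ∀ ν τ f e t → (leqE τ t ≡ true → f (subE e ν) (subE t τ) ≡ + 0) → shift (ν , τ) f e t ≡ + 0
shift-0 ν τ f e t h with leqE ν e | leqE τ t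
... | true | true = h refl
... | true | false = refl
... | false | _ = refl

shift-value : ∀ ν τ f e t {z} → leqE τ t ≡ true → f (subE e ν) (subE t τ) ≡ z →
  shift (ν , τ) f e t ≡ (if leqE ν e then z else + 0)
shift-value ν τ f e t h refl rewrite h | BP.∧-identityʳ (leqE ν e) = refl

S-𝟙-eps : ∀ {ν} L m → Bits ν → All (Bits ∘ proj₂) L → ∀ e →
  S (𝟙 ν) (epsL L m) e ≡ (if leqE ν e then epsL L m (subE e ν) else + 0)
S-𝟙-eps {ν} [] m bν bs e with leqE ν e
... | true = S-zeroʳ (λ _ → refl) e
... | false = S-zeroʳ (λ _ → refl) e
S-𝟙-eps {ν} ((n , μ) ∷ L) m bν (bμ ∷ bs) e = trans (S-+ʳ (𝟙 ν) (λ v → if n ≡ᵇ m then 𝟙 μ v else + 0) (epsL L m) e)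
  (trans (cong₂ ℤ._+_ (one (n ≡ᵇ m)) (S-𝟙-eps L m bν bs e)) (join (leqE ν e)))
  where
  one : ∀ b → S (𝟙 ν) (λ v → if b then 𝟙 μ v else + 0) e
    ≡ (if leqE ν e then (if b then 𝟙 μ (subE e ν) else + 0) else + 0)
  one true = trans (S-𝟙 bν bμ e) (trans (cong (λ x → 𝟙 x e) (addE-comm ν μ))
    (trans (cong ⟦_⟧ (eqE-addE μ ν e)) (if-∧ (leqE ν e) (eqE μ (subE e ν)))))
  one false with leqE ν e
  ... | true = S-zeroʳ (λ _ → refl) e
  ... | false = S-zeroʳ (λ _ → refl) e
  join : ∀ b {x y} → (if b then x else + 0) ℤ.+ (if b then y else + 0) ≡ (if b then x ℤ.+ y else + 0)
  join true = refl
  join false = refl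

neg-if : ∀ b x → (if b then - x else + 0) ≡ - (if b then x else + 0)
neg-if true x = refl
neg-if false x = refl

module _ {k l R : ℕ} {M : Exp → ℤ} (k≥1 : 1 ≤ k) (k<l : k < l) where

  -- The product changes a coefficient at τ by one at τ / T_m. If T_m is one of the factors T_n,
  -- T_k, T_l of τ, what remains is a constant or linear coefficient, already known. If it divides τ
  -- without being one of them, what remains rises from place m to m + 1, where `f` vanishes. The
  -- new monomial is never paired with itself, since k ≠ l.
  Slices-factor : ∀ {L f} → Slices k l R M (epsL L) f → All (Bits ∘ proj₂) L →
    ∀ {m ν} → 1 ≤ m → Bits ν →
    Slices k l R M (epsL ((m , ν) ∷ L)) (λ e t → f e t - shift (ν , tExp m) f e t)
  Slices-factor {L} {f} I bs {m} {ν} m≥1 bν = record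
    { rising = rising'
    ; constant = constant'
    ; linear = linear'
    ; quadratic = quadratic'
    }
    where
    open Slices I
    long : ∀ e → R ≤ length e → R ≤ length (subE e ν)
    long e = subst (R ≤_) (sym (length-subE e ν))
    at : ∀ τ j → nth (subE τ (tExp m)) j ≡ nth τ j ∸ seg m j
    at τ j = trans (nth-subE τ (tExp m) j) (cong (nth τ j ∸_) (nth-tExp m j))
    below : ∀ τ → leqE (tExp m) τ ≡ true → ∀ j → seg m j ≤ nth τ j
    below τ h j = subst (_≤ nth τ j) (nth-tExp m j) (leqE→nth (tExp m) τ h j)
    f-rising : ∀ e τ j → R ≤ length e → nth τ j ∸ seg m j < nth τ (suc j) ∸ seg m (suc j) →
      f (subE e ν) (subE τ (tExp m)) ≡ + 0
    f-rising e τ j r h = rising _ _ j (long e r) (subst₂ _<_ (sym (at τ j)) (sym (at τ (suc j))) h)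
    keep : ∀ {a b c} → a ≡ c → b ≡ + 0 → a - b ≡ c
    keep refl refl = ℤP.+-identityʳ _

    rising' : ∀ e τ j → R ≤ length e → nth τ j < nth τ (suc j) → f e τ - shift (ν , tExp m) f e τ ≡ + 0
    rising' e τ j r h = keep (rising e τ j r h) (shift-0 ν (tExp m) f e τ λ le →
      f-rising e τ j r (fall (below τ le j) h (seg-antitone m j)))
      where
      -- `seg m` is weakly decreasing, so subtracting it cannot destroy a rise.
      fall : ∀ {x y s s'} → s ≤ x → x < y → (s ≡ 1 × s' ≡ 1) ⊎ s' ≡ 0 → x ∸ s < y ∸ s'
      fall {zero} () _ (inj₁ (refl , refl))
      fall {suc x} {suc y} s≤x (s≤s x<y) (inj₁ (refl , refl)) = x<y
      fall {x} {s = s} s≤x x<y (inj₂ refl) = ℕP.≤-<-trans (ℕP.m∸n≤m x s) x<y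

    constant' : ∀ e τ → R ≤ length e → (∀ j → nth τ j ≡ 0) → f e τ - shift (ν , tExp m) f e τ ≡ 𝟙 [] e
    constant' e τ r h = keep (constant e τ r h) (shift-0 ν (tExp m) f e τ λ le →
      ⊥-elim (absurd (subst (seg m 0 ≤_) (h 0) (below τ le 0))))
      where
      absurd : ¬ seg m 0 ≤ 0
      absurd p rewrite seg-< m 0 m≥1 with p
      ... | ()

    linear' : ∀ n → 1 ≤ n → n ≤ l → ∀ e τ → R ≤ length e → (∀ j → nth τ j ≡ seg n j) →
      f e τ - shift (ν , tExp m) f e τ ≡ - epsL ((m , ν) ∷ L) n e
    linear' n n≥1 n≤l e τ r h with ℕP.<-cmp m n
    ... | tri≈ _ refl _ rewrite ≡ᵇ-refl m = trans (cong₂ _-_ (linear n n≥1 n≤l e τ r h)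
        (trans (shift-value ν (tExp m) f e τ (nth→leqE (tExp m) τ λ j → ℕP.≤-reflexive (trans (nth-tExp m j) (sym (h j))))
          (constant _ _ (long e r) λ j → trans (at τ j) (trans (cong (_∸ seg m j) (h j)) (ℕP.n∸n≡0 (seg m j)))))
        (sym (trans (cong ⟦_⟧ (eqE-addE [] ν e)) (if-∧ (leqE ν e) (eqE [] (subE e ν))))))) (neg-sum (epsL L n e) (𝟙 ν e))
      where
      neg-sum : ∀ a b → ℤ.- a ℤ.- b ≡ ℤ.- (b ℤ.+ a)
      neg-sum = solve-∀
    linear' n n≥1 n≤l e τ r h | tri< m<n m≢n _ rewrite ≡ᵇ-false m n m≢n =
      keep (trans (linear n n≥1 n≤l e τ r h) (cong -_ (sym (ℤP.+-identityˡ _)))) (shift-0 ν (tExp m) f e τ λ _ →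
        dip m m≥1 m<n refl)
      where
      dip : ∀ m' → 1 ≤ m' → m' < n → m' ≡ m → f (subE e ν) (subE τ (tExp m)) ≡ + 0
      dip (suc m') _ m<n refl = f-rising e τ m' r (subst₂ _<_
        (sym (cong₂ _∸_ (trans (h m') (seg-< n m' (ℕP.<-trans (ℕP.n<1+n m') m<n))) (seg-< (suc m') m' ℕP.≤-refl)))
        (sym (cong₂ _∸_ (trans (h (suc m')) (seg-< n (suc m') m<n)) (seg-≥ (suc m') (suc m') ℕP.≤-refl)))
        (s≤s z≤n))
    linear' n n≥1 n≤l e τ r h | tri> _ m≢n n<m rewrite ≡ᵇ-false m n m≢n =
      keep (trans (linear n n≥1 n≤l e τ r h) (cong -_ (sym (ℤP.+-identityˡ _)))) (shift-0 ν (tExp m) f e τ λ le →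
        ⊥-elim (ℕP.<⇒≱ (s≤s z≤n) (subst₂ _≤_ (seg-< m n n<m) (trans (h n) (seg-≥ n n ℕP.≤-refl)) (below τ le n))))

    χ : ℕ → Exp → ℤ
    χ n v = if m ≡ᵇ n then 𝟙 ν v else + 0

    expand : ∀ e → S (epsL ((m , ν) ∷ L) k) (epsL ((m , ν) ∷ L) l) e
      ≡ (S (χ k) (χ l) e ℤ.+ S (χ k) (epsL L l) e) ℤ.+ (S (epsL L k) (χ l) e ℤ.+ S (epsL L k) (epsL L l) e)
    expand e = trans (S-+ˡ (χ k) (epsL L k) _ e)
      (cong₂ ℤ._+_ (S-+ʳ (χ k) (χ l) (epsL L l) e) (S-+ʳ (epsL L k) (χ l) (epsL L l) e))

    χ-hit : ∀ n → m ≡ n → ∀ v → χ n v ≡ 𝟙 ν v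
    χ-hit n refl v rewrite ≡ᵇ-refl m = refl
    χ-miss : ∀ n → ¬ m ≡ n → ∀ v → χ n v ≡ + 0
    χ-miss n h v rewrite ≡ᵇ-false m n h = refl

    quadratic' : ∀ e τ → R ≤ length e → (∀ j → nth τ j ≡ seg k j + seg l j) →
      f e τ - shift (ν , tExp m) f e τ ≡ M e ℤ.+ S (epsL ((m , ν) ∷ L) k) (epsL ((m , ν) ∷ L) l) e
    quadratic' e τ r h = trans (cases (m ℕP.≟ k) (m ℕP.≟ l)) (cong (λ z → M e ℤ.+ z) (sym (expand e)))
      where
      goal = f e τ - shift (ν , tExp m) f e τ ≡ M e ℤ.+
        ((S (χ k) (χ l) e ℤ.+ S (χ k) (epsL L l) e) ℤ.+ (S (epsL L k) (χ l) e ℤ.+ S (epsL L k) (epsL L l) e))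
      inside : m ≡ k ⊎ m ≡ l → leqE (tExp m) τ ≡ true
      inside c = nth→leqE (tExp m) τ λ j → subst₂ _≤_ (sym (nth-tExp m j)) (sym (h j)) (part c j)
        where
        part : m ≡ k ⊎ m ≡ l → ∀ j → seg m j ≤ seg k j + seg l j
        part (inj₁ refl) j = ℕP.m≤m+n _ _
        part (inj₂ refl) j = ℕP.m≤n+m _ _
      S₀ = S (epsL L k) (epsL L l) e
      first : ∀ m s t → (m ℤ.+ s) ℤ.- ℤ.- t ≡ m ℤ.+ ((+ 0 ℤ.+ t) ℤ.+ (+ 0 ℤ.+ s))
      first = solve-∀
      second : ∀ m s t → (m ℤ.+ s) ℤ.- ℤ.- t ≡ m ℤ.+ ((+ 0 ℤ.+ + 0) ℤ.+ (t ℤ.+ s))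
      second = solve-∀
      neither : ∀ m s → (m ℤ.+ s) ℤ.- + 0 ≡ m ℤ.+ ((+ 0 ℤ.+ + 0) ℤ.+ (+ 0 ℤ.+ s))
      neither = solve-∀
      cases : Dec (m ≡ k) → Dec (m ≡ l) → goal
      cases (yes p) (yes q) = ⊥-elim (ℕP.<-irrefl (trans (sym p) q) k<l)
      cases (yes p) (no q) = trans (cong₂ _-_ (quadratic e τ r h)
          (trans (shift-value ν (tExp m) f e τ (inside (inj₁ p)) (linear l (ℕP.≤-trans k≥1 (ℕP.<⇒≤ k<l)) ℕP.≤-refl _ _ (long e r) λ j →
            trans (at τ j) (trans (cong₂ _∸_ (h j) (cong (λ x → seg x j) p)) (ℕP.m+n∸m≡n (seg k j) (seg l j)))))
          (neg-if (leqE ν e) (epsL L l (subE e ν)))))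
        (trans (first (M e) S₀ _) (cong (λ z → M e ℤ.+ z) (cong₂ ℤ._+_
          (cong₂ ℤ._+_ (sym (S-zeroʳ (χ-miss l q) e))
            (sym (trans (S-cong (χ-hit k p) (λ _ → refl) e) (S-𝟙-eps L l bν bs e))))
          (cong (ℤ._+ S₀) (sym (S-zeroʳ (χ-miss l q) e))))))
      cases (no p) (yes q) = trans (cong₂ _-_ (quadratic e τ r h)
          (trans (shift-value ν (tExp m) f e τ (inside (inj₂ q)) (linear k k≥1 (ℕP.<⇒≤ k<l) _ _ (long e r) λ j →
            trans (at τ j) (trans (cong₂ _∸_ (h j) (cong (λ x → seg x j) q)) (ℕP.m+n∸n≡m (seg k j) (seg l j)))))
          (neg-if (leqE ν e) (epsL L k (subE e ν)))))
        (trans (second (M e) S₀ _) (cong (λ z → M e ℤ.+ z) (cong₂ ℤ._+_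
          (sym (cong₂ ℤ._+_ (S-zeroˡ (χ-miss k p) e) (S-zeroˡ (χ-miss k p) e)))
          (cong (ℤ._+ S₀) (sym (trans (S-comm (epsL L k) (χ l) e)
            (trans (S-cong (χ-hit l q) (λ _ → refl) e) (S-𝟙-eps L k bν bs e))))))))
      cases (no p) (no q) = trans (cong₂ _-_ (quadratic e τ r h) (shift-0 ν (tExp m) f e τ (λ le → dip m m≥1 refl le)))
        (trans (neither (M e) S₀) (cong (λ z → M e ℤ.+ z) (cong₂ ℤ._+_
          (sym (cong₂ ℤ._+_ (S-zeroˡ (χ-miss k p) e) (S-zeroˡ (χ-miss k p) e)))
          (cong (ℤ._+ S₀) (sym (S-zeroʳ (χ-miss l q) e))))))
        where
        -- if m ≤ l is neither k nor l, the exponents of T_k T_l / T_m rise from m to m + 1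
        rise : ∀ m' → suc m' ≡ m → m < l → ∀ a → seg k m' ≡ a → seg k (suc m') ≡ a → f (subE e ν) (subE τ (tExp m)) ≡ + 0
        rise m' refl m<l a p q = f-rising e τ m' r (subst₂ _<_
          (sym (trans (cong₂ _∸_ (trans (h m') (cong₂ _+_ p (seg-< l m' (ℕP.<-trans (ℕP.n<1+n m') m<l)))) (seg-< (suc m') m' ℕP.≤-refl))
            (ℕP.m+n∸n≡m a 1)))
          (sym (trans (cong₂ _∸_ (trans (h (suc m')) (cong₂ _+_ q (seg-< l (suc m') m<l))) (seg-≥ (suc m') (suc m') ℕP.≤-refl))
            (ℕP.+-comm a 1)))
          ℕP.≤-refl)
        dip : ∀ m' → 1 ≤ m' → m' ≡ m → leqE (tExp m) τ ≡ true → f (subE e ν) (subE τ (tExp m)) ≡ + 0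
        dip (suc m') _ refl le with ℕP.<-cmp m l
        ... | tri≈ _ m≡l _ = ⊥-elim (q m≡l)
        ... | tri> _ _ l<m = ⊥-elim (ℕP.<⇒≱ (s≤s z≤n) (subst₂ _≤_ (seg-< m l l<m)
              (trans (h l) (cong₂ _+_ (seg-≥ k l (ℕP.<⇒≤ k<l)) (seg-≥ l l ℕP.≤-refl))) (below τ le l)))
        ... | tri< m<l _ _ with ℕP.<-cmp m k
        ...   | tri≈ _ m≡k _ = ⊥-elim (p m≡k)
        ...   | tri< m<k _ _ = rise m' refl m<l 1 (seg-< k m' (ℕP.<-trans (ℕP.n<1+n m') m<k)) (seg-< k m m<k)
        ...   | tri> _ _ k<m = rise m' refl m<l 0 (seg-≥ k m' (ℕP.≤-pred k<m)) (seg-≥ k m (ℕP.<⇒≤ k<m))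

  *P-oneP : ∀ P → P *P oneP ≡ P
  *P-oneP [] = refl
  *P-oneP ((c , (e , t)) ∷ P) = cong₂ _∷_ (cong₂ _,_ (ℤP.*-identityʳ c) (cong₂ _,_ (addE-[] e) (addE-[] t))) (*P-oneP P)

  -- By associativity the factors are absorbed one at a time; `L₀` holds those already absorbed.
  Slices-product : ∀ L L₀ P → All (λ x → 1 ≤ proj₁ x × Bits (proj₂ x)) L → All (Bits ∘ proj₂) L₀ →
    Slices k l R M (epsL L₀) (coeff′ P) →
    Slices k l R M (λ m e → epsL L m e ℤ.+ epsL L₀ m e) (coeff′ (P *P prodP (map factor L)))
  Slices-product [] L₀ P gs bs I =
    Slices-resp (λ m e → sym (ℤP.+-identityˡ _)) (λ e t → cong (λ Q → coeff′ Q e t) (sym (*P-oneP P))) I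
  Slices-product ((m , ν) ∷ L) L₀ P ((m≥1 , bν) ∷ gs) bs I =
    Slices-resp (λ n e → rearrange (epsL L n e) (if m ≡ᵇ n then 𝟙 ν e else + 0) (epsL L₀ n e))
      (λ e t → cong (λ Q → coeff′ Q e t) (*P-assoc P (factor (m , ν)) (prodP (map factor L))))
      (Slices-product L ((m , ν) ∷ L₀) (P *P factor (m , ν)) gs (bν ∷ bs)
        (Slices-resp (λ _ _ → refl) (λ e t → sym (coeff-*factor P m ν e t)) (Slices-factor I bs m≥1 bν)))
    where
    rearrange : ∀ a b c → a ℤ.+ (b ℤ.+ c) ≡ (b ℤ.+ a) ℤ.+ c
    rearrange = solve-∀

-- Sorted lists and exponent vectors

-- the increasing sequence with e_j entries equal to j, the exponents being numbered from s
pos : ℕ → Exp → List ℕ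
pos s [] = []
pos s (x ∷ e) = replicate x s ++ pos (suc s) e

All-pos : ∀ s e → All (s ≤_) (pos s e)
All-pos s [] = []
All-pos s (x ∷ e) = AllP.++⁺ (AllP.replicate⁺ x ℕP.≤-refl) (All.map ℕP.<⇒≤ (All-pos (suc s) e))

pos-ext : ∀ s a b → (∀ j → nth a j ≡ nth b j) → pos s a ≡ pos s b
pos-ext s [] [] h = refl
pos-ext s [] (y ∷ b) h rewrite sym (h 0) = pos-ext (suc s) [] b (h ∘ suc)
pos-ext s (x ∷ a) [] h rewrite h 0 = pos-ext (suc s) a [] (h ∘ suc)
pos-ext s (x ∷ a) (y ∷ b) h rewrite h 0 = cong (replicate y s ++_) (pos-ext (suc s) a b (h ∘ suc))

insertL-≤ : ∀ x L → All (x ≤_) L → insertL x L ≡ x ∷ L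
insertL-≤ x [] _ = refl
insertL-≤ x (y ∷ L) (x≤y ∷ _) rewrite ≤ᵇ-complete x≤y = refl

insertL-replicate : ∀ x n s L → s < x → insertL x (replicate n s ++ L) ≡ replicate n s ++ insertL x L
insertL-replicate x zero s L s<x = refl
insertL-replicate x (suc n) s L s<x rewrite ≤ᵇ-false s<x = cong (s ∷_) (insertL-replicate x n s L s<x)

insertL-pos : ∀ n s e → insertL (n + s) (pos s e) ≡ pos s (addE (unitE (suc n)) e)
insertL-pos zero s [] = refl
insertL-pos zero s (x ∷ e) = insertL-≤ s _ (All-pos s (x ∷ e))
insertL-pos (suc n) s [] = trans (cong (λ z → insertL z []) (sym (ℕP.+-suc n s)))
  (trans (insertL-pos n (suc s) []) (cong (pos (suc s)) (addE-[] (unitE (suc n)))))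
insertL-pos (suc n) s (x ∷ e) = trans (insertL-replicate (suc n + s) x s (pos (suc s) e) (s≤s (ℕP.m≤n+m s n)))
  (cong (replicate x s ++_) (trans (cong (λ z → insertL z (pos (suc s) e)) (sym (ℕP.+-suc n s))) (insertL-pos n (suc s) e)))

sortL-pos : ∀ L → All (1 ≤_) L → sortL L ≡ pos 1 (xExp L)
sortL-pos [] _ = refl
sortL-pos (suc n ∷ L) (_ ∷ h) = trans (cong (insertL (suc n)) (sortL-pos L h))
  (trans (cong (λ z → insertL z (pos 1 (xExp L))) (ℕP.+-comm 1 n)) (insertL-pos n 1 (xExp L)))

occ : ℕ → List ℕ → ℕ
occ x [] = 0
occ x (y ∷ L) = (if y ≡ᵇ x then 1 else 0) + occ x L

nth-unitE : ∀ n j → nth (unitE (suc n)) j ≡ (if n ≡ᵇ j then 1 else 0)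
nth-unitE zero zero = refl
nth-unitE zero (suc j) = refl
nth-unitE (suc n) zero = refl
nth-unitE (suc n) (suc j) = nth-unitE n j

nth-xExp : ∀ L → All (1 ≤_) L → ∀ j → nth (xExp L) j ≡ occ (suc j) L
nth-xExp [] _ j = refl
nth-xExp (suc n ∷ L) (_ ∷ h) j = trans (nth-addE (unitE (suc n)) (xExp L) j)
  (cong₂ _+_ (nth-unitE n j) (nth-xExp L h j))

occ-++ : ∀ x L L' → occ x (L ++ L') ≡ occ x L + occ x L'
occ-++ x [] L' = refl
occ-++ x (y ∷ L) L' = trans (cong (λ z → (if y ≡ᵇ x then 1 else 0) + z) (occ-++ x L L')) (sym (ℕP.+-assoc (if y ≡ᵇ x then 1 else 0) (occ x L) (occ x L')))

occ-replicate : ∀ x n → occ x (replicate n x) ≡ n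
occ-replicate x zero = refl
occ-replicate x (suc n) rewrite ≡ᵇ-refl x = cong suc (occ-replicate x n)

occ-≢ : ∀ x L → All (λ y → ¬ y ≡ x) L → occ x L ≡ 0
occ-≢ x [] _ = refl
occ-≢ x (y ∷ L) (h ∷ hs) rewrite ≡ᵇ-false y x h = occ-≢ x L hs

occ-pos : ∀ s e j → occ (j + s) (pos s e) ≡ nth e j
occ-pos s [] j = refl
occ-pos s (x ∷ e) zero = trans (occ-++ s (replicate x s) _) (trans (cong₂ _+_ (occ-replicate s x)
  (occ-≢ s _ (All.map (λ s<y y≡s → ℕP.<-irrefl (sym y≡s) s<y) (All-pos (suc s) e)))) (ℕP.+-identityʳ x))
occ-pos s (x ∷ e) (suc j) = trans (occ-++ (suc j + s) (replicate x s) _) (trans (cong₂ _+_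
  (occ-≢ (suc j + s) _ (AllP.replicate⁺ x λ s≡ → ℕP.<-irrefl s≡ (s≤s (ℕP.m≤n+m s j))))
  (trans (cong (λ z → occ z (pos (suc s) e)) (sym (ℕP.+-suc j s))) (occ-pos (suc s) e j))) refl)

occ-pos₁ : ∀ e j → occ (suc j) (pos 1 e) ≡ nth e j
occ-pos₁ e j = trans (cong (λ z → occ z (pos 1 e)) (ℕP.+-comm 1 j)) (occ-pos 1 e j)

bits-nth : ∀ {e} → Bits e → ∀ j → nth e j ≤ 1
bits-nth [] j = z≤n
bits-nth (0∷ b) zero = z≤n
bits-nth (1∷ b) zero = ℕP.≤-refl
bits-nth (0∷ b) (suc j) = bits-nth b j
bits-nth (1∷ b) (suc j) = bits-nth b j

nth-bits : ∀ e → (∀ j → nth e j ≤ 1) → Bits e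
nth-bits [] h = []
nth-bits (0 ∷ e) h = 0∷ nth-bits e (h ∘ suc)
nth-bits (1 ∷ e) h = 1∷ nth-bits e (h ∘ suc)
nth-bits (suc (suc x) ∷ e) h with h 0
... | s≤s ()

leqB-[] : ∀ L → leqB L [] ≡ (length L ≡ᵇ 0)
leqB-[] [] = refl
leqB-[] (x ∷ L) = refl

leqB-< : ∀ s L L' → All (suc s ≤_) L → leqB L (s ∷ L') ≡ false
leqB-< s [] L' _ = refl
leqB-< s (x ∷ L) L' (s<x ∷ _) rewrite ≤ᵇ-false s<x = refl

-- Q holds the entries of the left sequence that have been read but not yet matched
leqB-queue : ∀ s Q {e Y} → Bits e → Bits Y → length Y ≤ length e → All (_≤ s) Q →
  leqB (Q ++ pos s e) (pos s Y) ≡ dom (length Q) e (nth Y)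
leqB-queue s Q [] [] le hQ rewrite LP.++-identityʳ Q = leqB-[] Q
leqB-queue s Q {x ∷ e} bx [] le hQ = read bx
  where
  up : All (_≤ suc s) Q
  up = All.map ℕP.m≤n⇒m≤1+n hQ
  read : Bits (x ∷ e) → leqB (Q ++ pos s (x ∷ e)) [] ≡ dom (length Q) (x ∷ e) (nth [])
  read (0∷ b) = leqB-queue (suc s) Q b [] z≤n up
  read (1∷ b) = trans (cong (λ z → leqB z []) (sym (LP.++-assoc Q (s ∷ []) _)))
    (trans (leqB-queue (suc s) (Q ++ s ∷ []) b [] z≤n (AllP.++⁺ up (ℕP.n≤1+n s ∷ [])))
      (cong (λ n → dom n e (nth [])) (trans (LP.length-++ Q) (ℕP.+-comm _ 1))))
leqB-queue s Q (0∷ b) (0∷ c) (s≤s le) hQ = leqB-queue (suc s) Q b c le (All.map ℕP.m≤n⇒m≤1+n hQ)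
leqB-queue s Q {_ ∷ e} {_ ∷ Y} (1∷ b) (0∷ c) (s≤s le) hQ = trans (cong (λ z → leqB z (pos (suc s) Y)) (sym (LP.++-assoc Q (s ∷ []) _)))
  (trans (leqB-queue (suc s) (Q ++ s ∷ []) b c le (AllP.++⁺ (All.map ℕP.m≤n⇒m≤1+n hQ) (ℕP.n≤1+n s ∷ [])))
    (cong (λ n → dom n e (nth Y)) (trans (LP.length-++ Q) (ℕP.+-comm _ 1))))
leqB-queue s [] {_ ∷ e} {_ ∷ Y} (0∷ b) (1∷ c) (s≤s le) hQ =
  leqB-< s (pos (suc s) e) (pos (suc s) Y) (All-pos (suc s) e)
leqB-queue s (q ∷ Q) (0∷ b) (1∷ c) (s≤s le) (q≤s ∷ hQ) rewrite ≤ᵇ-complete q≤s =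
  leqB-queue (suc s) Q b c le (All.map ℕP.m≤n⇒m≤1+n hQ)
leqB-queue s [] (1∷ b) (1∷ c) (s≤s le) hQ rewrite ≤ᵇ-complete (ℕP.≤-refl {s}) = leqB-queue (suc s) [] b c le []
leqB-queue s (q ∷ Q) {_ ∷ e} {_ ∷ Y} (1∷ b) (1∷ c) (s≤s le) (q≤s ∷ hQ) rewrite ≤ᵇ-complete q≤s =
  trans (cong (λ z → leqB z (pos (suc s) Y)) (sym (LP.++-assoc Q (s ∷ []) _)))
    (trans (leqB-queue (suc s) (Q ++ s ∷ []) b c le (AllP.++⁺ (All.map ℕP.m≤n⇒m≤1+n hQ) (ℕP.n≤1+n s ∷ [])))
      (cong (λ n → dom n e (nth Y)) (trans (LP.length-++ Q) (ℕP.+-comm _ 1))))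

leqB-pos : ∀ s {e Y} → Bits e → Bits Y → length Y ≤ length e → leqB (pos s e) (pos s Y) ≡ dom 0 e (nth Y)
leqB-pos s b c le = leqB-queue s [] b c le []

length-addE-≤ : ∀ a b n → length a ≤ n → length b ≤ n → length (addE a b) ≤ n
length-addE-≤ [] b n p q = q
length-addE-≤ (x ∷ a) [] n p q = p
length-addE-≤ (x ∷ a) (y ∷ b) (suc n) (s≤s p) (s≤s q) = s≤s (length-addE-≤ a b n p q)

length-unitE : ∀ n → length (unitE (suc n)) ≡ suc n
length-unitE zero = refl
length-unitE (suc n) = cong suc (length-unitE n)

length-xExp-≤ : ∀ L n → All (1 ≤_) L → All (_≤ n) L → length (xExp L) ≤ n
length-xExp-≤ [] n _ _ = z≤n
length-xExp-≤ (suc x ∷ L) n (_ ∷ h) (p ∷ q) =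
  length-addE-≤ (unitE (suc x)) (xExp L) n (subst (_≤ n) (sym (length-unitE x)) p) (length-xExp-≤ L n h q)

nth-beyond : ∀ e j → length e ≤ j → nth e j ≡ 0
nth-beyond [] j _ = refl
nth-beyond (x ∷ e) (suc j) (s≤s h) = nth-beyond e j h

leqB-length : ∀ a b → leqB a b ≡ true → length a ≡ length b
leqB-length [] [] h = refl
leqB-length (x ∷ a) (y ∷ b) h = cong suc (leqB-length a b (proj₂ (∧-elim {x ≤ᵇ y} h)))

next-elim : ∀ x y δ {k} → next x y δ k ≡ true → ∃ λ δ' → k δ' ≡ true
next-elim 0 0 δ h = δ , h
next-elim 1 1 δ h = δ , h
next-elim 1 0 δ h = suc δ , h
next-elim 0 1 (suc δ) h = δ , h

-- Once `y` has no ones left, a further one of `v` creates an excess that can never return to 0.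
-- This confines the members of A_m(w) to the range over which `A` enumerates.
dom-support : ∀ n δ v y → (∀ j → n ≤ j → y j ≡ 0) → dom δ v y ≡ true → ∀ j → n ≤ j → nth v j ≡ 0
dom-support n δ [] y hy h j n≤j = refl
dom-support (suc n) δ (x ∷ v) y hy h (suc j) (s≤s n≤j) with next-elim x (y 0) δ h
... | δ' , h' = dom-support n δ' v (y ∘ suc) (λ i p → hy (suc i) (s≤s p)) h' j n≤j
dom-support zero δ (x ∷ v) y hy h j _ rewrite hy 0 z≤n = go x h j
  where
  go : ∀ x → next x 0 δ (λ δ' → dom δ' v (y ∘ suc)) ≡ true → ∀ j → nth (x ∷ v) j ≡ 0
  go 0 h zero = refl
  go 0 h (suc j) = dom-support zero δ v (y ∘ suc) (λ i _ → hy (suc i) z≤n) h j z≤n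
  go 1 h j with trans (sym h) (trans (dom-cong (suc δ) v λ i → hy (suc i) z≤n) (dom-surplus δ v))
  ... | ()

upFrom : ℕ → ℕ → List ℕ
upFrom s zero = []
upFrom s (suc n) = s ∷ upFrom (suc s) n

range-upFrom : ∀ n → range n ≡ upFrom 1 n
range-upFrom n = trans (LP.map-applyUpTo (λ x → x) suc n) (go suc n 1 λ i → ℕP.+-comm 1 i)
  where
  go : ∀ (f : ℕ → ℕ) n s → (∀ i → f i ≡ i + s) → applyUpTo f n ≡ upFrom s n
  go f zero s h = refl
  go f (suc n) s h = cong₂ _∷_ (h 0) (go (f ∘ suc) n (suc s) λ i → trans (h (suc i)) (sym (ℕP.+-suc i s)))

choose-complete : ∀ n s {e} → Bits e → (∀ j → n ≤ j → nth e j ≡ 0) →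
  pos s e ∈ choose (length (pos s e)) (upFrom s n)
choose-complete n s [] h = here refl
choose-complete zero s (0∷ b) h = choose-complete zero (suc s) b (λ j _ → h (suc j) z≤n)
choose-complete zero s (1∷ b) h with h 0 z≤n
... | ()
choose-complete (suc n) s {_ ∷ e} (0∷ b) h with pos (suc s) e | choose-complete n (suc s) b (λ j p → h (suc j) (s≤s p))
... | [] | m = here refl
... | x ∷ L | m = ∈P.∈-++⁺ʳ (map (s ∷_) (choose (length L) (upFrom (suc s) n))) m
choose-complete (suc n) s (1∷ b) h =
  ∈P.∈-++⁺ˡ (∈P.∈-map⁺ (s ∷_) (choose-complete n (suc s) b (λ j p → h (suc j) (s≤s p))))

choose-sound : ∀ m n s {α} → α ∈ choose m (upFrom s n) → ∃ λ e → Bits e × length e ≡ n × α ≡ pos s e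
choose-sound zero n s (here refl) = replicate n 0 , zeros n , LP.length-replicate n , empty n s
  where
  zeros : ∀ n → Bits (replicate n 0)
  zeros zero = []
  zeros (suc n) = 0∷ zeros n
  empty : ∀ n s → [] ≡ pos s (replicate n 0)
  empty zero s = refl
  empty (suc n) s = empty n (suc s)
choose-sound (suc m) (suc n) s α∈ with ∈P.∈-++⁻ (map (s ∷_) (choose m (upFrom (suc s) n))) α∈
... | inj₁ p with ∈P.∈-map⁻ (s ∷_) p
...   | β , β∈ , refl with choose-sound m n (suc s) β∈
...     | e , b , l , refl = 1 ∷ e , 1∷ b , cong suc l , refl
choose-sound (suc m) (suc n) s α∈ | inj₂ p with choose-sound (suc m) n (suc s) p
... | e , b , l , refl = 0 ∷ e , 0∷ b , cong suc l , refl

choose-unique : ∀ m n s → Unique (choose m (upFrom s n))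
choose-unique zero n s = [] ∷ []
choose-unique (suc m) zero s = []
choose-unique (suc m) (suc n) s = UP.++⁺ (UP.map⁺ LP.∷-injectiveʳ (choose-unique m n (suc s)))
  (choose-unique (suc m) n (suc s)) disjoint
  where
  disjoint : ∀ {α} → α ∈ map (s ∷_) (choose m (upFrom (suc s) n)) × α ∈ choose (suc m) (upFrom (suc s) n) → ⊥
  disjoint (p , q) with ∈P.∈-map⁻ (s ∷_) p | choose-sound (suc m) n (suc s) q
  ... | β , _ , eq | e , _ , _ , eq' with subst (All (suc s ≤_)) (trans (sym eq') eq) (All-pos (suc s) e)
  ...   | s<s ∷ _ = ℕP.<-irrefl refl s<s

-- Filtered lists and sums over them

filterB-∈⁻ : ∀ {X : Set} (p : X → Bool) L {x} → x ∈ filterB p L → x ∈ L × p x ≡ true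
filterB-∈⁻ p (y ∷ L) x∈ with p y in eq
filterB-∈⁻ p (y ∷ L) (here refl) | true = here refl , eq
filterB-∈⁻ p (y ∷ L) (there x∈) | true = there (proj₁ (filterB-∈⁻ p L x∈)) , proj₂ (filterB-∈⁻ p L x∈)
... | false = there (proj₁ (filterB-∈⁻ p L x∈)) , proj₂ (filterB-∈⁻ p L x∈)

filterB-∈⁺ : ∀ {X : Set} (p : X → Bool) L {x} → x ∈ L → p x ≡ true → x ∈ filterB p L
filterB-∈⁺ p (y ∷ L) (here refl) h rewrite h = here refl
filterB-∈⁺ p (y ∷ L) (there x∈) h with p y
... | true = there (filterB-∈⁺ p L x∈ h)
... | false = filterB-∈⁺ p L x∈ h

filterB-unique : ∀ {X : Set} (p : X → Bool) {L} → Unique L → Unique (filterB p L)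
filterB-unique p [] = []
filterB-unique p {y ∷ L} (h ∷ u) with p y
... | true = All.tabulate (λ x∈ → All.lookup h (proj₁ (filterB-∈⁻ p L x∈))) ∷ filterB-unique p u
... | false = filterB-unique p u

listEqB-sound : ∀ a b → listEqB a b ≡ true → a ≡ b
listEqB-sound [] [] h = refl
listEqB-sound (x ∷ a) (y ∷ b) h =
  cong₂ _∷_ (≡ᵇ-sound x y (proj₁ (∧-elim h))) (listEqB-sound a b (proj₂ (∧-elim {x ≡ᵇ y} h)))

listEqB-refl : ∀ a → listEqB a a ≡ true
listEqB-refl [] = refl
listEqB-refl (x ∷ a) rewrite ≡ᵇ-refl x = listEqB-refl a

memLB-sound : ∀ α L → memLB α L ≡ true → α ∈ L
memLB-sound α (β ∷ L) h with listEqB α β in eq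
... | true = here (listEqB-sound α β eq)
... | false = there (memLB-sound α L h)

memLB-complete : ∀ {α L} → α ∈ L → memLB α L ≡ true
memLB-complete {α} (here refl) rewrite listEqB-refl α = refl
memLB-complete {α} {β ∷ L} (there h) rewrite memLB-complete h = BP.∨-zeroʳ (listEqB α β)

epsL-absent : ∀ {X : Set} (φ : X → Exp) m e L → (∀ {x} → x ∈ L → eqE (φ x) e ≡ false) →
  epsL (map (λ x → m , φ x) L) m e ≡ + 0
epsL-absent φ m e [] h = refl
epsL-absent φ m e (x ∷ L) h rewrite ≡ᵇ-refl m | h (here refl) =
  trans (ℤP.+-identityˡ _) (epsL-absent φ m e L (h ∘ there))

epsL-once : ∀ {X : Set} (φ : X → Exp) m e {L} x₀ → Unique L → x₀ ∈ L → eqE (φ x₀) e ≡ true →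
  (∀ {x} → x ∈ L → eqE (φ x) e ≡ true → x ≡ x₀) → epsL (map (λ x → m , φ x) L) m e ≡ + 1
epsL-once φ m e {x ∷ L} x₀ (h ∷ u) (here refl) hit only rewrite ≡ᵇ-refl m | hit =
  cong (ℤ._+_ (+ 1)) (epsL-absent φ m e L λ {x} x∈ → miss x x∈)
  where
  miss : ∀ y → y ∈ L → eqE (φ y) e ≡ false
  miss y y∈ with eqE (φ y) e in eq
  ... | false = refl
  ... | true = ⊥-elim (All.lookup h y∈ (sym (only (there y∈) eq)))
epsL-once φ m e {x ∷ L} x₀ (h ∷ u) (there x₀∈) hit only with eqE (φ x) e in eq
... | true = ⊥-elim (All.lookup h x₀∈ (only (here refl) eq))
... | false rewrite ≡ᵇ-refl m = trans (ℤP.+-identityˡ _) (epsL-once φ m e x₀ u x₀∈ hit (only ∘ there))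

-- The sets A_m(w) and A_{m,i}(w)

data SwView (i : ℕ) : ℕ → ℕ → Set where
  lower : SwView i i (suc i)
  upper : SwView i (suc i) i
  other : ∀ {j} → ¬ j ≡ i → ¬ j ≡ suc i → SwView i j j

swView : ∀ i j → SwView i j (sw i j)
swView i j with j ≡ᵇ i in p
... | true with ≡ᵇ-sound j i p
...   | refl = lower
swView i j | false with j ≡ᵇ suc i in q
... | true with ≡ᵇ-sound j (suc i) q
...   | refl = upper
swView i j | false | false = other (λ { refl → true≢false (trans (sym (≡ᵇ-refl i)) p) })
  (λ { refl → true≢false (trans (sym (≡ᵇ-refl i)) q) })

sw-lower : ∀ i → sw i i ≡ suc i
sw-lower i rewrite ≡ᵇ-refl i = refl

sw-upper : ∀ i → sw i (suc i) ≡ i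
sw-upper i rewrite ≡ᵇ-false (suc i) i (λ ()) | ≡ᵇ-refl i = refl

sw-other : ∀ i j → ¬ j ≡ i → ¬ j ≡ suc i → sw i j ≡ j
sw-other i j p q rewrite ≡ᵇ-false j i p | ≡ᵇ-false j (suc i) q = refl

sw-involutive : ∀ i j → sw i (sw i j) ≡ j
sw-involutive i j with sw i j | swView i j
... | _ | lower = sw-upper i
... | _ | upper = sw-lower i
... | _ | other p q = sw-other i j p q

sw-injective : ∀ i {j j'} → sw i j ≡ sw i j' → j ≡ j'
sw-injective i {j} {j'} h = trans (sym (sw-involutive i j)) (trans (cong (sw i) h) (sw-involutive i j'))

sw-≥1 : ∀ i j → 1 ≤ i → 1 ≤ j → 1 ≤ sw i j
sw-≥1 i j p q with sw i j | swView i j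
... | _ | lower = s≤s z≤n
... | _ | upper = p
... | _ | other _ _ = q

sw-≤ : ∀ i j n → i < n → j ≤ n → sw i j ≤ n
sw-≤ i j n p q with sw i j | swView i j
... | _ | lower = p
... | _ | upper = ℕP.<⇒≤ p
... | _ | other _ _ = q

sw-reverses : ∀ i a b → a < b → sw i b < sw i a → a ≡ i × b ≡ suc i
sw-reverses i a b a<b h with sw i a | swView i a | sw i b | swView i b
... | _ | lower | _ | lower = ⊥-elim (ℕP.<-irrefl refl a<b)
... | _ | lower | _ | upper = refl , refl
... | _ | lower | _ | other _ _ = ⊥-elim (ℕP.<⇒≱ a<b (ℕP.≤-pred h))
... | _ | upper | _ | lower = ⊥-elim (ℕP.<⇒≱ a<b (ℕP.n≤1+n i))
... | _ | upper | _ | upper = ⊥-elim (ℕP.<-irrefl refl a<b)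
... | _ | upper | _ | other _ _ = ⊥-elim (ℕP.<⇒≱ (ℕP.<-trans a<b h) (ℕP.n≤1+n i))
... | _ | other _ _ | _ | lower = ⊥-elim (ℕP.<⇒≱ (ℕP.<-trans a<b (ℕP.n<1+n i)) (ℕP.<⇒≤ h))
... | _ | other _ _ | _ | upper = ⊥-elim (ℕP.<⇒≱ h (ℕP.≤-pred a<b))
... | _ | other _ _ | _ | other _ _ = ⊥-elim (ℕP.<⇒≱ a<b (ℕP.<⇒≤ h))

perm⁻¹ : List ℕ → ℕ → ℕ
perm⁻¹ [] x = x
perm⁻¹ (i ∷ ws) x = perm⁻¹ ws (sw i x)

perm-perm⁻¹ : ∀ ws x → perm ws (perm⁻¹ ws x) ≡ x
perm-perm⁻¹ [] x = refl
perm-perm⁻¹ (i ∷ ws) x = trans (cong (sw i) (perm-perm⁻¹ ws (sw i x))) (sw-involutive i x)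

perm-injective : ∀ ws {x y} → perm ws x ≡ perm ws y → x ≡ y
perm-injective [] h = h
perm-injective (i ∷ ws) h = perm-injective ws (sw-injective i h)

perm-≥1 : ∀ ws x → All (1 ≤_) ws → 1 ≤ x → 1 ≤ perm ws x
perm-≥1 [] x _ p = p
perm-≥1 (i ∷ ws) x (q ∷ qs) p = sw-≥1 i _ q (perm-≥1 ws x qs p)

perm⁻¹-≥1 : ∀ ws x → All (1 ≤_) ws → 1 ≤ x → 1 ≤ perm⁻¹ ws x
perm⁻¹-≥1 [] x _ p = p
perm⁻¹-≥1 (i ∷ ws) x (q ∷ qs) p = perm⁻¹-≥1 ws (sw i x) qs (sw-≥1 i x q p)

perm-≤ : ∀ ws x n → All (_< n) ws → x ≤ n → perm ws x ≤ n
perm-≤ [] x n _ p = p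
perm-≤ (i ∷ ws) x n (q ∷ qs) p = sw-≤ i _ n q (perm-≤ ws x n qs p)

perm⁻¹-≤ : ∀ ws x n → All (_< n) ws → x ≤ n → perm⁻¹ ws x ≤ n
perm⁻¹-≤ [] x n _ p = p
perm⁻¹-≤ (i ∷ ws) x n (q ∷ qs) p = perm⁻¹-≤ ws (sw i x) n qs (sw-≤ i x n q p)

inv≤ : ∀ {B f g} → (∀ p q → (p <ᵇ q) ∧ (f q <ᵇ f p) ≡ true → (p <ᵇ q) ∧ (g q <ᵇ g p) ≡ true) → len B f ≤ len B g
inv≤ {B} {f} {g} h = outer (range B)
  where
  mono : ∀ a b → (a ≡ true → b ≡ true) → (if a then 1 else 0) ≤ (if b then 1 else 0)
  mono true b k rewrite k refl = ℕP.≤-refl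
  mono false b k = z≤n
  inner : ∀ p qs → countInv f p qs ≤ countInv g p qs
  inner p [] = z≤n
  inner p (q ∷ qs) = ℕP.+-mono-≤ (mono _ _ (h p q)) (inner p qs)
  outer : ∀ ps → foldr (λ p acc → countInv f p (range B) + acc) 0 ps ≤ foldr (λ p acc → countInv g p (range B) + acc) 0 ps
  outer [] = z≤n
  outer (p ∷ ps) = ℕP.+-mono-≤ (inner p (range B)) (outer ps)

<ᵇ-sound : ∀ m n → (m <ᵇ n) ≡ true → m < n
<ᵇ-sound m n eq = ℕP.<ᵇ⇒< m n (subst T (sym eq) _)

<ᵇ-complete : ∀ {m n} → m < n → (m <ᵇ n) ≡ true
<ᵇ-complete {m} {n} m<n with m <ᵇ n | ℕP.<⇒<ᵇ m<n
... | true | _ = refl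

-- If i + 1 stood before i, every inversion of s_i w would be one of w, because i < i + 1 is the
-- only pair of values whose order s_i reverses; then the length could not grow.
longer⇒ordered : ∀ B ws i → len B (perm ws) < len B (λ j → sw i (perm ws j)) →
  ∀ p q → p < q → perm ws p ≡ suc i → perm ws q ≡ i → ⊥
longer⇒ordered B ws i up p₀ q₀ p₀<q₀ wp wq = ℕP.<⇒≱ up (inv≤ {B} still)
  where
  w = perm ws
  still : ∀ p q → (p <ᵇ q) ∧ (sw i (w q) <ᵇ sw i (w p)) ≡ true → (p <ᵇ q) ∧ (w q <ᵇ w p) ≡ true
  still p q h with ∧-elim {p <ᵇ q} h
  ... | a , b = cong₂ _∧_ a (<ᵇ-complete below)
    where
    p<q : p < q
    p<q = <ᵇ-sound p q a
    below : w q < w p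
    below with ℕP.<-cmp (w p) (w q)
    ... | tri> _ _ c = c
    ... | tri≈ _ c _ = ⊥-elim (ℕP.<-irrefl (perm-injective ws c) p<q)
    ... | tri< c _ _ with sw-reverses i (w p) (w q) c (<ᵇ-sound _ _ b)
    ...   | x , y = ⊥-elim (ℕP.<-asym p<q (subst₂ _<_ (perm-injective ws (trans wp (sym y)))
              (perm-injective ws (trans wq (sym x))) p₀<q₀))

upFrom-bounds : ∀ s n → All (λ x → s ≤ x × x < s + n) (upFrom s n)
upFrom-bounds s zero = []
upFrom-bounds s (suc n) = (ℕP.≤-refl , ℕP.m<m+n s (s≤s z≤n)) ∷
  All.map (λ {x} (a , b) → ℕP.<⇒≤ a , subst (x <_) (sym (ℕP.+-suc s n)) b) (upFrom-bounds (suc s) n)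

∈-upFrom : ∀ s n x → s ≤ x → x < s + n → x ∈ upFrom s n
∈-upFrom s zero x a b = ⊥-elim (ℕP.<⇒≱ b (subst (_≤ x) (sym (ℕP.+-identityʳ s)) a))
∈-upFrom s (suc n) x a b with s ℕP.≟ x
... | yes refl = here refl
... | no s≢x = there (∈-upFrom (suc s) n x (ℕP.≤∧≢⇒< a s≢x) (subst (x <_) (ℕP.+-suc s n) b))

range-bounds : ∀ m → All (λ x → 1 ≤ x × x ≤ m) (range m)
range-bounds m rewrite range-upFrom m = All.map (λ (a , b) → a , ℕP.≤-pred b) (upFrom-bounds 1 m)

∈-range : ∀ m x → 1 ≤ x → x ≤ m → x ∈ range m
∈-range m x a b rewrite range-upFrom m = ∈-upFrom 1 m x a (s≤s b)

range-unique : ∀ m → Unique (range m)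
range-unique m = UP.map⁺ ℕP.suc-injective (UP.upTo⁺ m)

occ-unique : ∀ x {L} → Unique L → occ x L ≤ 1
occ-unique x [] = z≤n
occ-unique x {y ∷ L} (h ∷ u) with y ≡ᵇ x in eq
... | false = occ-unique x u
... | true with ≡ᵇ-sound y x eq
...   | refl = ℕP.≤-reflexive (cong suc (occ-≢ y L (All.map (λ y≢z z≡y → y≢z (sym z≡y)) h)))

occ-∈ : ∀ {x L} → x ∈ L → 1 ≤ occ x L
occ-∈ {x} (here refl) rewrite ≡ᵇ-refl x = s≤s z≤n
occ-∈ {x} {y ∷ L} (there h) = ℕP.≤-trans (occ-∈ h) (ℕP.m≤n+m _ _)

∈-occ : ∀ x L → 1 ≤ occ x L → x ∈ L
∈-occ x (y ∷ L) h with y ≡ᵇ x in eq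
... | true = here (sym (≡ᵇ-sound y x eq))
... | false = there (∈-occ x L h)

occ-map-sw : ∀ i x L → occ x (map (sw i) L) ≡ occ (sw i x) L
occ-map-sw i x [] = refl
occ-map-sw i x (y ∷ L) = cong₂ _+_ (cong (λ b → if b then 1 else 0) (bool-ext
    (λ h → subst (λ z → (y ≡ᵇ z) ≡ true) (trans (sym (sw-involutive i y)) (cong (sw i) (≡ᵇ-sound (sw i y) x h))) (≡ᵇ-refl y))
    (λ h → subst (λ z → (sw i z ≡ᵇ x) ≡ true) (sym (≡ᵇ-sound y (sw i x) h))
      (subst (λ z → (z ≡ᵇ x) ≡ true) (sym (sw-involutive i x)) (≡ᵇ-refl x))))) (occ-map-sw i x L)

values : List ℕ → ℕ → List ℕ
values ws m = map (perm ws) (range m)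

-- The indicator of {w(1), ..., w(m)}, with index j standing for the value j + 1.
Y : List ℕ → ℕ → ℕ → ℕ
Y ws m = nth (xExp (values ws m))

sα-pos : ∀ i α → 1 ≤ i → All (1 ≤_) α → sα i α ≡ pos 1 (xExp (map (sw i) α))
sα-pos i α i≥1 h = sortL-pos (map (sw i) α) (AllP.map⁺ (All.map (sw-≥1 i _ i≥1) h))

nth-sα : ∀ n α → All (1 ≤_) α → ∀ j → nth (xExp (sα (suc n) α)) j ≡ nth (xExp α) (sw n j)
nth-sα n α h j = begin
  nth (xExp (sα (suc n) α)) j ≡⟨ cong (λ z → nth (xExp z) j) (sα-pos (suc n) α (s≤s z≤n) h) ⟩
  nth (xExp (pos 1 X)) j ≡⟨ nth-xExp (pos 1 X) (All-pos 1 X) j ⟩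
  occ (suc j) (pos 1 X) ≡⟨ occ-pos₁ X j ⟩
  nth X j ≡⟨ nth-xExp _ (AllP.map⁺ (All.map (sw-≥1 (suc n) _ (s≤s z≤n)) h)) j ⟩
  occ (suc j) (map (sw (suc n)) α) ≡⟨ occ-map-sw (suc n) (suc j) α ⟩
  occ (sw (suc n) (suc j)) α ≡⟨ cong (λ z → occ z α) (sw-suc n j) ⟩
  occ (suc (sw n j)) α ≡⟨ nth-xExp α h (sw n j) ⟨
  nth (xExp α) (sw n j) ∎
  where
  open ≡-Reasoning
  X = xExp (map (sw (suc n)) α)

nth-xExp-pos : ∀ e j → nth (xExp (pos 1 e)) j ≡ nth e j
nth-xExp-pos e j = trans (nth-xExp (pos 1 e) (All-pos 1 e) j) (occ-pos₁ e j)

nth-swap : ∀ u p q v j → nth (u ++ q ∷ p ∷ v) j ≡ nth (u ++ p ∷ q ∷ v) (sw (length u) j)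
nth-swap [] p q v 0 = refl
nth-swap [] p q v 1 = refl
nth-swap [] p q v (suc (suc j)) = refl
nth-swap (x ∷ u) p q v zero = refl
nth-swap (x ∷ u) p q v (suc j) rewrite sw-suc (length u) j = nth-swap u p q v j

split-at : ∀ n (e : Exp) → suc n < length e → ∃ λ u → ∃ λ p → ∃ λ q → ∃ λ v → e ≡ u ++ p ∷ q ∷ v × length u ≡ n
split-at zero (p ∷ q ∷ v) h = [] , p , q , v , refl , refl
split-at zero (p ∷ []) (s≤s ())
split-at (suc n) (x ∷ e) (s≤s h) with split-at n e h
... | u , p , q , v , refl , refl = x ∷ u , p , q , v , refl , refl

-- Moving a one to an earlier place only increases prefix weights: A_m(w) is closed under replacing
-- i + 1 by i.
dom-raise : ∀ δ u v y → dom δ (u ++ 0 ∷ 1 ∷ v) y ≡ true → dom δ (u ++ 1 ∷ 0 ∷ v) y ≡ true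
dom-raise δ [] v y h = go δ (y 0) (y 1) h
  where
  K = λ δ → dom δ v (y ∘ suc ∘ suc)
  go : ∀ δ a b → (next 0 a δ λ δ → next 1 b δ K) ≡ true → (next 1 a δ λ δ → next 0 b δ K) ≡ true
  go δ 0 0 h = h
  go δ 0 1 h = h
  go (suc δ) 1 0 h = h
  go (suc δ) 1 1 h = h
dom-raise δ (x ∷ u) v y h = go x (y 0) δ h
  where
  IH : ∀ δ → dom δ (u ++ 0 ∷ 1 ∷ v) (y ∘ suc) ≡ true → dom δ (u ++ 1 ∷ 0 ∷ v) (y ∘ suc) ≡ true
  IH δ = dom-raise δ u v (y ∘ suc)
  go : ∀ x r δ → (next x r δ λ δ → dom δ (u ++ 0 ∷ 1 ∷ v) (y ∘ suc)) ≡ true →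
    (next x r δ λ δ → dom δ (u ++ 1 ∷ 0 ∷ v) (y ∘ suc)) ≡ true
  go 0 0 δ h = IH δ h
  go 1 1 δ h = IH δ h
  go 1 0 δ h = IH (suc δ) h
  go 0 1 (suc δ) h = IH δ h

bits-++⁻ : ∀ u {v} → Bits (u ++ v) → Bits u × Bits v
bits-++⁻ [] b = [] , b
bits-++⁻ (_ ∷ u) (0∷ b) = 0∷ proj₁ (bits-++⁻ u b) , proj₂ (bits-++⁻ u b)
bits-++⁻ (_ ∷ u) (1∷ b) = 1∷ proj₁ (bits-++⁻ u b) , proj₂ (bits-++⁻ u b)

bits-++⁺ : ∀ {u v} → Bits u → Bits v → Bits (u ++ v)
bits-++⁺ [] c = c
bits-++⁺ (0∷ b) c = 0∷ bits-++⁺ b c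
bits-++⁺ (1∷ b) c = 1∷ bits-++⁺ b c

bits? : ∀ e → Bits e ⊎ ∃ λ u → ∃ λ x → ∃ λ v → e ≡ u ++ suc (suc x) ∷ v
bits? [] = inj₁ []
bits? (x ∷ e) with bits? e
... | inj₂ (u , z , v , refl) = inj₂ (x ∷ u , z , v , refl)
bits? (0 ∷ e) | inj₁ b = inj₁ (0∷ b)
bits? (1 ∷ e) | inj₁ b = inj₁ (1∷ b)
bits? (suc (suc x) ∷ e) | inj₁ b = inj₂ ([] , x , e , refl)

newL : ℕ → List ℕ → ℕ → ℕ → List (ℕ × Exp)
newL B ws i m = map (λ α → m , xExp (sα i α)) (Ami B (perm ws) m i)

module _ {B : ℕ} {ws : List ℕ} (ws≥1 : All (1 ≤_) ws) (ws<B : All (_< B) ws) where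

  values-≥1 : ∀ m → All (1 ≤_) (values ws m)
  values-≥1 m = AllP.map⁺ (All.map (λ {x} (a , _) → perm-≥1 ws x ws≥1 a) (range-bounds m))

  values-≤ : ∀ m → All (_≤ m + B) (values ws m)
  values-≤ m = AllP.map⁺ (All.map (λ {x} (_ , b) → perm-≤ ws x (m + B)
    (All.map (λ {i} h → ℕP.<-≤-trans h (ℕP.m≤n+m B m)) ws<B) (ℕP.≤-trans b (ℕP.m≤m+n m B))) (range-bounds m))

  Y-occ : ∀ m j → Y ws m j ≡ occ (suc j) (values ws m)
  Y-occ m j = nth-xExp (values ws m) (values-≥1 m) j

  Y-≤1 : ∀ m j → Y ws m j ≤ 1
  Y-≤1 m j = subst (_≤ 1) (sym (Y-occ m j)) (occ-unique (suc j) (UP.map⁺ (perm-injective ws) (range-unique m)))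

  Y-bits : ∀ m → Bits (xExp (values ws m))
  Y-bits m = nth-bits (xExp (values ws m)) (Y-≤1 m)

  Y-length : ∀ m → length (xExp (values ws m)) ≤ m + B
  Y-length m = length-xExp-≤ (values ws m) (m + B) (values-≥1 m) (values-≤ m)

  leqB-wup : ∀ m {e} → Bits e → m + B ≤ length e → leqB (pos 1 e) (wup (perm ws) m) ≡ dom 0 e (Y ws m)
  leqB-wup m {e} b h = trans (cong (leqB (pos 1 e)) (sortL-pos (values ws m) (values-≥1 m)))
    (leqB-pos 1 b (Y-bits m) (ℕP.≤-trans (Y-length m) h))

  wup-length : ∀ m → length (wup (perm ws) m) ≡ m
  wup-length m = trans (sortL-length (values ws m)) (trans (LP.length-map (perm ws) (range m))
    (trans (LP.length-map suc (upTo m)) (LP.length-upTo m)))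
    where
    insertL-length : ∀ x L → length (insertL x L) ≡ suc (length L)
    insertL-length x [] = refl
    insertL-length x (y ∷ L) with x ≤ᵇ y
    ... | true = refl
    ... | false = cong suc (insertL-length x L)
    sortL-length : ∀ L → length (sortL L) ≡ length L
    sortL-length [] = refl
    sortL-length (x ∷ L) = trans (insertL-length x (sortL L)) (cong suc (sortL-length L))

  A-complete : ∀ m {e} → Bits e → m + B ≤ length e → dom 0 e (Y ws m) ≡ true → pos 1 e ∈ A B (perm ws) m
  A-complete m {e} b h d = filterB-∈⁺ _ (choose m (range (m + B)))
    (subst₂ (λ x y → pos 1 e ∈ choose x y) (trans (leqB-length (pos 1 e) (wup (perm ws) m) le) (wup-length m)) (sym (range-upFrom (m + B)))
      (choose-complete (m + B) 1 b (dom-support (m + B) 0 e (Y ws m) (λ j p → nth-beyond (xExp (values ws m)) j (ℕP.≤-trans (Y-length m) p)) d)))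
    le
    where
    le : leqB (pos 1 e) (wup (perm ws) m) ≡ true
    le = trans (leqB-wup m b h) d

  A-bits : ∀ m {α} → α ∈ A B (perm ws) m → (∃ λ x → Bits x × α ≡ pos 1 x) × leqB α (wup (perm ws) m) ≡ true
  A-bits m {α} α∈ with filterB-∈⁻ _ (choose m (range (m + B))) α∈
  ... | c , le with choose-sound m (m + B) 1 (subst (λ z → α ∈ choose m z) (range-upFrom (m + B)) c)
  ...   | x , b , _ , eq = (x , b , eq) , le

  memLB-A : ∀ m {e} → Bits e → m + B ≤ length e → memLB (pos 1 e) (A B (perm ws) m) ≡ dom 0 e (Y ws m)
  memLB-A m {e} b h = bool-ext
    (λ p → trans (sym (leqB-wup m b h)) (proj₂ (A-bits m (memLB-sound (pos 1 e) _ p))))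
    (λ d → memLB-complete (A-complete m b h d))

  module _ {n : ℕ} (i<B : suc n < B) (up : len B (perm ws) < len B (λ j → sw (suc n) (perm ws j))) where

    Y-swap : ∀ m j → Y (suc n ∷ ws) m j ≡ Y ws m (sw n j)
    Y-swap m j = begin
      nth (xExp (values (suc n ∷ ws) m)) j
        ≡⟨ cong (λ z → nth (xExp z) j) (LP.map-∘ (range m)) ⟩
      nth (xExp (map (sw (suc n)) (values ws m))) j
        ≡⟨ nth-xExp _ (AllP.map⁺ (All.map (sw-≥1 (suc n) _ (s≤s z≤n)) (values-≥1 m))) j ⟩
      occ (suc j) (map (sw (suc n)) (values ws m)) ≡⟨ occ-map-sw (suc n) (suc j) (values ws m) ⟩
      occ (sw (suc n) (suc j)) (values ws m) ≡⟨ cong (λ z → occ z (values ws m)) (sw-suc n j) ⟩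
      occ (suc (sw n j)) (values ws m) ≡⟨ Y-occ m (sw n j) ⟨
      Y ws m (sw n j) ∎
      where open ≡-Reasoning

    Y-ordered : ∀ m → Ordered (Y ws m n) (Y ws m (suc n))
    Y-ordered m = go (Y-≤1 m n) (Y-≤1 m (suc n)) exclude
      where
      -- If i + 1 = w(p) with p ≤ m, then i occurs before p, since otherwise s_i would not lengthen
      -- w.
      exclude : 1 ≤ Y ws m (suc n) → 1 ≤ Y ws m n
      exclude h with ∈P.∈-map⁻ (perm ws) (∈-occ _ (values ws m) (subst (1 ≤_) (Y-occ m (suc n)) h))
      ... | p , p∈ , eq with ℕP.<-cmp p (perm⁻¹ ws (suc n))
      ...   | tri< p<q _ _ = ⊥-elim (longer⇒ordered B ws (suc n) up p _ p<q (sym eq) (perm-perm⁻¹ ws (suc n)))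
      ...   | tri≈ _ refl _ = ⊥-elim (ℕP.m≢1+m+n (suc n) (trans (sym (perm-perm⁻¹ ws (suc n))) (trans (sym eq) (cong suc (sym (ℕP.+-identityʳ (suc n)))))))
      ...   | tri> _ _ q<p = subst (1 ≤_) (sym (Y-occ m n)) (occ-∈ (subst (_∈ values ws m) (perm-perm⁻¹ ws (suc n))
                (∈P.∈-map⁺ (perm ws) (∈-range m _ (perm⁻¹-≥1 ws _ ws≥1 (s≤s z≤n))
                  (ℕP.≤-trans (ℕP.<⇒≤ q<p) (proj₂ (All.lookup (range-bounds m) p∈)))))))
      go : ∀ {r s} → r ≤ 1 → s ≤ 1 → (1 ≤ s → 1 ≤ r) → Ordered r s
      go {0} {0} _ _ _ = inj₁ (refl , refl)
      go {1} {1} _ _ _ = inj₂ (inj₁ (refl , refl))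
      go {1} {0} _ _ _ = inj₂ (inj₂ (refl , refl))
      go {0} {1} _ _ h with h ℕP.≤-refl
      ... | ()
      go {suc (suc _)} (s≤s ()) _ _
      go {0} {suc (suc _)} _ (s≤s ()) _
      go {1} {suc (suc _)} _ (s≤s ()) _

    Y-lift : ∀ m → Lift n (𝔻 (Y ws m)) (𝔻 (Y (suc n ∷ ws) m))
    Y-lift m = dom-Lift n (Y-swap m) (Y-ordered m) 0

    -- From m = B on, both i and i + 1 lie in {w(1), ..., w(m)}, so the swap has no effect; this is
    -- why the product `N` may stop at m = B.
    Y-stable : ∀ m → B ≤ m → ∀ j → Y (suc n ∷ ws) m j ≡ Y ws m j
    Y-stable m B≤m j = trans (Y-swap m j) (go (swView n j))
      where
      full : ∀ x → suc x ≤ B → Y ws m x ≡ 1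
      full x h = ℕP.≤-antisym (Y-≤1 m x) (subst (1 ≤_) (sym (Y-occ m x)) (occ-∈ (subst (_∈ values ws m) (perm-perm⁻¹ ws (suc x))
        (∈P.∈-map⁺ (perm ws) (∈-range m _ (perm⁻¹-≥1 ws _ ws≥1 (s≤s z≤n))
          (ℕP.≤-trans (perm⁻¹-≤ ws (suc x) B ws<B h) B≤m))))))
      go : ∀ {j'} → SwView n j j' → Y ws m j' ≡ Y ws m j
      go lower = trans (full (suc n) i<B) (sym (full n (ℕP.<⇒≤ i<B)))
      go upper = trans (full n (ℕP.<⇒≤ i<B)) (sym (full (suc n) i<B))
      go (other _ _) = refl

    Ami-member : ∀ m {α} → α ∈ Ami B (perm ws) m (suc n) →
      (∃ λ x → Bits x × α ≡ pos 1 x) × (∀ j → nth (xExp (sα (suc n) α)) j ≡ nth (xExp α) (sw n j))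
    Ami-member m {α} α∈ with A-bits m (proj₁ (filterB-∈⁻ _ (A B (perm ws) m) α∈))
    ... | (x , b , refl) , _ = (x , b , refl) , nth-sα n (pos 1 x) (All-pos 1 x)

    Ami-bits : ∀ m {α} → α ∈ Ami B (perm ws) m (suc n) → Bits (xExp (sα (suc n) α))
    Ami-bits m α∈ with Ami-member m α∈
    ... | (x , b , refl) , h = nth-bits _ λ j →
      subst (_≤ 1) (sym (trans (h j) (nth-xExp-pos x (sw n j)))) (bits-nth b (sw n j))

    -- The sets s_i α with α in A_{m,i}(w) are precisely the members of A_m(s_i w) outside A_m(w),
    -- and each arises once because s_i is an involution. Multiplicities above 1 in `e` make every
    -- term vanish.
    newL-coeff : ∀ m e → m + B ≤ length e →
      epsL (newL B ws (suc n) m) m e ≡ 𝔻 (Y (suc n ∷ ws) m) e - 𝔻 (Y ws m) e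
    newL-coeff m e long with bits? e
    ... | inj₂ (u , x , v , refl) = trans (epsL-absent _ m e _ no-hit)
        (sym (cong₂ _-_ (cong ⟦_⟧ (dom-nonbit 0 u x v (Y (suc n ∷ ws) m))) (cong ⟦_⟧ (dom-nonbit 0 u x v (Y ws m)))))
      where
      no-hit : ∀ {α} → α ∈ Ami B (perm ws) m (suc n) → eqE (xExp (sα (suc n) α)) e ≡ false
      no-hit {α} α∈ with eqE (xExp (sα (suc n) α)) e in eq
      ... | false = refl
      ... | true with subst (_≤ 1) (trans (eqE→nth (xExp (sα (suc n) α)) e eq (length u + 0)) (nth-++ u (suc (suc x) ∷ v) 0)) (bits-nth (Ami-bits m α∈) (length u + 0))
      ...   | s≤s ()
    ... | inj₁ be with split-at n e (ℕP.<-≤-trans i<B (ℕP.≤-trans (ℕP.m≤n+m B m) long))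
    ...   | u , p , q , v , refl , refl with bits-++⁻ u be
    ...     | bu , bpqv = trans count (sym (difference bpqv))
      where
      e' = u ++ p ∷ q ∷ v
      -- With the entries at i and i + 1 exchanged, `α₀` is the sole α for which s_i α can have
      -- exponent `e'`.
      ê = u ++ q ∷ p ∷ v
      α₀ = pos 1 ê
      y = Y ws m
      bê : Bits ê
      bê = nth-bits ê λ j → subst (_≤ 1) (sym (nth-swap u p q v j)) (bits-nth be (sw n j))
      longê : m + B ≤ length ê
      longê = subst (m + B ≤_) (trans (LP.length-++ u) (sym (LP.length-++ u))) long
      b₁ = dom 0 ê y
      b₂ = dom 0 e' y
      X = xExp (map (sw (suc n)) α₀)
      sα₀ : sα (suc n) α₀ ≡ pos 1 e'
      sα₀ = trans (sα-pos (suc n) α₀ (s≤s z≤n) (All-pos 1 ê)) (pos-ext 1 X e' λ j →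
        trans (sym (trans (cong (λ z → nth (xExp z) j) (sα-pos (suc n) α₀ (s≤s z≤n) (All-pos 1 ê))) (nth-xExp-pos X j)))
          (trans (nth-sα n α₀ (All-pos 1 ê) j) (trans (nth-xExp-pos ê (sw n j))
            (trans (nth-swap u p q v (sw n j)) (cong (nth e') (sw-involutive n j))))))
      hit : eqE (xExp (sα (suc n) α₀)) e' ≡ true
      hit = nth→eqE (xExp (sα (suc n) α₀)) e' λ j → trans (cong (λ z → nth (xExp z) j) sα₀) (nth-xExp-pos e' j)
      only : ∀ {α} → α ∈ Ami B (perm ws) m (suc n) → eqE (xExp (sα (suc n) α)) e' ≡ true → α ≡ α₀
      only {α} α∈ h with Ami-member m α∈
      ... | (x , _ , refl) , s = pos-ext 1 x ê λ j → trans (cong (nth x) (sym (sw-involutive n j)))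
            (trans (sym (nth-xExp-pos x (sw n (sw n j)))) (trans (sym (s (sw n j)))
              (trans (eqE→nth (xExp (sα (suc n) (pos 1 x))) e' h (sw n j)) (sym (nth-swap u p q v j)))))
      member : b₁ ∧ not b₂ ≡ true → α₀ ∈ Ami B (perm ws) m (suc n)
      member h = filterB-∈⁺ _ (A B (perm ws) m) (A-complete m bê longê (proj₁ (∧-elim h)))
        (trans (cong not (trans (cong (λ z → memLB z (A B (perm ws) m)) sα₀) (memLB-A m be long))) (proj₂ (∧-elim {b₁} h)))
      member⁻ : α₀ ∈ Ami B (perm ws) m (suc n) → b₁ ∧ not b₂ ≡ true
      member⁻ h with filterB-∈⁻ _ (A B (perm ws) m) h
      ... | a , s = cong₂ _∧_ (trans (sym (leqB-wup m bê longê)) (proj₂ (A-bits m a)))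
            (trans (cong not (sym (trans (cong (λ z → memLB z (A B (perm ws) m)) sα₀) (memLB-A m be long)))) s)
      Ami-unique : Unique (Ami B (perm ws) m (suc n))
      Ami-unique = filterB-unique _ (filterB-unique _
        (subst (λ z → Unique (choose m z)) (sym (range-upFrom (m + B))) (choose-unique m (m + B) 1)))
      count : epsL (newL B ws (suc n) m) m e' ≡ ⟦ b₁ ∧ not b₂ ⟧
      count with b₁ ∧ not b₂ in eq
      ... | true = epsL-once _ m e' α₀ Ami-unique (member eq) hit only
      ... | false = epsL-absent _ m e' _ absent
        where
        absent : ∀ {α} → α ∈ Ami B (perm ws) m (suc n) → eqE (xExp (sα (suc n) α)) e' ≡ false
        absent {α} α∈ with eqE (xExp (sα (suc n) α)) e' in hit'
        ... | false = refl
        ... | true with only α∈ hit'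
        ...   | refl with trans (sym eq) (member⁻ α∈)
        ...     | ()
      open Lift₀ (Lift-at u (Y-lift m))
      difference : ∀ {p q} → Bits (p ∷ q ∷ v) → 𝔻 (Y (suc n ∷ ws) m) (u ++ p ∷ q ∷ v) - 𝔻 y (u ++ p ∷ q ∷ v)
        ≡ ⟦ dom 0 (u ++ q ∷ p ∷ v) y ∧ not (dom 0 (u ++ p ∷ q ∷ v) y) ⟧
      difference (0∷ (0∷ _)) = trans (ℤP.i≡j⇒i-j≡0 (l00 v)) (diag (dom 0 (u ++ 0 ∷ 0 ∷ v) y))
        where
        diag : ∀ b → + 0 ≡ ⟦ b ∧ not b ⟧
        diag true = refl
        diag false = refl
      difference (1∷ (1∷ _)) = trans (ℤP.i≡j⇒i-j≡0 (l11 v)) (diag (dom 0 (u ++ 1 ∷ 1 ∷ v) y))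
        where
        diag : ∀ b → + 0 ≡ ⟦ b ∧ not b ⟧
        diag true = refl
        diag false = refl
      difference (1∷ (0∷ _)) = trans (ℤP.i≡j⇒i-j≡0 (l10 v)) (implied _ _ (dom-raise 0 u v y))
        where
        implied : ∀ a b → (a ≡ true → b ≡ true) → + 0 ≡ ⟦ a ∧ not b ⟧
        implied true b h rewrite h refl = refl
        implied false b h = refl
      difference (0∷ (1∷ _)) = trans (cong (_- 𝔻 y (u ++ 0 ∷ 1 ∷ v)) (l01 v)) (minus _ _ (dom-raise 0 u v y))
        where
        minus : ∀ a b → (a ≡ true → b ≡ true) → ⟦ b ⟧ - ⟦ a ⟧ ≡ ⟦ b ∧ not a ⟧
        minus true b h rewrite h refl = refl
        minus false true h = refl
        minus false false h = refl

-- The coefficient of T_k T_l in P_w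

-- `S` consults its arguments only at 0/1 vectors of the length of `e`. This matters because
-- identities such as `newL-coeff` are available only for vectors that are long enough.
S-cong-bits : ∀ e {κ κ' μ μ'} → (∀ {v} → Bits v → length v ≡ length e → κ v ≡ κ' v) →
  (∀ {v} → Bits v → length v ≡ length e → μ v ≡ μ' v) → S κ μ e ≡ S κ' μ' e
S-cong-bits [] p q = cong₂ ℤ._*_ (p [] refl) (q [] refl)
S-cong-bits (0 ∷ e) p q = S-cong-bits e (λ b h → p (0∷ b) (cong suc h)) (λ b h → q (0∷ b) (cong suc h))
S-cong-bits (1 ∷ e) p q = cong₂ ℤ._+_
  (S-cong-bits e (λ b h → p (0∷ b) (cong suc h)) (λ b h → q (1∷ b) (cong suc h)))
  (S-cong-bits e (λ b h → p (1∷ b) (cong suc h)) (λ b h → q (0∷ b) (cong suc h)))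
S-cong-bits (2 ∷ e) p q = S-cong-bits e (λ b h → p (1∷ b) (cong suc h)) (λ b h → q (1∷ b) (cong suc h))
S-cong-bits (suc (suc (suc _)) ∷ e) p q = refl

W-cong-bits : ∀ e h {κ κ' μ μ'} → (∀ {v} → Bits v → length v ≡ length e → κ v ≡ κ' v) →
  (∀ {v} → Bits v → length v ≡ length e → μ v ≡ μ' v) → W κ μ e h ≡ W κ' μ' e h
W-cong-bits [] zero p q = cong₂ ℤ._*_ (p [] refl) (q [] refl)
W-cong-bits [] (suc h) p q = refl
W-cong-bits (0 ∷ e) h p q = W-cong-bits e h (λ b h → p (0∷ b) (cong suc h)) (λ b h → q (0∷ b) (cong suc h))
W-cong-bits (1 ∷ e) zero p q = cong₂ ℤ._+_
  (W-cong-bits e 0 (λ b h → p (0∷ b) (cong suc h)) (λ b h → q (1∷ b) (cong suc h)))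
  (W-cong-bits e 1 (λ b h → p (0∷ b) (cong suc h)) (λ b h → q (0∷ b) (cong suc h)))
W-cong-bits (1 ∷ e) (suc h) p q = cong₂ ℤ._+_
  (W-cong-bits e (2 + h) (λ b h → p (0∷ b) (cong suc h)) (λ b h → q (0∷ b) (cong suc h)))
  (W-cong-bits e h (λ b h → p (1∷ b) (cong suc h)) (λ b h → q (1∷ b) (cong suc h)))
W-cong-bits (2 ∷ e) h p q = W-cong-bits e h (λ b h → p (1∷ b) (cong suc h)) (λ b h → q (1∷ b) (cong suc h))
W-cong-bits (suc (suc (suc _)) ∷ e) h p q = refl

epsL-++ : ∀ L L' m e → epsL (L ++ L') m e ≡ epsL L m e ℤ.+ epsL L' m e
epsL-++ [] L' m e = sym (ℤP.+-identityˡ _)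
epsL-++ ((n , ν) ∷ L) L' m e = trans (cong (λ z → (if n ≡ᵇ m then 𝟙 ν e else + 0) ℤ.+ z) (epsL-++ L L' m e))
  (sym (ℤP.+-assoc (if n ≡ᵇ m then 𝟙 ν e else + 0) (epsL L m e) (epsL L' m e)))

epsL-other : ∀ m e L → All (λ x → ¬ proj₁ x ≡ m) L → epsL L m e ≡ + 0
epsL-other m e [] _ = refl
epsL-other m e ((n , ν) ∷ L) (h ∷ hs) rewrite ≡ᵇ-false n m h = trans (ℤP.+-identityˡ _) (epsL-other m e L hs)

epsL-concat : ∀ m e (G : ℕ → List (ℕ × Exp)) → (∀ n → All (λ x → proj₁ x ≡ n) (G n)) → ∀ xs → Unique xs →
  (m ∈ xs → epsL (concatMap G xs) m e ≡ epsL (G m) m e) × (¬ m ∈ xs → epsL (concatMap G xs) m e ≡ + 0)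
epsL-concat m e G h [] _ = (λ ()) , λ _ → refl
epsL-concat m e G h (x ∷ xs) (x∉ ∷ u) = present , absent
  where
  IH = epsL-concat m e G h xs u
  skip : ¬ x ≡ m → epsL (G x) m e ≡ + 0
  skip x≢m = epsL-other m e (G x) (All.map (λ { refl → x≢m }) (h x))
  present : m ∈ x ∷ xs → epsL (concatMap G (x ∷ xs)) m e ≡ epsL (G m) m e
  present (here refl) = trans (epsL-++ (G x) _ m e)
    (trans (cong (λ z → epsL (G x) m e ℤ.+ z) (proj₂ IH λ m∈ → All.lookup x∉ m∈ refl)) (ℤP.+-identityʳ _))
  present (there m∈) = trans (epsL-++ (G x) _ m e)
    (trans (cong₂ ℤ._+_ (skip (All.lookup x∉ m∈)) (proj₁ IH m∈)) (ℤP.+-identityˡ _))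
  absent : ¬ m ∈ x ∷ xs → epsL (concatMap G (x ∷ xs)) m e ≡ + 0
  absent m∉ = trans (epsL-++ (G x) _ m e) (cong₂ ℤ._+_ (skip λ x≡m → m∉ (here (sym x≡m))) (proj₂ IH (m∉ ∘ there)))

N-factors : ∀ B ws i → N B (perm ws) i ≡ prodP (map factor (concatMap (newL B ws i) (range B)))
N-factors B ws i = cong prodP (go (range B))
  where
  go : ∀ ms → concatMap (λ m → map (λ α → factor (m , xExp (sα i α))) (Ami B (perm ws) m i)) ms
    ≡ map factor (concatMap (newL B ws i) ms)
  go [] = refl
  go (m ∷ ms) = trans (cong₂ _++_ (LP.map-∘ (Ami B (perm ws) m i)) (go ms))
    (sym (LP.map-++ factor (newL B ws i m) (concatMap (newL B ws i) ms)))

𝟙-Demazure : ∀ u v → Demazure (λ p q → 𝟙 [] (u ++ p ∷ q ∷ v)) (λ p q → 𝟙 [] (u ++ p ∷ q ∷ v))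
𝟙-Demazure [] v = record
  { f-suppˡ = λ _ _ → refl ; f-suppʳ = supp ; g-suppˡ = λ _ _ → refl ; g-suppʳ = supp
  ; at00 = refl ; at22 = refl ; at10 = refl ; at01 = refl ; at20 = refl ; at02 = refl ; at21 = refl ; at12 = refl
  ; at11 = refl }
  where
  supp : ∀ p q → 𝟙 [] (p ∷ 3 + q ∷ v) ≡ + 0
  supp zero q = refl
  supp (suc p) q = refl
𝟙-Demazure (zero ∷ u) v = 𝟙-Demazure u v
𝟙-Demazure (suc x ∷ u) v = Demazure-0

Y-id : ∀ m j → Y [] m j ≡ seg m j
Y-id m j with suc j ℕP.≤? m
... | yes j<m = trans (ℕP.≤-antisym (Y-≤1 {m} [] [] m j) (subst (1 ≤_) (sym (Y-occ {m} [] [] m j))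
        (occ-∈ (∈P.∈-map⁺ (perm []) (∈-range m (suc j) (s≤s z≤n) j<m))))) (sym (seg-< m j j<m))
... | no j≮m = trans (Y-occ {m} [] [] m j) (trans (occ-≢ (suc j) (values [] m)
        (AllP.map⁺ (All.map (λ { (_ , b) refl → j≮m b }) (range-bounds m)))) (sym (seg-≥ m j (ℕP.≮⇒≥ j≮m))))

-- minus the number m^{k,l}_η(w) of the paper
𝕄 : List ℕ → ℕ → ℕ → Exp → ℤ
𝕄 ws k l e = W (𝔻 (Y ws k)) (𝔻 (Y ws l)) e 0 - S (𝔻 (Y ws k)) (𝔻 (Y ws l)) e

module _ {k l : ℕ} (k≥1 : 1 ≤ k) (k<l : k < l) (B : ℕ) where

  -- Induction along the word. With ε_m the sum over the new sets, the product with `N` has - ε_m at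
  -- T_m and `𝕄` + ε_k ε_l at T_k T_l. Applying π_i kills the former and turns W - (S - ε_k ε_l)
  -- into the difference W - S for s_i w, by `W-Demazure` and `S-Demazure`.
  P-slices : ∀ {ws P} → IsP B ws P → All (1 ≤_) ws → All (_< B) ws →
    Slices k l (l + B) (𝕄 ws k l) (epsL []) (coeff′ P)
  P-slices base _ _ = record
    { rising = λ e τ j _ h → drop e τ λ eq → ℕP.<⇒≱ h (subst (_≤ nth τ j) (eqE→nth [] τ eq (suc j)) z≤n)
    ; constant = λ e τ _ h → keep e τ (nth→eqE [] τ λ j → sym (h j))
    ; linear = λ { (suc m) _ _ e τ _ h → drop e τ λ eq → 0≢1 (trans (eqE→nth [] τ eq 0) (h 0)) }
    ; quadratic = λ e τ _ h → trans (drop e τ λ eq → ℕP.<⇒≢ (s≤s z≤n) (trans (eqE→nth [] τ eq 0)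
        (trans (h 0) (cong₂ _+_ (seg-< k 0 k≥1) (seg-< l 0 (ℕP.≤-trans k≥1 (ℕP.<⇒≤ k<l)))))))
        (sym (cong₂ ℤ._+_ (ℤP.i≡j⇒i-j≡0 (identity e)) (S-zeroˡ (λ _ → refl) e)))
    }
    where
    0≢1 : ¬ 0 ≡ 1
    0≢1 ()
    drop : ∀ e τ → ¬ eqE [] τ ≡ true → coeff′ oneP e τ ≡ + 0
    drop e τ h with eqE [] e | eqE [] τ
    ... | _ | true = ⊥-elim (h refl)
    ... | true | false = refl
    ... | false | false = refl
    keep : ∀ e τ → eqE [] τ ≡ true → coeff′ oneP e τ ≡ 𝟙 [] e
    keep e τ h rewrite h | BP.∧-identityʳ (eqE [] e) = ℤP.+-identityʳ (𝟙 [] e)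
    to-seg : ∀ m v → 𝔻 (Y [] m) v ≡ 𝔻 (seg m) v
    to-seg m v = cong ⟦_⟧ (dom-cong 0 v (Y-id m))
    identity : ∀ e → W (𝔻 (Y [] k)) (𝔻 (Y [] l)) e 0 ≡ S (𝔻 (Y [] k)) (𝔻 (Y [] l)) e
    identity e = trans (W-cong (to-seg k) (to-seg l) e 0) (trans
      (subst (λ z → W (𝔻 (seg k)) (𝔻 (seg z)) e 0 ≡ S (𝔻 (seg k)) (𝔻 (seg z)) e) (ℕP.m+[n∸m]≡n (ℕP.<⇒≤ k<l))
        (W≡S-id k (l ∸ k) e))
      (sym (S-cong (to-seg k) (to-seg l) e)))
  P-slices {_ ∷ ws} {Q} (step {P = P} (suc n) _ up isP π) (_ ∷ ws≥1) (i<B ∷ ws<B) = record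
    { rising = λ e τ j r h → slice {λ _ → + 0} {λ _ → + 0} τ (λ e r → PN.rising e τ j r h) (λ u v _ → Demazure-0) e r
    ; constant = λ e τ r h → slice τ (λ e r → PN.constant e τ r h) (λ u v _ → 𝟙-Demazure u v) e r
    ; linear = λ m m≥1 m≤l e τ r h → slice {λ e → - (new m e)} {λ _ → + 0} τ
        (λ e r → trans (PN.linear m m≥1 m≤l e τ r h) (cong -_ (trans (ℤP.+-identityʳ _) (eps-new m m≥1 m≤l e r))))
        (λ { u v refl → Demazure-neg (new-Demazure u (lift m) v) }) e r
    ; quadratic = λ e τ r h → trans
        (slice {λ e → 𝕄 ws k l e ℤ.+ S (new k) (new l) e} {𝕄 (suc n ∷ ws) k l} τ
          (λ e r → trans (PN.quadratic e τ r h) (cong (λ z → 𝕄 ws k l e ℤ.+ z)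
            (S-cong-bits e (λ {v} _ h → same k k≥1 (ℕP.<⇒≤ k<l) v (long {e} {v} r h)) (λ {v} _ h → same l l≥1 ℕP.≤-refl v (long {e} {v} r h)))))
          (λ { u v refl → Demazure-resp
            (λ p q → rearrange (W (𝔻 (Y ws k)) (𝔻 (Y ws l)) (u ++ p ∷ q ∷ v) 0) (S (𝔻 (Y ws k)) (𝔻 (Y ws l)) (u ++ p ∷ q ∷ v))
              (S (new k) (new l) (u ++ p ∷ q ∷ v)))
            (λ _ _ → refl)
            (Demazure-+ (W-Demazure u (lift k) (lift l) v 0) (Demazure-neg (S-Demazure u (lift k) (lift l) v))) }) e r)
        (sym (trans (cong (λ z → 𝕄 (suc n ∷ ws) k l e ℤ.+ z) (S-zeroˡ (λ _ → refl) e)) (ℤP.+-identityʳ _)))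
    }
    where
    R = l + B
    l≥1 : 1 ≤ l
    l≥1 = ℕP.≤-trans k≥1 (ℕP.<⇒≤ k<l)
    new : ℕ → Exp → ℤ
    new m e = 𝔻 (Y (suc n ∷ ws) m) e - 𝔻 (Y ws m) e
    lift : ∀ m → Lift n (𝔻 (Y ws m)) (𝔻 (Y (suc n ∷ ws) m))
    lift = Y-lift ws≥1 ws<B i<B up
    L : List (ℕ × Exp)
    L = concatMap (newL B ws (suc n)) (range B)
    PNL = P *P N B (perm ws) (suc n)
    good : All (λ x → 1 ≤ proj₁ x × Bits (proj₂ x)) L
    good = AllP.concat⁺ (AllP.map⁺ (All.map (λ {m} (m≥1 , _) →
      AllP.map⁺ (All.tabulate λ α∈ → m≥1 , Ami-bits ws≥1 ws<B i<B up m α∈)) (range-bounds B)))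
    module PN = Slices (subst (λ z → Slices k l R (𝕄 ws k l) (λ m e → epsL L m e ℤ.+ + 0) (coeff′ (P *P z)))
      (sym (N-factors B ws (suc n))) (Slices-product k≥1 k<l L [] P good [] (P-slices isP ws≥1 ws<B)))
    level : ∀ m → All (λ x → proj₁ x ≡ m) (newL B ws (suc n) m)
    level m = AllP.map⁺ (All.tabulate λ _ → refl)
    eps-new : ∀ m → 1 ≤ m → m ≤ l → ∀ e → R ≤ length e → epsL L m e ≡ new m e
    eps-new m m≥1 m≤l e r with epsL-concat m e (newL B ws (suc n)) level (range B) (range-unique B) | m ℕP.≤? B
    ... | present , _ | yes m≤B = trans (present (∈-range B m m≥1 m≤B))
            (newL-coeff ws≥1 ws<B i<B up m e (ℕP.≤-trans (ℕP.+-monoˡ-≤ B m≤l) r))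
    -- For m > B the product contributes no factor, and the indicator does not change either.
    ... | _ , absent | no m≰B = trans (absent λ m∈ → m≰B (proj₂ (All.lookup (range-bounds B) m∈)))
            (sym (ℤP.i≡j⇒i-j≡0 (cong ⟦_⟧ (dom-cong 0 e (Y-stable ws≥1 ws<B i<B up m (ℕP.<⇒≤ (ℕP.≰⇒> m≰B)))))))
    same : ∀ m → 1 ≤ m → m ≤ l → ∀ e → R ≤ length e → epsL L m e ℤ.+ + 0 ≡ new m e
    same m m≥1 m≤l e r = trans (ℤP.+-identityʳ _) (eps-new m m≥1 m≤l e r)
    long : ∀ {e v : Exp} → R ≤ length e → length v ≡ length e → R ≤ length v
    long r h = subst (R ≤_) (sym h) r
    rearrange : ∀ w s t → w ℤ.+ ℤ.- (s ℤ.- t) ≡ (w ℤ.- s) ℤ.+ t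
    rearrange = solve-∀
    -- At a fixed t-exponent, any `G` related to `F` by the table `Demazure` in all contexts solves
    -- the equations that define the coefficients of `Q`; `↦-unique` then identifies the two.
    slice : ∀ {F G : Exp → ℤ} τ → (∀ e → R ≤ length e → coeff′ PNL e τ ≡ F e) →
      (∀ u v → length u ≡ n → Demazure (λ p q → F (u ++ p ∷ q ∷ v)) (λ p q → G (u ++ p ∷ q ∷ v))) →
      ∀ e → R ≤ length e → coeff′ Q e τ ≡ G e
    slice {F} {G} τ hF D e r with split-at n e (ℕP.<-≤-trans i<B (ℕP.≤-trans (ℕP.m≤n+m B l) r))
    ... | u , p , q , v , refl , refl = ↦-unique {λ p q → coeff′ PNL (u ++ p ∷ q ∷ v) τ}
      {λ p q → coeff′ Q (u ++ p ∷ q ∷ v) τ} {λ p q → G (u ++ p ∷ q ∷ v)} (coeff-π u PNL Q π v τ)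
      (Demazure⇒↦ (Demazure-resp (λ p' q' → sym (hF (u ++ p' ∷ q' ∷ v) (long {u ++ p ∷ q ∷ v} {u ++ p' ∷ q' ∷ v} r
        (trans (LP.length-++ u {p' ∷ q' ∷ v}) (sym (LP.length-++ u {p ∷ q ∷ v})))))) (λ _ _ → refl) (D u v refl))) p q

-- The count when all multiplicities are 1

nil : List ℕ → ℤ
nil [] = + 1
nil (_ ∷ _) = + 0

-- for v ∈ {0,1}^n: the positions of the ones, numbered from 0, are strictly below the entries of Y, one by one
th : List ℕ → Exp → ℤ
th Y [] = nil Y
th Y (zero ∷ v) = th (map pred Y) v
th [] (suc _ ∷ v) = + 0
th (zero ∷ Y) (suc _ ∷ v) = + 0
th (suc _ ∷ Y) (suc _ ∷ v) = th (map pred Y) v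

-- likewise, the positions of the zeros are at or above the entries of Y
co : List ℕ → Exp → ℤ
co Y [] = nil Y
co Y (suc _ ∷ v) = co (map pred Y) v
co [] (zero ∷ v) = + 0
co (zero ∷ Y) (zero ∷ v) = co (map pred Y) v
co (suc _ ∷ Y) (zero ∷ v) = + 0

th-zero : ∀ Y v → th (0 ∷ Y) v ≡ + 0
th-zero Y [] = refl
th-zero Y (zero ∷ v) = th-zero (map pred Y) v
th-zero Y (suc _ ∷ v) = refl

𝟏 : ℕ → Exp
𝟏 n = replicate n 1

∸-pos : ∀ {m n} → n ≤ m → + (m ∸ n) ≡ + m - + n
∸-pos {m} {n} h = trans (sym (ℤP.⊖-≥ h)) (sym (ℤP.m-n≡m⊖n m n))

W-0 : ∀ n → W (th []) (co []) (𝟏 n) 0 ≡ + 1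
W-0 zero = refl
W-0 (suc n) = cong₂ ℤ._+_ (W-0 n) (W-zeroʳ (λ _ → refl) (𝟏 n) 1)

S-0 : ∀ n → S (th []) (co []) (𝟏 n) ≡ + 1
S-0 zero = refl
S-0 (suc n) = cong₂ ℤ._+_ (S-0 n) (S-zeroˡ (λ _ → refl) (𝟏 n))

-- The single one of β is the single zero of α, so the choice is among the positions b, ..., D - 1.
S-1 : ∀ n D b → D ≤ n → S (th (D ∷ [])) (co (b ∷ [])) (𝟏 n) ≡ + (D ∸ b)
S-1 zero zero b _ = cong +_ (sym (ℕP.0∸n≡0 b))
S-1 (suc n) zero b _ = trans (S-zeroˡ {μ = co (b ∷ [])} (th-zero []) (𝟏 (suc n))) (cong +_ (sym (ℕP.0∸n≡0 b)))
S-1 (suc n) (suc D) (suc b) (s≤s h) =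
  trans (cong₂ ℤ._+_ (S-1 n D b h) (S-zeroʳ (λ _ → refl) (𝟏 n))) (ℤP.+-identityʳ _)
S-1 (suc n) (suc D) zero (s≤s h) =
  trans (cong₂ ℤ._+_ (S-1 n D 0 h) (S-0 n)) (ℤP.+-comm (+ D) (+ 1))

W-0-up : ∀ n D → suc D ≤ n → W (th (suc D ∷ [])) (co []) (𝟏 n) 1 ≡ + 1
W-0-up (suc n) D _ = cong₂ ℤ._+_ (W-zeroʳ (λ _ → refl) (𝟏 n) 2) (W-0 n)

-- No level step is allowed at height 1 and only one up step is available, so the down step follows
-- it at once: the peak starts at one of b, ..., D - 2.
W-1 : ∀ n D b → D ≤ n → W (th (D ∷ [])) (co (b ∷ [])) (𝟏 n) 0 ≡ + (D ∸ 1 ∸ b)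
W-1 n zero b _ = trans (W-zeroˡ (th-zero []) (𝟏 n) 0) (cong +_ (sym (ℕP.0∸n≡0 b)))
W-1 (suc n) (suc zero) b _ = trans (cong₂ ℤ._+_ (W-zeroˡ (th-zero []) (𝟏 n) 0) (W-zeroˡ (th-zero []) (𝟏 n) 1))
  (cong +_ (sym (ℕP.0∸n≡0 b)))
W-1 (suc n) (suc (suc D)) (suc b) (s≤s h) =
  trans (cong₂ ℤ._+_ (W-1 n (suc D) b h) (W-zeroʳ (λ _ → refl) (𝟏 n) 1)) (ℤP.+-identityʳ _)
W-1 (suc n) (suc (suc D)) zero (s≤s h) =
  trans (cong₂ ℤ._+_ (W-1 n (suc D) 0 h) (W-0-up n D h)) (ℤP.+-comm (+ D) (+ 1))

W-0-up² : ∀ n C D → suc C < D → D ≤ n → W (th (suc C ∷ D ∷ [])) (co []) (𝟏 n) 2 ≡ + 1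
W-0-up² n C (suc zero) (s≤s ()) _
W-0-up² (suc n) C (suc (suc D)) C<D (s≤s h) =
  cong₂ ℤ._+_ (W-zeroʳ (λ _ → refl) (𝟏 n) 3) (W-0-up n D h)

-- The bound `suc b` forbids an up step at the first letter, and at height 1 only a down step is
-- left; `W-1` counts the rest.
W-1-up : ∀ n C D b → suc C < D → D ≤ n →
  W (th (suc C ∷ D ∷ [])) (co (suc b ∷ [])) (𝟏 n) 1 ≡ + (D ∸ 2 ∸ b)
W-1-up (suc n) C (suc D) b C<D (s≤s h) =
  trans (cong₂ ℤ._+_ (W-zeroʳ (λ _ → refl) (𝟏 n) 2) (W-1 n D b h)) (ℤP.+-identityˡ _)

-- With lower bound 0 an up step is possible as well. The two down steps then follow at once, and
-- the first of them, at position 1, must stay below `suc C`: this is one path if C ≥ 1 and none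
-- otherwise. That indicator is written `1 ∸ (1 ∸ C)` so that it cancels in `count₀-low`.
W-1-up₀ : ∀ n C D → suc C < D → D ≤ n → W (th (suc C ∷ D ∷ [])) (co (0 ∷ [])) (𝟏 n) 1 ≡ + (1 ∸ (1 ∸ C)) ℤ.+ + (D ∸ 2)
W-1-up₀ (suc n) zero (suc D) C<D (s≤s h) = cong₂ ℤ._+_ (W-zeroˡ (th-zero (D ∷ [])) (𝟏 n) 2) (W-1 n D 0 h)
W-1-up₀ (suc n) (suc C) (suc D) (s≤s C<D) (s≤s h) =
  trans (cong₂ ℤ._+_ (W-0-up² n C D C<D h) (W-1 n D 0 h)) (cong (λ z → + (1 ∸ z) ℤ.+ + (D ∸ 1)) (sym (ℕP.0∸n≡0 C)))

regroup : ∀ s s' w w' → (s ℤ.+ s') ℤ.- (w ℤ.+ w') ≡ (s ℤ.- w) ℤ.+ (s' ℤ.- w')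
regroup = solve-∀

-- For b = 0 and b = 1 the first letter leaves the same remaining bound 0, so both cases share this
-- computation.
count₀-low : ∀ c n D → suc c < 2 + D → 2 + D ≤ n →
  S (th (suc c ∷ 2 + D ∷ [])) (co (0 ∷ 0 ∷ [])) (𝟏 n) - W (th (suc c ∷ 2 + D ∷ [])) (co (0 ∷ 0 ∷ [])) (𝟏 n) 0
    ≡ + (2 + D) - + (1 ∸ c) →
  (S (th (suc c ∷ 2 + D ∷ [])) (co (0 ∷ 0 ∷ [])) (𝟏 n) ℤ.+ S (th (2 + D ∷ [])) (co (0 ∷ [])) (𝟏 n))
    - (W (th (suc c ∷ 2 + D ∷ [])) (co (0 ∷ 0 ∷ [])) (𝟏 n) 0 ℤ.+ W (th (suc c ∷ 2 + D ∷ [])) (co (0 ∷ [])) (𝟏 n) 1)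
  ≡ + (3 + D) - + (0 ∸ c)
count₀-low c n D c<D h IH = trans (regroup (S _ (co (0 ∷ 0 ∷ [])) (𝟏 n)) _ _ _)
  (trans (cong₂ ℤ._+_ IH (cong₂ _-_ (S-1 n (2 + D) 0 h) (trans (W-1-up₀ n c (2 + D) c<D h)
      (cong (λ z → z ℤ.+ + D) (∸-pos (ℕP.m∸n≤m 1 c))))))
    (trans (rearrange (+ D) (+ (1 ∸ c))) (cong (λ z → + (3 + D) - + z) (sym (ℕP.0∸n≡0 c)))))
  where
  rearrange : ∀ d t → ((+ 2 ℤ.+ d) ℤ.- t) ℤ.+ ((+ 2 ℤ.+ d) ℤ.- ((+ 1 ℤ.- t) ℤ.+ d)) ≡ (+ 3 ℤ.+ d) ℤ.- + 0
  rearrange = solve-∀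

-- The two zeros of α occupy different positions, so the larger is at least 1 whatever b is; hence
-- `b ⊔ 1`. Reading a letter that α alone takes lowers the bounds by one. For b ≥ 2 the other first
-- letters contribute exactly one to the difference, as `S-1` exceeds `W-1-up` by one, and this
-- restores the lost unit of D.
count₀ : ∀ c n b D → suc c < D → D ≤ n → b < D →
  S (th (suc c ∷ D ∷ [])) (co (0 ∷ b ∷ [])) (𝟏 n) - W (th (suc c ∷ D ∷ [])) (co (0 ∷ b ∷ [])) (𝟏 n) 0
  ≡ + D - + ((b ⊔ 1) ∸ c)
-- For c = 0 the smaller one of β must sit at position 0, but no path begins with a down step; only
-- splittings are counted.
count₀ zero (suc n) b (suc D) _ (s≤s h) b<D = trans
  (cong₂ _-_ (cong₂ ℤ._+_ (S-zeroˡ (th-zero (D ∷ [])) (𝟏 n)) (S-1 n D (pred b) h))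
    (cong₂ ℤ._+_ (W-zeroˡ (th-zero (D ∷ [])) (𝟏 n) 0) (W-zeroˡ (th-zero (D ∷ [])) (𝟏 n) 1)))
  (last b b<D)
  where
  last : ∀ b → b < suc D → (+ 0 ℤ.+ + (D ∸ pred b)) - + 0 ≡ + (suc D) - + (b ⊔ 1)
  last zero _ = rearrange (+ D)
    where
    rearrange : ∀ d → (+ 0 ℤ.+ d) ℤ.- + 0 ≡ (+ 1 ℤ.+ d) ℤ.- + 1
    rearrange = solve-∀
  last (suc b) (s≤s b≤D) = trans (cong (λ z → (+ 0 ℤ.+ z) - + 0) (∸-pos (ℕP.<⇒≤ b≤D))) (trans (rearrange (+ D) (+ b))
    (cong (λ z → + suc D - + suc z) (sym (ℕP.⊔-identityʳ b))))
    where
    rearrange : ∀ d b → (+ 0 ℤ.+ (d ℤ.- b)) ℤ.- + 0 ≡ (+ 1 ℤ.+ d) ℤ.- (+ 1 ℤ.+ b)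
    rearrange = solve-∀
count₀ (suc c) (suc n) b (suc (suc zero)) (s≤s (s≤s ())) _ _
count₀ (suc c) (suc n) (suc (suc b)) (suc (suc (suc D))) (s≤s c<D) (s≤s h) (s≤s (s≤s (s≤s b≤D))) = trans
  (regroup (S _ (co (0 ∷ suc b ∷ [])) (𝟏 n)) _ _ _)
  (trans (cong₂ ℤ._+_ (count₀ c n (suc b) (2 + D) c<D h (s≤s (s≤s b≤D)))
      (cong₂ _-_ (trans (S-1 n (2 + D) (suc b) h) (∸-pos (ℕP.m≤n⇒m≤1+n b≤D)))
        (trans (W-1-up n c (2 + D) b c<D h) (∸-pos b≤D))))
    (trans (cong (λ z → (+ (2 + D) - + (suc z ∸ c)) ℤ.+ ((+ suc D - + b) - (+ D - + b))) (ℕP.⊔-identityʳ b))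
      (rearrange (+ D) (+ (suc b ∸ c)) (+ b))))
  where
  rearrange : ∀ d t b → ((+ 2 ℤ.+ d) ℤ.- t) ℤ.+ ((+ 1 ℤ.+ d ℤ.- b) ℤ.- (d ℤ.- b)) ≡ (+ 3 ℤ.+ d) ℤ.- t
  rearrange = solve-∀
count₀ (suc c) (suc n) zero (suc (suc (suc D))) (s≤s c<D) (s≤s h) _ =
  count₀-low c n D c<D h (count₀ c n 0 (2 + D) c<D h (s≤s z≤n))
count₀ (suc c) (suc n) (suc zero) (suc (suc (suc D))) (s≤s c<D) (s≤s h) _ =
  count₀-low c n D c<D h (count₀ c n 0 (2 + D) c<D h (s≤s z≤n))

-- The first a letters are forced: α takes the entry, which is a level step of the path. This lowers
-- a to 0. The truncated difference `b ∸ c` is ε (b - c), and the bounds are `suc c`, `suc d`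
-- because `th` compares strictly.
count : ∀ a n b c d → a < b → a ≤ c → c < d → b ≤ d → d < n →
  S (th (suc c ∷ suc d ∷ [])) (co (a ∷ b ∷ [])) (𝟏 n) - W (th (suc c ∷ suc d ∷ [])) (co (a ∷ b ∷ [])) (𝟏 n) 0
  ≡ (+ d - + a ℤ.+ + 1) - + (b ∸ c)
count zero n (suc b) c d a<b a≤c c<d b≤d d<n = trans (count₀ c n (suc b) (suc d) (s≤s c<d) d<n (s≤s b≤d))
  (trans (cong (λ z → + suc d - + (suc z ∸ c)) (ℕP.⊔-identityʳ b)) (rearrange (+ d) (+ (suc b ∸ c))))
  where
  rearrange : ∀ d t → (+ 1 ℤ.+ d) ℤ.- t ≡ (d ℤ.- + 0 ℤ.+ + 1) ℤ.- t
  rearrange = solve-∀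
count (suc a) (suc n) (suc b) (suc c) (suc d) (s≤s a<b) (s≤s a≤c) (s≤s c<d) (s≤s b≤d) (s≤s d<n) =
  drop (S κ μ (𝟏 n)) (W κ μ (𝟏 n) 0) (S-zeroʳ {th (suc (suc c) ∷ suc (suc d) ∷ []) ⟨ 1 ⟩} (λ _ → refl) (𝟏 n))
    (W-zeroʳ {κ} (λ _ → refl) (𝟏 n) 1)
    (trans (count a n b c d a<b a≤c c<d b≤d d<n) (rearrange (+ d) (+ a) (+ (b ∸ c))))
  where
  rearrange : ∀ d a t → (d ℤ.- a ℤ.+ + 1) ℤ.- t ≡ ((+ 1 ℤ.+ d) ℤ.- (+ 1 ℤ.+ a) ℤ.+ + 1) ℤ.- t
  rearrange = solve-∀
  κ μ : Exp → ℤ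
  κ = th (suc c ∷ suc d ∷ [])
  μ = co (a ∷ b ∷ [])
  drop : ∀ (x y : ℤ) {x' y' z : ℤ} → x' ≡ + 0 → y' ≡ + 0 → x - y ≡ z → (x ℤ.+ x') - (y ℤ.+ y') ≡ z
  drop x y refl refl h = trans (cong₂ _-_ (ℤP.+-identityʳ x) (ℤP.+-identityʳ y)) h

-- Reduction to the entries of multiplicity 1

compl : Exp → Exp
compl = map (1 ∸_)

pos-suc : ∀ s v → pos (suc s) v ≡ map suc (pos s v)
pos-suc s [] = refl
pos-suc s (x ∷ v) = trans (cong₂ _++_ (sym (LP.map-replicate suc x s)) (pos-suc (suc s) v))
  (sym (LP.map-++ suc (replicate x s) (pos (suc s) v)))

leqB-pred : ∀ L Y → All (1 ≤_) L → leqB (map suc L) Y ≡ leqB L (map pred Y)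
leqB-pred [] [] _ = refl
leqB-pred [] (y ∷ Y) _ = refl
leqB-pred (zero ∷ L) Y (() ∷ _)
leqB-pred (suc x ∷ L) [] _ = refl
leqB-pred (suc x ∷ L) (zero ∷ Y) _ = refl
leqB-pred (suc x ∷ L) (suc y ∷ Y) (_ ∷ h) = cong ((suc x ≤ᵇ y) ∧_) (leqB-pred L Y h)

leqB-map-suc : ∀ L L' → leqB (map suc L) (map suc L') ≡ leqB L L'
leqB-map-suc [] [] = refl
leqB-map-suc [] (y ∷ L') = refl
leqB-map-suc (x ∷ L) [] = refl
leqB-map-suc (zero ∷ L) (y ∷ L') = leqB-map-suc L L'
leqB-map-suc (suc x ∷ L) (y ∷ L') = cong ((suc x ≤ᵇ y) ∧_) (leqB-map-suc L L')

leqB-ceil : ∀ Y L → All (1 ≤_) L → leqB (map suc (map pred Y)) L ≡ leqB Y L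
leqB-ceil [] [] _ = refl
leqB-ceil [] (x ∷ L) _ = refl
leqB-ceil (y ∷ Y) [] _ = refl
leqB-ceil (zero ∷ Y) (suc x ∷ L) (_ ∷ h) = leqB-ceil Y L h
leqB-ceil (suc y ∷ Y) (x ∷ L) (_ ∷ h) = cong ((suc y ≤ᵇ x) ∧_) (leqB-ceil Y L h)

-- `th` numbers positions from 0 and `pos 1` from 1, which turns the strict bounds into weak ones;
-- for the same reason the weak lower bounds in `co-leqB` become `map suc Y`.
th-leqB : ∀ Y {v} → Bits v → th Y v ≡ ⟦ leqB (pos 1 v) Y ⟧
th-leqB [] [] = refl
th-leqB (y ∷ Y) [] = refl
th-leqB Y (0∷_ {v} b) = trans (th-leqB (map pred Y) b)
  (cong ⟦_⟧ (sym (trans (cong (λ z → leqB z Y) (pos-suc 1 v)) (leqB-pred (pos 1 v) Y (All-pos 1 v)))))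
th-leqB [] (1∷ b) = refl
th-leqB (zero ∷ Y) (1∷ b) = refl
th-leqB (suc y ∷ Y) (1∷_ {v} b) = trans (th-leqB (map pred Y) b)
  (cong ⟦_⟧ (sym (trans (cong (λ z → leqB z Y) (pos-suc 1 v)) (leqB-pred (pos 1 v) Y (All-pos 1 v)))))

leqB-advance : ∀ Y v → leqB (map suc (map pred Y)) (pos 1 v) ≡ leqB (map suc Y) (pos 2 v)
leqB-advance Y v = trans (leqB-ceil Y (pos 1 v) (All-pos 1 v))
  (sym (trans (cong (leqB (map suc Y)) (pos-suc 1 v)) (leqB-map-suc Y (pos 1 v))))

co-leqB : ∀ Y {v} → Bits v → co Y v ≡ ⟦ leqB (map suc Y) (pos 1 (compl v)) ⟧
co-leqB [] [] = refl
co-leqB (y ∷ Y) [] = refl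
co-leqB Y (1∷_ {v} b) = trans (co-leqB (map pred Y) b) (cong ⟦_⟧ (leqB-advance Y (compl v)))
co-leqB [] (0∷ b) = refl
co-leqB (zero ∷ Y) (0∷_ {v} b) = trans (co-leqB (map pred Y) b) (cong ⟦_⟧ (leqB-advance Y (compl v)))
co-leqB (suc y ∷ Y) (0∷ b) = refl

leqB-trans : ∀ L M N → leqB L M ≡ true → leqB M N ≡ true → leqB L N ≡ true
leqB-trans [] [] [] p q = refl
leqB-trans (x ∷ L) (y ∷ M) (z ∷ N) p q = cong₂ _∧_
  (≤ᵇ-complete (ℕP.≤-trans (≤ᵇ-sound x y (proj₁ (∧-elim p))) (≤ᵇ-sound y z (proj₁ (∧-elim q)))))
  (leqB-trans L M N (proj₂ (∧-elim {x ≤ᵇ y} p)) (proj₂ (∧-elim {y ≤ᵇ z} q)))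

Pointwise⇒leqB : ∀ {L M} → Pointwise _≤_ L M → leqB L M ≡ true
Pointwise⇒leqB [] = refl
Pointwise⇒leqB (x≤y ∷ h) = cong₂ _∧_ (≤ᵇ-complete x≤y) (Pointwise⇒leqB h)

compl-bits : ∀ {v} → Bits v → Bits (compl v)
compl-bits [] = []
compl-bits (0∷ b) = 1∷ compl-bits b
compl-bits (1∷ b) = 0∷ compl-bits b

-- An excess of ones of v over u in a prefix is an excess of zeros of u over v, so complements
-- reverse the order. This turns α ≤ α_max into a lower bound for the complement of α.
dom-compl : ∀ δ {v u} → Bits v → Bits u → length v ≡ length u → dom δ v (nth u) ≡ dom δ (compl u) (nth (compl v))
dom-compl δ [] [] h = refl
dom-compl δ (0∷ b) (0∷ c) h = dom-compl δ b c (ℕP.suc-injective h)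
dom-compl δ (1∷ b) (1∷ c) h = dom-compl δ b c (ℕP.suc-injective h)
dom-compl δ (1∷ b) (0∷ c) h = dom-compl (suc δ) b c (ℕP.suc-injective h)
dom-compl zero (0∷ b) (1∷ c) h = refl
dom-compl (suc δ) (0∷ b) (1∷ c) h = dom-compl δ b c (ℕP.suc-injective h)

is1 : ℕ → ℕ
is1 1 = 1
is1 _ = 0

#1 : Exp → ℕ
#1 [] = 0
#1 (x ∷ e) = is1 x + #1 e

length-pos-is1 : ∀ s e → length (pos s (map is1 e)) ≡ #1 e
length-pos-is1 s [] = refl
length-pos-is1 s (x ∷ e) = trans (LP.length-++ (replicate (is1 x) s))
  (cong₂ _+_ (LP.length-replicate (is1 x)) (length-pos-is1 (suc s) e))

-- for an exponent vector e, the 0/1 vector that is 0, 1 where e is 0, 2, and that is v along the entries 1 of e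
fill : Exp → Exp → Exp
fill [] v = []
fill (0 ∷ e) v = 0 ∷ fill e v
fill (1 ∷ e) [] = 0 ∷ fill e []
fill (1 ∷ e) (x ∷ v) = x ∷ fill e v
fill (suc (suc _) ∷ e) v = 1 ∷ fill e v

restr : Exp → Exp → Exp
restr (1 ∷ e) (x ∷ v) = x ∷ restr e v
restr (0 ∷ e) (x ∷ v) = restr e v
restr (suc (suc _) ∷ e) (x ∷ v) = restr e v
restr _ _ = []

-- Entries 0 and 2 leave no choice of letters, so only the entries 1 contribute summands.
S-fill : ∀ {e} → All (_≤ 2) e → ∀ κ μ → S κ μ e ≡ S (κ ∘ fill e) (μ ∘ fill e) (𝟏 (#1 e))
S-fill [] κ μ = refl
S-fill {0 ∷ e} (_ ∷ h) κ μ = S-fill h (κ ⟨ 0 ⟩) (μ ⟨ 0 ⟩)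
S-fill {1 ∷ e} (_ ∷ h) κ μ = cong₂ ℤ._+_ (S-fill h (κ ⟨ 0 ⟩) (μ ⟨ 1 ⟩)) (S-fill h (κ ⟨ 1 ⟩) (μ ⟨ 0 ⟩))
S-fill {2 ∷ e} (_ ∷ h) κ μ = S-fill h (κ ⟨ 1 ⟩) (μ ⟨ 1 ⟩)
S-fill {suc (suc (suc _)) ∷ e} (s≤s (s≤s ()) ∷ h) κ μ

W-fill : ∀ {e} → All (_≤ 2) e → ∀ κ μ h → W κ μ e h ≡ W (κ ∘ fill e) (μ ∘ fill e) (𝟏 (#1 e)) h
W-fill [] κ μ zero = refl
W-fill [] κ μ (suc h) = refl
W-fill {0 ∷ e} (_ ∷ a) κ μ h = W-fill a (κ ⟨ 0 ⟩) (μ ⟨ 0 ⟩) h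
W-fill {1 ∷ e} (_ ∷ a) κ μ zero = cong₂ ℤ._+_ (W-fill a (κ ⟨ 0 ⟩) (μ ⟨ 1 ⟩) 0) (W-fill a (κ ⟨ 0 ⟩) (μ ⟨ 0 ⟩) 1)
W-fill {1 ∷ e} (_ ∷ a) κ μ (suc h) =
  cong₂ ℤ._+_ (W-fill a (κ ⟨ 0 ⟩) (μ ⟨ 0 ⟩) (2 + h)) (W-fill a (κ ⟨ 1 ⟩) (μ ⟨ 1 ⟩) h)
W-fill {2 ∷ e} (_ ∷ a) κ μ h = W-fill a (κ ⟨ 1 ⟩) (μ ⟨ 1 ⟩) h
W-fill {suc (suc (suc _)) ∷ e} (s≤s (s≤s ()) ∷ a) κ μ h

-- The letters that `fill` inserts agree in both vectors and do not affect the excess.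
dom-fill : ∀ e δ v u → length v ≡ #1 e → length u ≡ #1 e → dom δ (fill e v) (nth (fill e u)) ≡ dom δ v (nth u)
dom-fill [] δ [] [] p q = refl
dom-fill (0 ∷ e) δ v u p q = dom-fill e δ v u p q
dom-fill (1 ∷ e) δ (x ∷ v) (y ∷ u) p q =
  next-cong x y δ λ δ' → dom-fill e δ' v u (ℕP.suc-injective p) (ℕP.suc-injective q)
dom-fill (suc (suc _) ∷ e) δ v u p q = dom-fill e δ v u p q

length-fill : ∀ e v → length (fill e v) ≡ length e
length-fill [] v = refl
length-fill (0 ∷ e) v = cong suc (length-fill e v)
length-fill (1 ∷ e) [] = cong suc (length-fill e [])
length-fill (1 ∷ e) (x ∷ v) = cong suc (length-fill e v)
length-fill (suc (suc _) ∷ e) v = cong suc (length-fill e v)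

fill-bits : ∀ e {v} → Bits v → Bits (fill e v)
fill-bits [] b = []
fill-bits (0 ∷ e) b = 0∷ fill-bits e b
fill-bits (1 ∷ e) [] = 0∷ fill-bits e []
fill-bits (1 ∷ e) (0∷ b) = 0∷ fill-bits e b
fill-bits (1 ∷ e) (1∷ b) = 1∷ fill-bits e b
fill-bits (suc (suc _) ∷ e) b = 1∷ fill-bits e b

-- x is the indicator of a set α with η₂ ⊆ α ⊆ η₁ ∪ η₂
Between : Exp → Exp → Set
Between e x = ∀ j → (nth e j ≡ 0 → nth x j ≡ 0) × (nth e j ≡ 2 → nth x j ≡ 1)

fill-between : ∀ e v → Between e (fill e v)
fill-between [] v j = (λ _ → refl) , λ ()
fill-between (0 ∷ e) v zero = (λ _ → refl) , λ ()
fill-between (1 ∷ e) v zero = (λ ()) , λ ()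
fill-between (suc (suc _) ∷ e) v zero = (λ ()) , λ _ → refl
fill-between (0 ∷ e) v (suc j) = fill-between e v j
fill-between (1 ∷ e) [] (suc j) = fill-between e [] j
fill-between (1 ∷ e) (x ∷ v) (suc j) = fill-between e v j
fill-between (suc (suc _) ∷ e) v (suc j) = fill-between e v j

fill-restr : ∀ {e} → All (_≤ 2) e → ∀ x → length x ≡ length e → Between e x → fill e (restr e x) ≡ x
fill-restr [] [] _ _ = refl
fill-restr {0 ∷ e} (_ ∷ a) (x ∷ xs) l h = cong₂ _∷_ (sym (proj₁ (h 0) refl)) (fill-restr a xs (ℕP.suc-injective l) (h ∘ suc))
fill-restr {1 ∷ e} (_ ∷ a) (x ∷ xs) l h = cong (x ∷_) (fill-restr a xs (ℕP.suc-injective l) (h ∘ suc))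
fill-restr {2 ∷ e} (_ ∷ a) (x ∷ xs) l h = cong₂ _∷_ (sym (proj₂ (h 0) refl)) (fill-restr a xs (ℕP.suc-injective l) (h ∘ suc))
fill-restr {suc (suc (suc _)) ∷ e} (s≤s (s≤s ()) ∷ a) (x ∷ xs) l h

length-restr : ∀ e x → length x ≡ length e → length (restr e x) ≡ #1 e
length-restr [] x l = refl
length-restr (0 ∷ e) (x ∷ xs) l = length-restr e xs (ℕP.suc-injective l)
length-restr (1 ∷ e) (x ∷ xs) l = cong suc (length-restr e xs (ℕP.suc-injective l))
length-restr (suc (suc _) ∷ e) (x ∷ xs) l = length-restr e xs (ℕP.suc-injective l)

restr-bits : ∀ e {x} → Bits x → Bits (restr e x)
restr-bits [] b = []
restr-bits (0 ∷ e) [] = []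
restr-bits (1 ∷ e) [] = []
restr-bits (suc (suc _) ∷ e) [] = []
restr-bits (0 ∷ e) (0∷ b) = restr-bits e b
restr-bits (0 ∷ e) (1∷ b) = restr-bits e b
restr-bits (1 ∷ e) (0∷ b) = 0∷ restr-bits e b
restr-bits (1 ∷ e) (1∷ b) = 1∷ restr-bits e b
restr-bits (suc (suc _) ∷ e) (0∷ b) = restr-bits e b
restr-bits (suc (suc _) ∷ e) (1∷ b) = restr-bits e b

restr-compl : ∀ e x z → length x ≡ length e → length z ≡ length e → (∀ j → nth e j ≡ nth x j + nth z j) →
  compl (restr e x) ≡ restr e z
restr-compl [] x z p q h = refl
restr-compl (0 ∷ e) (x ∷ xs) (z ∷ zs) p q h = restr-compl e xs zs (ℕP.suc-injective p) (ℕP.suc-injective q) (h ∘ suc)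
restr-compl (1 ∷ e) (x ∷ xs) (z ∷ zs) p q h =
  cong₂ _∷_ (trans (cong (_∸ x) (h 0)) (ℕP.m+n∸m≡n x z)) (restr-compl e xs zs (ℕP.suc-injective p) (ℕP.suc-injective q) (h ∘ suc))
restr-compl (suc (suc _) ∷ e) (x ∷ xs) (z ∷ zs) p q h =
  restr-compl e xs zs (ℕP.suc-injective p) (ℕP.suc-injective q) (h ∘ suc)

restr-nth : ∀ e s x {η} → length x ≡ length e → η ≡ pos s (map is1 e) → (a : Fin (length η)) →
  ∃ λ p → lookup η a ≡ p + s × nth e p ≡ 1 × nth (restr e x) (toℕ a) ≡ nth x p
restr-nth (0 ∷ e) s (x ∷ xs) l refl a with restr-nth e (suc s) xs (ℕP.suc-injective l) refl a
... | p , q , r , t = suc p , trans q (ℕP.+-suc p s) , r , t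
restr-nth (1 ∷ e) s (x ∷ xs) l refl Fin.zero = 0 , refl , refl , refl
restr-nth (1 ∷ e) s (x ∷ xs) l refl (Fin.suc a) with restr-nth e (suc s) xs (ℕP.suc-injective l) refl a
... | p , q , r , t = suc p , trans q (ℕP.+-suc p s) , r , t
restr-nth (suc (suc _) ∷ e) s (x ∷ xs) l refl a with restr-nth e (suc s) xs (ℕP.suc-injective l) refl a
... | p , q , r , t = suc p , trans q (ℕP.+-suc p s) , r , t

nth-map : ∀ (f : ℕ → ℕ) → f 0 ≡ 0 → ∀ e j → nth (map f e) j ≡ f (nth e j)
nth-map f h [] j = sym h
nth-map f h (x ∷ e) zero = refl
nth-map f h (x ∷ e) (suc j) = nth-map f h e j

nth-compl : ∀ v j → j < length v → nth (compl v) j ≡ 1 ∸ nth v j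
nth-compl (x ∷ v) zero _ = refl
nth-compl (x ∷ v) (suc j) (s≤s h) = nth-compl v j h

nth-tab : ∀ (f : ℕ → ℕ) n → (∀ j → n ≤ j → f j ≡ 0) → ∀ j → nth (applyUpTo f n) j ≡ f j
nth-tab f zero h j = sym (h j z≤n)
nth-tab f (suc n) h zero = refl
nth-tab f (suc n) h (suc j) = nth-tab (f ∘ suc) n (λ i p → h (suc i) (s≤s p)) j

-- Strictly increasing lists and their indicators

sortL-sorted : ∀ {L} → Linked _<_ L → sortL L ≡ L
sortL-sorted [] = refl
sortL-sorted [-] = refl
sortL-sorted {x ∷ L} (x<y ∷ h) rewrite sortL-sorted h | ≤ᵇ-complete (ℕP.<⇒≤ x<y) = refl

sorted≡pos : ∀ {L} → Linked _<_ L → All (1 ≤_) L → ∀ e → (∀ j → occ (suc j) L ≡ nth e j) → L ≡ pos 1 e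
sorted≡pos {L} s h e eq = trans (sym (sortL-sorted s)) (trans (sortL-pos L h)
  (pos-ext 1 (xExp L) e λ j → trans (nth-xExp L h j) (eq j)))

StrictInc-unique : ∀ {L} → StrictInc L → Unique L
StrictInc-unique s = AllPairs.map ℕP.<⇒≢ (LinkedP.Linked⇒AllPairs ℕP.<-trans s)

memB-complete : ∀ {x L} → x ∈ L → memB x L ≡ true
memB-complete {x} (here refl) rewrite ≡ᵇ-refl x = refl
memB-complete {x} {y ∷ L} (there h) rewrite memB-complete h = BP.∨-zeroʳ (y ≡ᵇ x)

memB-sound : ∀ x L → memB x L ≡ true → x ∈ L
memB-sound x (y ∷ L) h with y ≡ᵇ x in eq
... | true = here (sym (≡ᵇ-sound y x eq))
... | false = there (memB-sound x L h)

ind-∈ : ∀ {x L} → x ∈ L → ind x L ≡ 1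
ind-∈ h rewrite memB-complete h = refl

ind-∉ : ∀ x L → ¬ x ∈ L → ind x L ≡ 0
ind-∉ x L h with memB x L in eq
... | true = ⊥-elim (h (memB-sound x L eq))
... | false = refl

∈-ind : ∀ x L → ind x L ≡ 1 → x ∈ L
∈-ind x L h with memB x L in eq
... | true = memB-sound x L eq

ind≡occ : ∀ x L → occ x L ≤ 1 → ind x L ≡ occ x L
ind≡occ x L h with memB x L in eq
... | true = ℕP.≤-antisym (occ-∈ (memB-sound x L eq)) h
... | false = sym (zero-occ (occ x L) λ p → true≢false (trans (sym (memB-complete (∈-occ x L p))) eq))
  where
  zero-occ : ∀ n → ¬ 1 ≤ n → n ≡ 0
  zero-occ zero _ = refl
  zero-occ (suc n) h = ⊥-elim (h (s≤s z≤n))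

ind-pos : ∀ {x} → Bits x → ∀ j → ind (suc j) (pos 1 x) ≡ nth x j
ind-pos {x} b j = trans (ind≡occ (suc j) (pos 1 x) (subst (_≤ 1) (sym (occ-pos₁ x j)) (bits-nth b j))) (occ-pos₁ x j)

two-ones : ∀ {n} v → length v ≡ n → (c d : Fin n) → c Fin.< d →
  (∀ a → a ≡ c ⊎ a ≡ d → nth v (toℕ a) ≡ 1) → (∀ a → ¬ a ≡ c → ¬ a ≡ d → nth v (toℕ a) ≡ 0) →
  pos 1 v ≡ suc (toℕ c) ∷ suc (toℕ d) ∷ []
two-ones {n} v lv c d c<d one none = sym (sorted≡pos (s≤s c<d ∷ [-]) (s≤s z≤n ∷ s≤s z≤n ∷ []) v at)
  where
  hit : ∀ x → (if x ≡ᵇ x then 1 else 0) ≡ 1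
  hit x rewrite ≡ᵇ-refl x = refl
  miss : ∀ x j → ¬ x ≡ j → (if x ≡ᵇ j then 1 else 0) ≡ 0
  miss x j h rewrite ≡ᵇ-false x j h = refl
  at : ∀ j → (if toℕ c ≡ᵇ j then 1 else 0) + ((if toℕ d ≡ᵇ j then 1 else 0) + 0) ≡ nth v j
  at j with j ℕP.<? n
  ... | no j≮n = trans (cong₂ _+_ (miss (toℕ c) j λ { refl → j≮n (FinP.toℕ<n c) }) (cong (_+ 0) (miss (toℕ d) j λ { refl → j≮n (FinP.toℕ<n d) })))
          (sym (nth-beyond v j (subst (_≤ j) (sym lv) (ℕP.≮⇒≥ j≮n))))
  ... | yes j<n with Fin.fromℕ< j<n | FinP.toℕ-fromℕ< j<n
  ...   | a | refl with a FinP.≟ c | a FinP.≟ d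
  ...     | yes refl | _ = trans (cong₂ _+_ (hit (toℕ a)) (cong (_+ 0) (miss (toℕ d) (toℕ a) λ eq → ℕP.<-irrefl (sym eq) c<d))) (sym (one a (inj₁ refl)))
  ...     | no _ | yes refl = trans (cong₂ _+_ (miss (toℕ c) (toℕ a) λ eq → ℕP.<-irrefl eq c<d) (cong (_+ 0) (hit (toℕ a)))) (sym (one a (inj₂ refl)))
  ...     | no a≢c | no a≢d = trans (cong₂ _+_ (miss (toℕ c) (toℕ a) λ eq → a≢c (sym (FinP.toℕ-injective eq)))
              (cong (_+ 0) (miss (toℕ d) (toℕ a) λ eq → a≢d (sym (FinP.toℕ-injective eq))))) (sym (none a a≢c a≢d))

coeff-resp : ∀ P {e e'} t → (∀ j → nth e j ≡ nth e' j) → coeff P (e , t) ≡ coeff P (e' , t)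
coeff-resp [] t h = refl
coeff-resp ((c , (ν , τ)) ∷ P) {e} {e'} t h =
  cong₂ (λ b z → (if b ∧ eqE τ t then c else + 0) ℤ.+ z) (eqE-cong {ν} {ν} {e} {e'} (λ _ → refl) h) (coeff-resp P {e} {e'} t h)

IsP-≥1 : ∀ {B ws P} → IsP B ws P → All (1 ≤_) ws
IsP-≥1 base = []
IsP-≥1 (step i i≥1 _ p _) = i≥1 ∷ IsP-≥1 p

<-bound : ∀ ws → All (_< bound ws) ws
<-bound [] = []
<-bound (i ∷ ws) = s≤s (ℕP.m≤m⊔n i (maxL ws)) ∷
  All.map (λ h → ℕP.<-≤-trans h (s≤s (ℕP.m≤n⊔m i (maxL ws)))) (<-bound ws)

lookup-injective : ∀ {L : List ℕ} → Unique L → ∀ i j → lookup L i ≡ lookup L j → i ≡ j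
lookup-injective (h ∷ u) Fin.zero Fin.zero eq = refl
lookup-injective {_ ∷ L} (h ∷ u) Fin.zero (Fin.suc j) eq = ⊥-elim (All.lookup h (∈P.∈-lookup {xs = L} j) eq)
lookup-injective {_ ∷ L} (h ∷ u) (Fin.suc i) Fin.zero eq = ⊥-elim (All.lookup h (∈P.∈-lookup {xs = L} i) (sym eq))
lookup-injective (h ∷ u) (Fin.suc i) (Fin.suc j) eq = cong Fin.suc (lookup-injective u i j eq)

-- The coefficient in terms of the four indices

module _ {B : ℕ} {ws : List ℕ} (ws≥1 : All (1 ≤_) ws) (ws<B : All (_< B) ws)
  {η₁ η₂ : List ℕ} (inc₁ : StrictInc η₁) (inc₂ : StrictInc η₂) (disj : Disjoint η₁ η₂)
  {k l : ℕ} (k<l : k < l) (inB : InB B (perm ws) k l η₁ η₂) where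

  private
    R : ℕ
    R = l + B

    e : Exp
    e = applyUpTo (λ j → cnt η₁ η₂ (suc j)) R

    Pos : List ℕ → Exp → Set
    Pos α x = Bits x × length x ≡ R × α ≡ pos 1 x

    -- The enumeration yields vectors of length m + B; padding gives all of them the length of `e`,
    -- so that members of A_k(w) and A_l(w) can be added and restricted together.
    A-vec : ∀ {m α} → m ≤ l → α ∈ A B (perm ws) m → ∃ (Pos α)
    A-vec {m} {α} m≤l α∈ with choose-sound m (m + B) 1
      (subst (λ z → α ∈ choose m z) (range-upFrom (m + B)) (proj₁ (filterB-∈⁻ _ (choose m (range (m + B))) α∈)))
    ... | x , b , lx , refl = applyUpTo (nth x) R , nth-bits _ (λ j → subst (_≤ 1) (sym (at j)) (bits-nth b j)) ,
        LP.length-applyUpTo (nth x) R , pos-ext 1 x (applyUpTo (nth x) R) (λ j → sym (at j))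
      where
      at : ∀ j → nth (applyUpTo (nth x) R) j ≡ nth x j
      at = nth-tab (nth x) R λ j h → nth-beyond x j (subst (_≤ j) (sym lx) (ℕP.≤-trans (ℕP.+-monoˡ-≤ B m≤l) h))

    α β : List ℕ
    α = proj₁ inB
    β = proj₁ (proj₂ (proj₂ inB))

    α∈ : α ∈ A B (perm ws) l
    α∈ = proj₁ (proj₂ (proj₂ (proj₂ (proj₂ inB))))

    β∈ : β ∈ A B (perm ws) k
    β∈ = proj₁ (proj₂ (proj₂ (proj₂ (proj₂ (proj₂ (proj₂ inB))))))

    α+β : IsSum η₁ η₂ α β
    α+β = proj₁ (proj₂ (proj₂ (proj₂ (proj₂ (proj₂ (proj₂ (proj₂ (proj₂ inB))))))))

    x : Exp
    x = proj₁ (A-vec ℕP.≤-refl α∈)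
    x-bits = proj₁ (proj₂ (A-vec ℕP.≤-refl α∈))
    x-length = proj₁ (proj₂ (proj₂ (A-vec ℕP.≤-refl α∈)))
    x-pos : α ≡ pos 1 x
    x-pos = proj₂ (proj₂ (proj₂ (A-vec ℕP.≤-refl α∈)))

    z : Exp
    z = proj₁ (A-vec (ℕP.<⇒≤ k<l) β∈)
    z-bits = proj₁ (proj₂ (A-vec (ℕP.<⇒≤ k<l) β∈))
    z-length = proj₁ (proj₂ (proj₂ (A-vec (ℕP.<⇒≤ k<l) β∈)))
    z-pos : β ≡ pos 1 z
    z-pos = proj₂ (proj₂ (proj₂ (A-vec (ℕP.<⇒≤ k<l) β∈)))

    cnt-sum : ∀ j → cnt η₁ η₂ (suc j) ≡ nth x j + nth z j
    cnt-sum j = trans (α+β (suc j)) (cong₂ _+_ (trans (cong (ind (suc j)) x-pos) (ind-pos x-bits j))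
      (trans (cong (ind (suc j)) z-pos) (ind-pos z-bits j)))

    -- Cutting `e` off at `R` loses nothing, because η is a sum of two sets whose vectors have
    -- length `R`.
    e-cnt : ∀ j → nth e j ≡ cnt η₁ η₂ (suc j)
    e-cnt = nth-tab _ R λ j h → trans (cnt-sum j)
      (cong₂ _+_ (nth-beyond x j (subst (_≤ j) (sym x-length) h)) (nth-beyond z j (subst (_≤ j) (sym z-length) h)))

    e-sum : ∀ j → nth e j ≡ nth x j + nth z j
    e-sum j = trans (e-cnt j) (cnt-sum j)

    e-length : length e ≡ R
    e-length = LP.length-applyUpTo _ R

    e≤2 : All (_≤ 2) e
    e≤2 = AllP.applyUpTo⁺₂ _ R λ j → subst (_≤ 2) (sym (cnt-sum j)) (ℕP.+-mono-≤ (bits-nth x-bits j) (bits-nth z-bits j))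

    ¬0∈ : ∀ {y} → Bits y → ind 0 (pos 1 y) ≡ 0
    ¬0∈ {y} b = ind-∉ 0 (pos 1 y) λ h → ℕP.<-irrefl refl (All.lookup (All-pos 1 y) h)

    cnt-0 : ind 0 η₁ + 2 * ind 0 η₂ ≡ 0
    cnt-0 = trans (α+β 0) (cong₂ _+_ (trans (cong (ind 0) x-pos) (¬0∈ x-bits)) (trans (cong (ind 0) z-pos) (¬0∈ z-bits)))

    -- The value 0 is ruled out by η = α + β, since α and β come from the enumeration of positive
    -- entries.
    η₁≥1 : All (1 ≤_) η₁
    η₁≥1 = All.tabulate λ { {zero} h → ⊥-elim (one≢zero (trans (sym (ind-∈ h)) (ℕP.m+n≡0⇒m≡0 (ind 0 η₁) cnt-0))) ; {suc _} _ → s≤s z≤n }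
      where
      one≢zero : ¬ 1 ≡ 0
      one≢zero ()

    η₂≥1 : All (1 ≤_) η₂
    η₂≥1 = All.tabulate λ { {zero} h → ⊥-elim (two≢zero (trans (cong (2 *_) (sym (ind-∈ h))) (ℕP.m+n≡0⇒n≡0 (ind 0 η₁) cnt-0))) ; {suc _} _ → s≤s z≤n }
      where
      two≢zero : ¬ 2 ≡ 0
      two≢zero ()

    ind-occ₁ : ∀ j → ind j η₁ ≡ occ j η₁
    ind-occ₁ j = ind≡occ j η₁ (occ-unique j (StrictInc-unique inc₁))

    ind-occ₂ : ∀ j → ind j η₂ ≡ occ j η₂
    ind-occ₂ j = ind≡occ j η₂ (occ-unique j (StrictInc-unique inc₂))

    data Place (y : ℕ) : ℕ → Set where
      neither : ¬ y ∈ η₁ → ¬ y ∈ η₂ → Place y 0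
      once : y ∈ η₁ → ¬ y ∈ η₂ → Place y 1
      twice : ¬ y ∈ η₁ → y ∈ η₂ → Place y 2

    place : ∀ y → Place y (cnt η₁ η₂ y)
    place y with memB y η₁ in p | memB y η₂ in q
    ... | true | true = ⊥-elim (disj y (memB-sound y η₁ p) (memB-sound y η₂ q))
    ... | true | false = once (memB-sound y η₁ p) λ h → true≢false (trans (sym (memB-complete h)) q)
    ... | false | true = twice (λ h → true≢false (trans (sym (memB-complete h)) p)) (memB-sound y η₂ q)
    ... | false | false = neither (λ h → true≢false (trans (sym (memB-complete h)) p)) λ h → true≢false (trans (sym (memB-complete h)) q)

    η₁-ones : η₁ ≡ pos 1 (map is1 e)
    η₁-ones = sorted≡pos inc₁ η₁≥1 (map is1 e) λ j → trans (sym (ind-occ₁ (suc j)))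
      (trans (go (place (suc j))) (sym (trans (nth-map is1 refl e j) (cong is1 (e-cnt j)))))
      where
      go : ∀ {y n} → Place y n → ind y η₁ ≡ is1 n
      go (neither p _) = ind-∉ _ η₁ p
      go (once p _) = ind-∈ p
      go (twice p _) = ind-∉ _ η₁ p

    n≡ : length η₁ ≡ #1 e
    n≡ = trans (cong length η₁-ones) (length-pos-is1 1 e)

    between-sum : ∀ {y y'} → Bits y → Bits y' → (∀ j → nth e j ≡ nth y j + nth y' j) → Between e y
    between-sum {y} {y'} b b' h j = (λ p → ℕP.m+n≡0⇒m≡0 (nth y j) (trans (sym (h j)) p)) , λ p →
      two (bits-nth b j) (bits-nth b' j) (trans (sym (h j)) p)
      where
      two : ∀ {m n} → m ≤ 1 → n ≤ 1 → m + n ≡ 2 → m ≡ 1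
      two {1} _ _ _ = refl
      two {0} {suc (suc _)} _ (s≤s ()) _
      two {suc (suc _)} (s≤s ()) _ _

    between⇒Aη : ∀ {m y} → Bits y → Between e y → pos 1 y ∈ A B (perm ws) m → InAη B (perm ws) m η₁ η₂ (pos 1 y)
    between⇒Aη {m} {y} b h y∈ = y∈ , contains , within
      where
      contains : ∀ t → t ∈ η₂ → t ∈ pos 1 y
      contains zero t∈ = ⊥-elim (ℕP.<-irrefl refl (All.lookup η₂≥1 t∈))
      contains (suc j) t∈ = ∈-ind (suc j) (pos 1 y) (trans (ind-pos b j) (proj₂ (h j) (trans (e-cnt j) (go (place (suc j))))))
        where
        go : ∀ {n} → Place (suc j) n → n ≡ 2
        go (neither _ p) = ⊥-elim (p t∈)
        go (once _ p) = ⊥-elim (p t∈)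
        go (twice _ _) = refl
      within : ∀ t → t ∈ pos 1 y → t ∈ η₁ ⊎ t ∈ η₂
      within zero t∈ = ⊥-elim (ℕP.<-irrefl refl (All.lookup (All-pos 1 y) t∈))
      within (suc j) t∈ = go refl (place (suc j))
        where
        go : ∀ {n} → cnt η₁ η₂ (suc j) ≡ n → Place (suc j) n → suc j ∈ η₁ ⊎ suc j ∈ η₂
        go eq (neither _ _) = ⊥-elim (one≢zero (trans (sym (ind-∈ t∈)) (trans (ind-pos b j) (proj₁ (h j) (trans (e-cnt j) eq)))))
          where
          one≢zero : ¬ 1 ≡ 0
          one≢zero ()
        go _ (once p _) = inj₁ p
        go _ (twice _ p) = inj₂ p

    Aη⇒between : ∀ {m y} → Bits y → InAη B (perm ws) m η₁ η₂ (pos 1 y) → Between e y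
    Aη⇒between {m} {y} b (_ , contains , within) j = (λ p → zero-case (place (suc j)) (trans (sym (e-cnt j)) p)) ,
      λ p → two-case (place (suc j)) (trans (sym (e-cnt j)) p)
      where
      zero-case : ∀ {n} → Place (suc j) n → n ≡ 0 → nth y j ≡ 0
      zero-case (neither p q) _ = trans (sym (ind-pos b j)) (ind-∉ (suc j) (pos 1 y) λ h → outside (within (suc j) h))
        where
        outside : suc j ∈ η₁ ⊎ suc j ∈ η₂ → ⊥
        outside (inj₁ h) = p h
        outside (inj₂ h) = q h
      two-case : ∀ {n} → Place (suc j) n → n ≡ 2 → nth y j ≡ 1
      two-case (twice _ p) _ = trans (sym (ind-pos b j)) (ind-∈ (contains (suc j) p))

    record Top (m : ℕ) (γ : List ℕ) : Set where
      field
        g : Exp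
        g-bits : Bits g
        g-length : length g ≡ R
        g-pos : γ ≡ pos 1 g
        dominates : ∀ {v} → Bits v → length v ≡ #1 e → dom 0 (fill e v) (Y ws m) ≡ dom 0 v (nth (restr e g))
      top : Exp
      top = restr e g
      top-bits : Bits top
      top-bits = restr-bits e g-bits
      top-length : length top ≡ #1 e
      top-length = length-restr e g (trans g-length (sym e-length))

    -- A_m(w) is an order ideal, so lying below γ suffices for membership; maximality of γ gives the
    -- converse. As all sets concerned contain η₂ and stay inside η₁ and η₂, the comparison can be
    -- made along η₁ alone.
    max-top : ∀ {m γ} → m ≤ l → IsMaxAη B (perm ws) m η₁ η₂ γ → Top m γ
    max-top {m} {γ} m≤l (γ∈ , max) with A-vec m≤l (proj₁ γ∈)
    ... | g , bg , lg , refl = record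
      { g = g ; g-bits = bg ; g-length = lg ; g-pos = refl
      ; dominates = λ {v} bv lv → trans (bool-ext (up bv) (down bv)) (same bv lv) }
      where
      between : Between e g
      between = Aη⇒between {m} bg γ∈
      refill : fill e (restr e g) ≡ g
      refill = fill-restr e≤2 g (trans lg (sym e-length)) between
      long : ∀ v → length (fill e v) ≡ R
      long v = trans (length-fill e v) e-length
      enough : ∀ v → m + B ≤ length (fill e v)
      enough v = subst (m + B ≤_) (sym (long v)) (ℕP.+-monoˡ-≤ B m≤l)
      up : ∀ {v} → Bits v → dom 0 (fill e v) (Y ws m) ≡ true → leqB (pos 1 (fill e v)) (pos 1 g) ≡ true
      up {v} bv h = Pointwise⇒leqB (max _ (between⇒Aη {m} (fill-bits e bv) (fill-between e v)
        (A-complete ws≥1 ws<B m (fill-bits e bv) (enough v) h)))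
      down : ∀ {v} → Bits v → leqB (pos 1 (fill e v)) (pos 1 g) ≡ true → dom 0 (fill e v) (Y ws m) ≡ true
      down {v} bv h = trans (sym (leqB-wup ws≥1 ws<B m (fill-bits e bv) (enough v)))
        (leqB-trans (pos 1 (fill e v)) (pos 1 g) (wup (perm ws) m) h (proj₂ (A-bits ws≥1 ws<B m (proj₁ γ∈))))
      same : ∀ {v} → Bits v → length v ≡ #1 e → leqB (pos 1 (fill e v)) (pos 1 g) ≡ dom 0 v (nth (restr e g))
      same {v} bv lv = trans (leqB-pos 1 (fill-bits e bv) bg (ℕP.≤-reflexive (trans lg (sym (long v)))))
        (trans (cong (λ y → dom 0 (fill e v) (nth y)) (sym refill))
          (dom-fill e 0 v (restr e g) lv (length-restr e g (trans lg (sym e-length)))))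

    at-lookup : ∀ {y} → Bits y → length y ≡ R → (i : Fin (length η₁)) → ∃ λ p →
      lookup η₁ i ≡ suc p × cnt η₁ η₂ (suc p) ≡ 1 × nth (restr e y) (toℕ i) ≡ ind (suc p) (pos 1 y)
    at-lookup {y} b ly i with restr-nth e 1 y (trans ly (sym e-length)) η₁-ones i
    ... | p , q , r , t = p , trans q (ℕP.+-comm p 1) , trans (sym (e-cnt p)) r , trans t (sym (ind-pos b p))

    chosen : ∀ v → length v ≡ #1 e → (δ : List ℕ) (c d : Fin (length η₁)) → c Fin.< d →
      (∀ y → y ∈ δ ⇔ (y ∈ η₂ ⊎ (y ≡ lookup η₁ c ⊎ y ≡ lookup η₁ d))) →
      (∀ i → nth v (toℕ i) ≡ ind (lookup η₁ i) δ) → pos 1 v ≡ suc (toℕ c) ∷ suc (toℕ d) ∷ []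
    chosen v lv δ c d c<d iff h = two-ones v (trans lv (sym n≡)) c d c<d one none
      where
      one : ∀ i → i ≡ c ⊎ i ≡ d → nth v (toℕ i) ≡ 1
      one i (inj₁ refl) = trans (h i) (ind-∈ (Equivalence.from (iff _) (inj₂ (inj₁ refl))))
      one i (inj₂ refl) = trans (h i) (ind-∈ (Equivalence.from (iff _) (inj₂ (inj₂ refl))))
      none : ∀ i → ¬ i ≡ c → ¬ i ≡ d → nth v (toℕ i) ≡ 0
      none i i≢c i≢d = trans (h i) (ind-∉ (lookup η₁ i) δ λ y∈ → absurd (Equivalence.to (iff _) y∈))
        where
        absurd : lookup η₁ i ∈ η₂ ⊎ (lookup η₁ i ≡ lookup η₁ c ⊎ lookup η₁ i ≡ lookup η₁ d) → ⊥
        absurd (inj₁ y∈) = disj _ (∈P.∈-lookup {xs = η₁} i) y∈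
        absurd (inj₂ (inj₁ eq)) = i≢c (lookup-injective (StrictInc-unique inc₁) i c eq)
        absurd (inj₂ (inj₂ eq)) = i≢d (lookup-injective (StrictInc-unique inc₁) i d eq)

    target-e : ∀ j → nth (proj₁ (target η₁ η₂ k l)) j ≡ nth e j
    target-e j = trans (nth-addE (xExp η₁) (addE (xExp η₂) (xExp η₂)) j) (trans
      (cong₂ _+_ (at₁ j) (trans (nth-addE (xExp η₂) (xExp η₂) j) (cong₂ _+_ (at₂ j) (trans (at₂ j) (sym (ℕP.+-identityʳ _))))))
      (sym (e-cnt j)))
      where
      at₁ : ∀ j → nth (xExp η₁) j ≡ ind (suc j) η₁
      at₁ j = trans (nth-xExp η₁ η₁≥1 j) (sym (ind-occ₁ (suc j)))
      at₂ : ∀ j → nth (xExp η₂) j ≡ ind (suc j) η₂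
      at₂ j = trans (nth-xExp η₂ η₂≥1 j) (sym (ind-occ₂ (suc j)))

  coeff-target : 1 ≤ k → (αmax : List ℕ) → IsMaxAη B (perm ws) l η₁ η₂ αmax →
    (βmax : List ℕ) → IsMaxAη B (perm ws) k η₁ η₂ βmax →
    (βmin : List ℕ) → IsSum η₁ η₂ αmax βmin →
    (a b c d : Fin (length η₁)) → a Fin.< b → c Fin.< d →
    (∀ x → x ∈ βmin ⇔ (x ∈ η₂ ⊎ (x ≡ lookup η₁ a ⊎ x ≡ lookup η₁ b))) →
    (∀ x → x ∈ βmax ⇔ (x ∈ η₂ ⊎ (x ≡ lookup η₁ c ⊎ x ≡ lookup η₁ d))) →
    (P : Poly) → IsP B ws P →
    coeff P (target η₁ η₂ k l) ≡ - ((+ toℕ d) - (+ toℕ a) ℤ.+ + 1 - + (toℕ b ∸ toℕ c))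
  coeff-target k≥1 αmax maxα βmax maxβ βmin sum a b c d a<b c<d iffα iffβ P isP = begin
    coeff P (target η₁ η₂ k l)
      ≡⟨ coeff-resp P {e' = e} _ target-e ⟩
    coeff P (e , addE (tExp k) (tExp l))
      ≡⟨ Slices.quadratic (P-slices k≥1 k<l B isP ws≥1 ws<B) e _ (ℕP.≤-reflexive (sym e-length))
           (λ j → trans (nth-addE (tExp k) (tExp l) j) (cong₂ _+_ (nth-tExp k j) (nth-tExp l j))) ⟩
    𝕄 ws k l e ℤ.+ S (λ _ → + 0) (λ _ → + 0) e
      ≡⟨ trans (cong (λ t → 𝕄 ws k l e ℤ.+ t) (S-zeroˡ (λ _ → refl) e)) (ℤP.+-identityʳ _) ⟩
    W κ μ e 0 - S κ μ e
      ≡⟨ cong₂ _-_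
           (trans (W-fill e≤2 κ μ 0) (W-cong-bits (𝟏 n) 0 (λ bv lv → κ-th bv (trans lv 𝟏-length)) (λ bv lv → μ-co bv (trans lv 𝟏-length))))
           (trans (S-fill e≤2 κ μ) (S-cong-bits (𝟏 n) (λ bv lv → κ-th bv (trans lv 𝟏-length)) (λ bv lv → μ-co bv (trans lv 𝟏-length)))) ⟩
    W (th C) (co A₀) (𝟏 n) 0 - S (th C) (co A₀) (𝟏 n)
      ≡⟨ antisym (W (th C) (co A₀) (𝟏 n) 0) (S (th C) (co A₀) (𝟏 n)) ⟩
    - (S (th C) (co A₀) (𝟏 n) - W (th C) (co A₀) (𝟏 n) 0)
      ≡⟨ cong -_ (count (toℕ a) n (toℕ b) (toℕ c) (toℕ d) a<b a≤c c<d b≤d (subst (toℕ d <_) n≡ (FinP.toℕ<n d))) ⟩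
    - ((+ toℕ d) - (+ toℕ a) ℤ.+ + 1 - + (toℕ b ∸ toℕ c)) ∎
    where
    open ≡-Reasoning
    n = #1 e
    κ = 𝔻 (Y ws k)
    μ = 𝔻 (Y ws l)
    C A₀ : List ℕ
    C = suc (toℕ c) ∷ suc (toℕ d) ∷ []
    A₀ = toℕ a ∷ toℕ b ∷ []
    𝟏-length : length (𝟏 n) ≡ n
    𝟏-length = LP.length-replicate n
    antisym : ∀ w s → w ℤ.- s ≡ ℤ.- (s ℤ.- w)
    antisym = solve-∀
    module α⁺ = Top (max-top ℕP.≤-refl maxα)
    module β⁺ = Top (max-top (ℕP.<⇒≤ k<l) maxβ)

    β⁺-pos : pos 1 β⁺.top ≡ C
    β⁺-pos = chosen β⁺.top β⁺.top-length βmax c d c<d iffβ λ i → at i (at-lookup β⁺.g-bits β⁺.g-length i)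
      where
      at : ∀ i → (∃ λ p → lookup η₁ i ≡ suc p × cnt η₁ η₂ (suc p) ≡ 1 × nth β⁺.top (toℕ i) ≡ ind (suc p) (pos 1 β⁺.g)) →
        nth β⁺.top (toℕ i) ≡ ind (lookup η₁ i) βmax
      at i (p , q , _ , t) = trans t (cong₂ ind (sym q) (sym β⁺.g-pos))

    -- Each element of η₁ lies in exactly one of α_max and β_min, so along η₁ the complement of the
    -- former is the latter.
    α⁺-pos : pos 1 (compl α⁺.top) ≡ map suc A₀
    α⁺-pos = chosen (compl α⁺.top) (trans (LP.length-map (1 ∸_) α⁺.top) α⁺.top-length) βmin a b a<b iffα λ i →
      at i (at-lookup α⁺.g-bits α⁺.g-length i)
      where
      at : ∀ i → (∃ λ p → lookup η₁ i ≡ suc p × cnt η₁ η₂ (suc p) ≡ 1 × nth α⁺.top (toℕ i) ≡ ind (suc p) (pos 1 α⁺.g)) →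
        nth (compl α⁺.top) (toℕ i) ≡ ind (lookup η₁ i) βmin
      at i (p , q , r , t) = trans (nth-compl α⁺.top (toℕ i) (subst (toℕ i <_) (trans n≡ (sym α⁺.top-length)) (FinP.toℕ<n i)))
        (trans (cong (1 ∸_) (trans t (cong (ind (suc p)) (sym α⁺.g-pos))))
          (trans (trans (cong (_∸ ind (suc p) αmax) (trans (sym r) (sum (suc p)))) (ℕP.m+n∸m≡n (ind (suc p) αmax) (ind (suc p) βmin)))
            (cong (λ y → ind y βmin) (sym q))))

    κ-dom : ∀ {v} → Bits v → length v ≡ n → dom 0 (fill e v) (Y ws k) ≡ leqB (pos 1 v) C
    κ-dom {v} bv lv = trans (β⁺.dominates bv lv)
      (trans (sym (leqB-pos 1 bv β⁺.top-bits (ℕP.≤-reflexive (trans β⁺.top-length (sym lv))))) (cong (leqB (pos 1 v)) β⁺-pos))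

    μ-dom : ∀ {v} → Bits v → length v ≡ n → dom 0 (fill e v) (Y ws l) ≡ leqB (map suc A₀) (pos 1 (compl v))
    μ-dom {v} bv lv = trans (α⁺.dominates bv lv) (trans (dom-compl 0 bv α⁺.top-bits (trans lv (sym α⁺.top-length)))
      (trans (sym (leqB-pos 1 (compl-bits α⁺.top-bits) (compl-bits bv) (ℕP.≤-reflexive (trans (LP.length-map (1 ∸_) v)
          (trans lv (sym (trans (LP.length-map (1 ∸_) α⁺.top) α⁺.top-length)))))))
        (cong (λ y → leqB y (pos 1 (compl v))) α⁺-pos)))

    κ-th : ∀ {v} → Bits v → length v ≡ n → κ (fill e v) ≡ th C v
    κ-th bv lv = trans (cong ⟦_⟧ (κ-dom bv lv)) (sym (th-leqB C bv))

    μ-co : ∀ {v} → Bits v → length v ≡ n → μ (fill e v) ≡ co A₀ v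
    μ-co bv lv = trans (cong ⟦_⟧ (μ-dom bv lv)) (sym (co-leqB A₀ bv))

    z-between : Between e z
    z-between = between-sum z-bits x-bits λ j → trans (e-sum j) (ℕP.+-comm (nth x j) (nth z j))

    x-between : Between e x
    x-between = between-sum x-bits z-bits e-sum

    β-below : leqB (pos 1 (restr e z)) C ≡ true
    β-below = trans (sym (κ-dom (restr-bits e z-bits) (length-restr e z (trans z-length (sym e-length)))))
      (trans (cong (λ y → dom 0 y (Y ws k)) (fill-restr e≤2 z (trans z-length (sym e-length)) z-between))
        (trans (sym (leqB-wup ws≥1 ws<B k z-bits (subst (k + B ≤_) (sym z-length) (ℕP.+-monoˡ-≤ B (ℕP.<⇒≤ k<l)))))
          (trans (cong (λ y → leqB y (wup (perm ws) k)) (sym z-pos)) (proj₂ (A-bits ws≥1 ws<B k β∈)))))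

    α-below : leqB (map suc A₀) (pos 1 (restr e z)) ≡ true
    α-below = trans (cong (λ y → leqB (map suc A₀) (pos 1 y))
        (sym (restr-compl e x z (trans x-length (sym e-length)) (trans z-length (sym e-length)) e-sum)))
      (trans (sym (μ-dom (restr-bits e x-bits) (length-restr e x (trans x-length (sym e-length)))))
        (trans (cong (λ y → dom 0 y (Y ws l)) (fill-restr e≤2 x (trans x-length (sym e-length)) x-between))
          (trans (sym (leqB-wup ws≥1 ws<B l x-bits (ℕP.≤-reflexive (sym x-length))))
            (trans (cong (λ y → leqB y (wup (perm ws) l)) (sym x-pos)) (proj₂ (A-bits ws≥1 ws<B l α∈))))))

    -- Any splitting η = α + β provides an intermediate set: α ≤ α_max gives β_min ≤ β by
    -- complementation, and β ≤ β_max. Entrywise along η₁ this yields a ≤ c and b ≤ d.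
    ab≤cd : leqB (map suc A₀) C ≡ true
    ab≤cd = leqB-trans (map suc A₀) (pos 1 (restr e z)) C α-below β-below

    a≤c : toℕ a ≤ toℕ c
    a≤c = ℕP.≤-pred (≤ᵇ-sound (suc (toℕ a)) (suc (toℕ c)) (proj₁ (∧-elim ab≤cd)))

    b≤d : toℕ b ≤ toℕ d
    b≤d = ℕP.≤-pred (≤ᵇ-sound (suc (toℕ b)) (suc (toℕ d))
      (proj₁ (∧-elim (proj₂ (∧-elim {suc (toℕ a) ≤ᵇ suc (toℕ c)} ab≤cd)))))

theorem5p5 : (ws : List ℕ) (k l : ℕ) (η₁ η₂ : List ℕ) →
    k < l →
    StrictInc η₁ → StrictInc η₂ → Disjoint η₁ η₂ →
    InB (bound ws) (perm ws) k l η₁ η₂ →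
    length η₁ + 2 * length η₂ ≡ k + l →
    k ≡ length η₂ + 2 →
    (αmax : List ℕ) → IsMaxAη (bound ws) (perm ws) l η₁ η₂ αmax →
    (βmax : List ℕ) → IsMaxAη (bound ws) (perm ws) k η₁ η₂ βmax →
    (βmin : List ℕ) → IsSum η₁ η₂ αmax βmin →
    (a b c d : Fin (length η₁)) → a Fin.< b → c Fin.< d →
    (∀ x → x ∈ βmin ⇔ (x ∈ η₂ ⊎ (x ≡ lookup η₁ a ⊎ x ≡ lookup η₁ b))) →
    (∀ x → x ∈ βmax ⇔ (x ∈ η₂ ⊎ (x ≡ lookup η₁ c ⊎ x ≡ lookup η₁ d))) →
    (P : Poly) → IsP (bound ws) ws P →
    coeff P (target η₁ η₂ k l)
    ≡ - ((+ toℕ d) - (+ toℕ a) ℤ.+ + 1 - + (toℕ b ∸ toℕ c))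
theorem5p5 ws k l η₁ η₂ k<l inc₁ inc₂ disj inB _ k≡ αmax maxα βmax maxβ βmin sum a b c d a<b c<d iffα iffβ P isP =
  coeff-target (IsP-≥1 isP) (<-bound ws) inc₁ inc₂ disj k<l inB
    (subst (1 ≤_) (sym k≡) (ℕP.≤-trans (s≤s z≤n) (ℕP.m≤n+m 2 (length η₂))))
    αmax maxα βmax maxβ βmin sum a b c d a<b c<d iffα iffβ P isP
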